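{- For any $\varepsilon>0$, there exists an algorithm for the problem $BV^{\min}$ that, given any instance that has a feasible solution, outputs a set $S$ of items whose total weight is at most the optimal weight of $BV^{\min}$, such that $$(1-\varepsilon)\,l_k^v\le\sum_{r\in S\cap V_k}v_r^{(k)}\le(1+\varepsilon)\,u_k^v\qquad\text{for all }k\in[m],$$ and the total value of the items in $S$ is at least $(1-\varepsilon)L$. The running time of the algorithm is $$O\!\left(\frac{n^2\,m\,\log^3 m\;\log_{1+\varepsilon}^{3}\!\left(\frac{N v_{\max}}{v_{\min}}\right)}{\varepsilon}\right),$$ where $v_{\min}=\min\{v_j^{(i)} : i\in[m],\ j\in V_i,\ v_j^{(i)}>0\}$ and $v_{\max}=\max\{v_j^{(i)} : i\in[m],\ j\in V_i\}$.
   Context: Items are partitioned into $m$ categories; $V_i$ is the set of items of category $i\in[m]=\{1,\dots,m\}$. Item $j\in V_i$ has a non-negative weight $w_j^{(i)}$ and a non-negative value $v_j^{(i)}$ (rational numbers). At least one item has positive value, so that $v_{\min}$ is defined. $n=\max_{i\in[m]}|V_i|$ and $N=\sum_i|V_i|$ is the total number of items. Problem $BV^{\min}$: given the items, bounds $0\le l_i^v\le u_i^v$ for each $i\in[m]$, and a value lower bound $L$, find a subset $S\subseteq\bigcup_i V_i$ minimizing the total weight $\sum_{i}\sum_{j\in S\cap V_i}w_j^{(i)}$ subject to $l_i^v\le\sum_{j\in S\cap V_i}v_j^{(i)}\le u_i^v$ for all $i\in[m]$ and $\sum_i\sum_{j\in S\cap V_i}v_j^{(i)}\ge L$. A feasible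 solution is a subset satisfying all these constraints; the optimal weight is the minimum total weight of a feasible solution. Running time counts elementary operations (arithmetic, comparison, rounding) on numbers, each at unit cost. Inside the $O(\cdot)$, each logarithmic factor $x$ is read as $\max\{1,x\}$ (so that the bound is meaningful e.g. for $m=1$).
   Formalization: The accuracy ε and the bounds l, u, L are taken to be rational rather than real numbers, and the value lower bound L is taken to be non-negative (for negative L and ε > 1 the claim would fail). The value lower bound L is assumed non-negative: for negative L and ε greater than 1 the claim can fail, as (1−ε)L is then positive and possibly unattainable; for ε at most 1 a negative L is equivalent to L = 0. ε is taken rational, which loses nothing. -}

module Defs where

open import Algebra.Properties.CommutativeMonoid.Sum using ()
open import Data.Bool.Base using (Bool; true; false; if_then_else_; _∧_; not)
open import Data.Fin.Base using (Fin; zero; suc; toℕ)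
open import Data.Fin.Subset using (Subset)
open import Data.Integer.Base as ℤ using (+_)
import Data.List.Base as List
import Data.List.Extrema
import Data.List.Extrema.Nat as Extremaℕ
import Data.Nat.ListAction as ListAction
open import Data.Nat.Base as ℕ using (ℕ; zero; suc; _≡ᵇ_; _<ᵇ_)
open import Data.Product.Base using (∃-syntax; _×_)
open import Data.Rational.Base as ℚ using (ℚ; 0ℚ; 1ℚ; ↥_; ↧ₙ_; _/_)
import Data.Rational.Properties as ℚ
open import Data.Vec.Base using (lookup; tabulate)
open import Function.Base using (_∘_)
open import Relation.Binary.Bundles using (DecTotalOrder)
open import Relation.Binary.PropositionalEquality using (_≡_)
open import Relation.Nullary.Decidable using (yes; no)

open Algebra.Properties.CommutativeMonoid.Sum ℚ.+-0-commutativeMonoid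
  using (sum) public
open import Algebra.Definitions.RawSemiring ℚ.+-*-rawSemiring
  using (_^_) public

module Extremaℚ =
  Data.List.Extrema (DecTotalOrder.totalOrder ℚ.≤-decTotalOrder)

fromℕ : ℕ → ℚ
fromℕ n = + n / 1

infixl 7 _÷₀_

-- Total division, with p ÷₀ 0 = 0.
_÷₀_ : ℚ → ℚ → ℚ
p ÷₀ q with q ℚ.≟ 0ℚ
... | yes _   = 0ℚ
... | no  q≢0 = ℚ._÷_ p q {{ℚ.≢-nonZero q≢0}}

record Instance : Set where
  field
    m    : ℕ
    size : Fin m → ℕ                       -- size i = |V_i|
    w v  : (i : Fin m) → Fin (size i) → ℚ
    l u  : Fin m → ℚ
    L    : ℚ
    w≥0  : ∀ i j → 0ℚ ℚ.≤ w i j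
    v≥0  : ∀ i j → 0ℚ ℚ.≤ v i j
    l≥0  : ∀ i → 0ℚ ℚ.≤ l i
    l≤u  : ∀ i → l i ℚ.≤ u i
    L≥0  : 0ℚ ℚ.≤ L
    someValuePositive : ∃[ i ] ∃[ j ] 0ℚ ℚ.< v i j

module _ (I : Instance) where
  open Instance I

  -- A subset of the disjoint union of the V_i.
  Selection : Set
  Selection = (i : Fin m) → Subset (size i)

  categorySum : ((i : Fin m) → Fin (size i) → ℚ) → Selection → Fin m → ℚ
  categorySum f S i = sum λ j → if lookup (S i) j then f i j else 0ℚ

  categoryValue : Selection → Fin m → ℚ
  categoryValue = categorySum v

  totalValue : Selection → ℚ
  totalValue S = sum (categoryValue S)

  totalWeight : Selection → ℚ
  totalWeight S = sum (categorySum w S)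

  Feasible : Selection → Set
  Feasible S =
    (∀ i → l i ℚ.≤ categoryValue S i × categoryValue S i ℚ.≤ u i) ×
    L ℚ.≤ totalValue S

  IsOptimalWeight : ℚ → Set
  IsOptimalWeight W =
    (∃[ S ] (Feasible S × totalWeight S ≡ W)) ×
    (∀ S → Feasible S → W ℚ.≤ totalWeight S)

  ApproxSolution : ℚ → Selection → Set
  ApproxSolution ε S =
    (∀ W → IsOptimalWeight W → totalWeight S ℚ.≤ W) ×
    (∀ k → (1ℚ ℚ.- ε) ℚ.* l k ℚ.≤ categoryValue S k ×
           categoryValue S k ℚ.≤ (1ℚ ℚ.+ ε) ℚ.* u k) ×
    (1ℚ ℚ.- ε) ℚ.* L ℚ.≤ totalValue S

  maxSize : ℕ
  maxSize = Extremaℕ.max 0 (List.tabulate size)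

  itemCount : ℕ
  itemCount = ListAction.sum (List.tabulate size)

  values : List.List ℚ
  values = List.concat (List.tabulate λ i → List.tabulate (v i))

  -- All values are non-negative, so the base point 0 is harmless.
  vmax : ℚ
  vmax = Extremaℚ.max 0ℚ values

  -- vmax is itself a positive value of some item, so as a base point it
  -- does not change the minimum.
  vmin : ℚ
  vmin = Extremaℚ.min vmax (List.filter (0ℚ ℚ.<?_) values)

-- For b > 1 and a > 0:  max {1 , log_b a} ≤ y.  With y = p / q, q > 0, the
-- inequality log_b a ≤ p / q means a ^ q ≤ b ^ p; as 1 ≤ y, p = ∣ p ∣.
Log⁺[_,_]≤_ : ℚ → ℚ → ℚ → Set
Log⁺[ b , a ]≤ y = 1ℚ ℚ.≤ y × a ^ (↧ₙ y) ℚ.≤ b ^ ℤ.∣ ↥ y ∣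

-- t ≤ C n² m x³ y³ / ε for x = max {1 , log₂ m} and
-- y = max {1 , log_{1+ε} (N vmax / vmin)}.  These two reals are given by
-- their rational upper bounds: the right-hand side is continuous and
-- increasing in x and y, so the inequality for the reals is equivalent to
-- the inequality for all rational x, y above them.
WithinBound : (C : ℕ) (ε : ℚ) → Instance → (t : ℕ) → Set
WithinBound C ε I t =
  ∀ x y →
  Log⁺[ fromℕ 2 , fromℕ m ]≤ x →
  Log⁺[ 1ℚ ℚ.+ ε , fromℕ (itemCount I) ℚ.* vmax I ÷₀ vmin I ]≤ y →
  fromℕ t ℚ.≤
    fromℕ C ℚ.* fromℕ (maxSize I) ^ 2 ℚ.* fromℕ m ℚ.* x ^ 3 ℚ.* y ^ 3 ÷₀ ε
  where open Instance I

-- Algorithms: imperative programs on a random-access memory whose cells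
-- hold naturals or rationals.

data Ty : Set where
  nat rat : Ty

⟦_⟧ : Ty → Set
⟦ nat ⟧ = ℕ
⟦ rat ⟧ = ℚ

-- For each type, memory is a family of unbounded two-dimensional arrays,
-- named by naturals; a scalar variable is the cell (0 , 0) of an array.
Memory : Set → Set
Memory A = (name row column : ℕ) → A

record State : Set where
  constructor state
  field
    nats : Memory ℕ
    rats : Memory ℚ

open State public

read : ∀ τ → State → Memory ⟦ τ ⟧
read nat = nats
read rat = rats

update : ∀ {A} → Memory A → (a i j : ℕ) → A → Memory A
update M a i j x a′ i′ j′ =
  if (a ≡ᵇ a′) ∧ (i ≡ᵇ i′) ∧ (j ≡ᵇ j′) then x else M a′ i′ j′

write : ∀ τ → State → (a i j : ℕ) → ⟦ τ ⟧ → State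
write nat s a i j x = record s { nats = update (nats s) a i j x }
write rat s a i j x = record s { rats = update (rats s) a i j x }

data Op : Ty → Set where
  add sub mul : ∀ {τ} → Op τ
  div         : Op rat

-- Subtraction of naturals is truncated.
apply : ∀ {τ} → Op τ → ⟦ τ ⟧ → ⟦ τ ⟧ → ⟦ τ ⟧
apply {nat} add = ℕ._+_
apply {nat} sub = ℕ._∸_
apply {nat} mul = ℕ._*_
apply {rat} add = ℚ._+_
apply {rat} sub = ℚ._-_
apply {rat} mul = ℚ._*_
apply       div = _÷₀_

data Expr : Ty → Set where
  lit   : ∀ {τ} → ⟦ τ ⟧ → Expr τ
  cell  : ∀ {τ} (a : ℕ) (i j : Expr nat) → Expr τ
  op    : ∀ {τ} → Op τ → Expr τ → Expr τ → Expr τ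
  toRat : Expr nat → Expr rat
  floor : Expr rat → Expr nat

-- floor rounds down non-negative rationals; on negative ones it returns the
-- absolute value of the integer below.
eval : ∀ {τ} → Expr τ → State → ⟦ τ ⟧
eval     (lit x)      s = x
eval {τ} (cell a i j) s = read τ s a (eval i s) (eval j s)
eval     (op o e f)   s = apply o (eval e s) (eval f s)
eval     (toRat e)    s = fromℕ (eval e s)
eval     (floor e)    s = ℤ.∣ ℚ.floor (eval e s) ∣

cost : ∀ {τ} → Expr τ → ℕ
cost (lit x)      = 1
cost (cell a i j) = suc (cost i ℕ.+ cost j)
cost (op o e f)   = suc (cost e ℕ.+ cost f)
cost (toRat e)    = suc (cost e)
cost (floor e)    = suc (cost e)

data Test : Set where
  leq  : ∀ {τ} → Expr τ → Expr τ → Test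
  and  : Test → Test → Test
  neg  : Test → Test

leqᵇ : ∀ τ → ⟦ τ ⟧ → ⟦ τ ⟧ → Bool
leqᵇ nat = ℕ._≤ᵇ_
leqᵇ rat = ℚ._≤ᵇ_

evalTest : Test → State → Bool
evalTest (leq {τ} e f) s = leqᵇ τ (eval e s) (eval f s)
evalTest (and b c)     s = evalTest b s ∧ evalTest c s
evalTest (neg b)       s = not (evalTest b s)

costTest : Test → ℕ
costTest (leq e f) = suc (cost e ℕ.+ cost f)
costTest (and b c) = suc (costTest b ℕ.+ costTest c)
costTest (neg b)   = suc (costTest b)

infixr 5 _⨾_

data Program : Set where
  skip     : Program
  _⨾_      : Program → Program → Program
  assign   : ∀ {τ} (a : ℕ) (i j : Expr nat) → Expr τ → Program
  ifElse   : Test → Program → Program → Program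
  while    : Test → Program → Program

infix 4 ⟨_,_⟩⇓⟨_,_⟩

-- ⟨ P , s ⟩⇓⟨ s′ , t ⟩: started in s, the program P halts in s′ after
-- operations (arithmetic, comparisons, rounding, memory accesses, tests)
-- of total cost t.
data ⟨_,_⟩⇓⟨_,_⟩ : Program → State → State → ℕ → Set where
  skip : ∀ {s} → ⟨ skip , s ⟩⇓⟨ s , 0 ⟩

  seq : ∀ {P Q s s′ s″ t t′} →
    ⟨ P , s ⟩⇓⟨ s′ , t ⟩ → ⟨ Q , s′ ⟩⇓⟨ s″ , t′ ⟩ →
    ⟨ P ⨾ Q , s ⟩⇓⟨ s″ , t ℕ.+ t′ ⟩

  assign : ∀ {τ a i j s} {e : Expr τ} →
    ⟨ assign a i j e , s ⟩⇓⟨ write τ s a (eval i s) (eval j s) (eval e s)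
                           , suc (cost i ℕ.+ cost j ℕ.+ cost e) ⟩

  if-true : ∀ {b P Q s s′ t} → evalTest b s ≡ true →
    ⟨ P , s ⟩⇓⟨ s′ , t ⟩ →
    ⟨ ifElse b P Q , s ⟩⇓⟨ s′ , suc (costTest b ℕ.+ t) ⟩

  if-false : ∀ {b P Q s s′ t} → evalTest b s ≡ false →
    ⟨ Q , s ⟩⇓⟨ s′ , t ⟩ →
    ⟨ ifElse b P Q , s ⟩⇓⟨ s′ , suc (costTest b ℕ.+ t) ⟩

  while-true : ∀ {b P s s′ s″ t t′} → evalTest b s ≡ true →
    ⟨ P , s ⟩⇓⟨ s′ , t ⟩ → ⟨ while b P , s′ ⟩⇓⟨ s″ , t′ ⟩ →
    ⟨ while b P , s ⟩⇓⟨ s″ , suc (costTest b ℕ.+ t ℕ.+ t′) ⟩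

  while-false : ∀ {b P s} → evalTest b s ≡ false →
    ⟨ while b P , s ⟩⇓⟨ s , suc (costTest b) ⟩

scalar : ∀ {A : Set} → A → A → ℕ → ℕ → A
scalar d x zero zero = x
scalar d x _    _    = d

extend : ∀ {A : Set} {n} → A → (Fin n → A) → ℕ → A
extend {n = zero}  d f _       = d
extend {n = suc n} d f zero    = f zero
extend {n = suc n} d f (suc k) = extend d (f ∘ suc) k

module _ (I : Instance) where
  open Instance I

  column₀ : ∀ {A : Set} → A → (Fin m → A) → ℕ → ℕ → A
  column₀ d f i zero    = extend d f i
  column₀ d f i (suc _) = d

  table : ((i : Fin m) → Fin (size i) → ℚ) → ℕ → ℕ → ℚ
  table f i j = extend 0ℚ (λ k → extend 0ℚ (f k) j) i

  -- Every cell not holding input data is initially 0.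
  inputNats : Memory ℕ
  inputNats 0 = scalar 0 m
  inputNats 1 = column₀ 0 size
  inputNats _ = λ _ _ → 0

  inputRats : Memory ℚ
  inputRats 0 = table w
  inputRats 1 = table v
  inputRats 2 = column₀ 0ℚ l
  inputRats 3 = column₀ 0ℚ u
  inputRats 4 = scalar 0ℚ L
  inputRats _ = λ _ _ → 0ℚ

  input : State
  input = state inputNats inputRats

  -- Item j of category i is selected iff cell (i , j) of the natural-number
  -- array 2 is non-zero.
  output : State → Selection I
  output s i = tabulate λ j → 0 <ᵇ nats s 2 (toℕ i) (toℕ j)

{-
For ε ≥ 1 the empty selection is a solution.  For ε < 1, pad the instance to
M = 2ᵉ ≥ m categories of 2ᵈ items each; the new items have weight and value 0
and the new categories have bounds 0.  The items are the leaves of a complete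
binary tree of depth d + e, stored in heap order, and the categories are its
nodes of level e.

Let D = d + e + 1, β = 1 + ε / 2D, and consider the grid 0, b, bβ, bβ², … up
to the total value, where b is the least positive value.  For every node r and
grid point c, a table stores the least weight found for a set of items below r
whose value is approximated by c.  The table of r arises from those of its
children: a pair of grid points (a, b) contributes to every c with
c ≤ a + b ≤ βc, where at a category the points c that violate the bounds by
more than a factor 1 + ε are left out.  Since each level loses a factor β, the
value of a set is off by at most β^D ≤ 1 + ε.  No feasible set is lost, so the
lightest entry of the root with c(1 + ε) ≥ L is at most as heavy as the
optimum, and the indices of the contributing pairs lead from it to the items.

The grid has K = O(D log_{1+ε}(N vmax / vmin)) points, because (1 + ε) ≤ β^2D,
and trying all triples (a, b, c) at all nodes takes O(2ᵈ M K³) operations.  As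
D = O((4 + d) log m) and (4 + d)³ = O(2ᵈ), this is within the bound.
-}
module Submission where

open import Defs
open import Algebra.Bundles using (CommutativeRing)
import Algebra.Properties.Semiring.Exp
open import Data.Bool.Base using (Bool; true; false; if_then_else_; _∧_; not; T)
open import Data.Empty using (⊥-elim)
open import Data.Fin.Base as Fin using (Fin; toℕ)
import Data.Fin.Properties as Fin
import Data.Integer.Base as ℤ
import Data.Integer.Properties as ℤ
import Data.List.Base as List
import Data.List.Extrema.Nat as Extremaℕ
import Data.List.Membership.Propositional as List
import Data.List.Membership.Propositional.Properties as List
import Data.List.Relation.Unary.All as All
import Data.List.Relation.Unary.All.Properties as All
import Data.Nat.ListAction as ListAction
open import Data.Nat.Base as ℕ
  using (ℕ; zero; suc; _+_; _*_; _∸_; _≤_; _<_; z≤n; s≤s; _≡ᵇ_; _<ᵇ_; NonZero)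
open import Data.Nat.DivMod using (_/_; _%_)
import Data.Nat.Divisibility as ℕ
import Data.Nat.DivMod as ℕ
import Data.Nat.Properties as ℕ
import Data.Nat.Solver
open import Data.Product.Base
  using (Σ; ∃; ∃-syntax; _×_; _,_; proj₁; proj₂; uncurry)
open import Data.Rational.Base as ℚ using (ℚ; 0ℚ; 1ℚ; ½; ↥_; ↧_; ↧ₙ_)
  renaming ( _+_ to _+ℚ_; _*_ to _*ℚ_; _-_ to _-ℚ_
           ; _≤_ to _≤ℚ_; _<_ to _<ℚ_ )
import Data.Rational.Properties as ℚ
import Data.Rational.Solver
import Data.Rational.Unnormalised.Base as ℚᵘ
import Data.Rational.Unnormalised.Properties as ℚᵘ
open import Data.Sum.Base using (_⊎_; inj₁; inj₂)
open import Data.Unit.Base using (tt)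
open import Data.Vec.Base using (lookup)
import Data.Vec.Properties as Vec
open import Function.Base using (_∘_; _$_; case_of_)
open import Relation.Binary.PropositionalEquality
  using (_≡_; _≢_; refl; sym; trans; cong; cong₂; subst; subst₂; module ≡-Reasoning)
open import Relation.Binary.Definitions using (module Tri)
open import Relation.Nullary using (¬_; Dec; yes; no; contradiction)
open import Relation.Nullary.Decidable using (toWitness)

-- Ordered-field arithmetic on ℚ

module ^ where
  open Algebra.Properties.Semiring.Exp
    (CommutativeRing.semiring ℚ.+-*-commutativeRing) public

module ℚ-Solver = Data.Rational.Solver.+-*-Solver
module ℕ-Solver = Data.Nat.Solver.+-*-Solver

*-monoʳ : ∀ {p q r} → 0ℚ ≤ℚ r → p ≤ℚ q → r *ℚ p ≤ℚ r *ℚ q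
*-monoʳ {r = r} 0≤r = ℚ.*-monoˡ-≤-nonNeg r {{ℚ.nonNegative 0≤r}}

*-monoˡ : ∀ {p q r} → 0ℚ ≤ℚ r → p ≤ℚ q → p *ℚ r ≤ℚ q *ℚ r
*-monoˡ {r = r} 0≤r = ℚ.*-monoʳ-≤-nonNeg r {{ℚ.nonNegative 0≤r}}

*-mono : ∀ {p q r s} → 0ℚ ≤ℚ q → 0ℚ ≤ℚ r → p ≤ℚ q → r ≤ℚ s → p *ℚ r ≤ℚ q *ℚ s
*-mono 0≤q 0≤r p≤q r≤s = ℚ.≤-trans (*-monoˡ 0≤r p≤q) (*-monoʳ 0≤q r≤s)

*-cancelʳ : ∀ {p q r} → 0ℚ <ℚ r → p *ℚ r ≤ℚ q *ℚ r → p ≤ℚ q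
*-cancelʳ {r = r} 0<r = ℚ.*-cancelʳ-≤-pos r {{ℚ.positive 0<r}}

*-nonNeg : ∀ {p q} → 0ℚ ≤ℚ p → 0ℚ ≤ℚ q → 0ℚ ≤ℚ p *ℚ q
*-nonNeg {p} 0≤p 0≤q = ℚ.≤-trans (ℚ.≤-reflexive (sym (ℚ.*-zeroʳ p))) (*-monoʳ 0≤p 0≤q)

*-pos : ∀ {p q} → 0ℚ <ℚ p → 0ℚ <ℚ q → 0ℚ <ℚ p *ℚ q
*-pos {p} {q} 0<p 0<q = ℚ.positive⁻¹ (p *ℚ q)
  {{ℚ.pos*pos⇒pos p {{ℚ.positive 0<p}} q {{ℚ.positive 0<q}}}}

+-nonNeg : ∀ {p q} → 0ℚ ≤ℚ p → 0ℚ ≤ℚ q → 0ℚ ≤ℚ p +ℚ q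
+-nonNeg = ℚ.+-mono-≤

0≤1 : 0ℚ ≤ℚ 1ℚ
0≤1 = toWitness {a? = 0ℚ ℚ.≤? 1ℚ} _

0<1 : 0ℚ <ℚ 1ℚ
0<1 = toWitness {a? = 0ℚ ℚ.<? 1ℚ} _

p≤p+q : ∀ {p q} → 0ℚ ≤ℚ q → p ≤ℚ p +ℚ q
p≤p+q {p} 0≤q = ℚ.≤-trans (ℚ.≤-reflexive (sym (ℚ.+-identityʳ p))) (ℚ.+-monoʳ-≤ p 0≤q)

q≤p+q : ∀ {p q} → 0ℚ ≤ℚ p → q ≤ℚ p +ℚ q
q≤p+q {p} {q} 0≤p = ℚ.≤-trans (p≤p+q 0≤p) (ℚ.≤-reflexive (ℚ.+-comm q p))

q≤p*q : ∀ {p q} → 1ℚ ≤ℚ p → 0ℚ ≤ℚ q → q ≤ℚ p *ℚ q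
q≤p*q {p} {q} 1≤p 0≤q =
  ℚ.≤-trans (ℚ.≤-reflexive (sym (ℚ.*-identityˡ q))) (*-monoˡ 0≤q 1≤p)

0≤q-p : ∀ {p q} → p ≤ℚ q → 0ℚ ≤ℚ q -ℚ p
0≤q-p {p} {q} p≤q =
  ℚ.≤-trans (ℚ.≤-reflexive (sym (ℚ.+-inverseʳ p))) (ℚ.+-monoˡ-≤ (ℚ.- p) p≤q)

≤-fromDifference : ∀ {p q} r → 0ℚ ≤ℚ r → q ≡ p +ℚ r → p ≤ℚ q
≤-fromDifference r 0≤r refl = p≤p+q 0≤r

^-nonNeg : ∀ {p} n → 0ℚ ≤ℚ p → 0ℚ ≤ℚ p ^ n
^-nonNeg zero    0≤p = 0≤1
^-nonNeg (suc n) 0≤p = *-nonNeg 0≤p (^-nonNeg n 0≤p)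

^-pos : ∀ {p} n → 0ℚ <ℚ p → 0ℚ <ℚ p ^ n
^-pos zero    0<p = 0<1
^-pos (suc n) 0<p = *-pos 0<p (^-pos n 0<p)

1≤^ : ∀ {p} n → 1ℚ ≤ℚ p → 1ℚ ≤ℚ p ^ n
1≤^ zero    1≤p = ℚ.≤-refl
1≤^ (suc n) 1≤p =
  ℚ.≤-trans (1≤^ n 1≤p) (q≤p*q 1≤p (^-nonNeg n (ℚ.≤-trans 0≤1 1≤p)))

^-monoˡ : ∀ {p q} n → 0ℚ ≤ℚ p → p ≤ℚ q → p ^ n ≤ℚ q ^ n
^-monoˡ zero    0≤p p≤q = ℚ.≤-refl
^-monoˡ (suc n) 0≤p p≤q =
  *-mono (ℚ.≤-trans 0≤p p≤q) (^-nonNeg n 0≤p) p≤q (^-monoˡ n 0≤p p≤q)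

^-monoʳ : ∀ {p m n} → 1ℚ ≤ℚ p → m ≤ n → p ^ m ≤ℚ p ^ n
^-monoʳ {n = n} 1≤p z≤n       = 1≤^ n 1≤p
^-monoʳ         1≤p (s≤s m≤n) = *-monoʳ (ℚ.≤-trans 0≤1 1≤p) (^-monoʳ 1≤p m≤n)

^-cancelˡ-≤ : ∀ {p} m n → 1ℚ <ℚ p → p ^ m ≤ℚ p ^ n → m ≤ n
^-cancelˡ-≤ zero n 1<p _ = z≤n
^-cancelˡ-≤ {p} (suc m) zero 1<p pᵐ⁺¹≤1 =
  contradiction (ℚ.<-≤-trans 1<p (ℚ.≤-trans p≤pᵐ⁺¹ pᵐ⁺¹≤1)) (ℚ.<-irrefl refl)
  where
  1≤p = ℚ.<⇒≤ 1<p
  p≤pᵐ⁺¹ : p ≤ℚ p ^ suc m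
  p≤pᵐ⁺¹ = ℚ.≤-trans (ℚ.≤-reflexive (sym (ℚ.*-identityʳ p)))
    (*-monoʳ (ℚ.≤-trans 0≤1 1≤p) (1≤^ m 1≤p))
^-cancelˡ-≤ {p} (suc m) (suc n) 1<p le = s≤s $ ^-cancelˡ-≤ m n 1<p $
  ℚ.*-cancelˡ-≤-pos p {{ℚ.positive (ℚ.<-trans 0<1 1<p)}} le

bernoulli : ∀ {δ} n → 0ℚ ≤ℚ δ → 1ℚ +ℚ fromℕ n *ℚ δ ≤ℚ (1ℚ +ℚ δ) ^ n

-- The embedding of ℕ

fromℕ-toℚᵘ : ∀ n → ℚ.toℚᵘ (fromℕ n) ℚᵘ.≃ ℚᵘ.mkℚᵘ (ℤ.+ n) 0
fromℕ-toℚᵘ n = ℚ.toℚᵘ-fromℚᵘ (ℚᵘ.mkℚᵘ (ℤ.+ n) 0)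

abstract
  fromℕ-+ : ∀ m n → fromℕ (m + n) ≡ fromℕ m +ℚ fromℕ n
  fromℕ-+ m n = ℚ.toℚᵘ-injective $ begin
    ℚ.toℚᵘ (fromℕ (m + n))                        ≈⟨ fromℕ-toℚᵘ (m + n) ⟩
    ℚᵘ.mkℚᵘ (ℤ.+ (m + n)) 0                       ≈⟨ ℚᵘ.*≡* (cong (ℤ._* ℤ.+ 1) (cong₂ ℤ._+_ (sym (ℤ.*-identityʳ (ℤ.+ m))) (sym (ℤ.*-identityʳ (ℤ.+ n))))) ⟩
    ℚᵘ.mkℚᵘ (ℤ.+ m) 0 ℚᵘ.+ ℚᵘ.mkℚᵘ (ℤ.+ n) 0      ≈⟨ ℚᵘ.+-cong (fromℕ-toℚᵘ m) (fromℕ-toℚᵘ n) ⟨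
    ℚ.toℚᵘ (fromℕ m) ℚᵘ.+ ℚ.toℚᵘ (fromℕ n)        ≈⟨ ℚ.toℚᵘ-homo-+ (fromℕ m) (fromℕ n) ⟨
    ℚ.toℚᵘ (fromℕ m +ℚ fromℕ n)                   ∎
    where open ℚᵘ.≃-Reasoning

  fromℕ-* : ∀ m n → fromℕ (m * n) ≡ fromℕ m *ℚ fromℕ n
  fromℕ-* m n = ℚ.toℚᵘ-injective $ begin
    ℚ.toℚᵘ (fromℕ (m * n))                        ≈⟨ fromℕ-toℚᵘ (m * n) ⟩
    ℚᵘ.mkℚᵘ (ℤ.+ (m * n)) 0                       ≈⟨ ℚᵘ.*≡* (cong (ℤ._* ℤ.+ 1) (ℤ.pos-* m n)) ⟩
    ℚᵘ.mkℚᵘ (ℤ.+ m) 0 ℚᵘ.* ℚᵘ.mkℚᵘ (ℤ.+ n) 0      ≈⟨ ℚᵘ.*-cong (fromℕ-toℚᵘ m) (fromℕ-toℚᵘ n) ⟨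
    ℚ.toℚᵘ (fromℕ m) ℚᵘ.* ℚ.toℚᵘ (fromℕ n)        ≈⟨ ℚ.toℚᵘ-homo-* (fromℕ m) (fromℕ n) ⟨
    ℚ.toℚᵘ (fromℕ m *ℚ fromℕ n)                   ∎
    where open ℚᵘ.≃-Reasoning

  fromℕ-mono : ∀ {m n} → m ≤ n → fromℕ m ≤ℚ fromℕ n
  fromℕ-mono {m} {n} m≤n = ℚ.toℚᵘ-cancel-≤ $ begin
    ℚ.toℚᵘ (fromℕ m)    ≃⟨ fromℕ-toℚᵘ m ⟩
    ℚᵘ.mkℚᵘ (ℤ.+ m) 0   ≤⟨ ℚᵘ.*≤* (ℤ.*-monoʳ-≤-nonNeg (ℤ.+ 1) (ℤ.+≤+ m≤n)) ⟩
    ℚᵘ.mkℚᵘ (ℤ.+ n) 0   ≃⟨ fromℕ-toℚᵘ n ⟨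
    ℚ.toℚᵘ (fromℕ n)    ∎
    where open ℚᵘ.≤-Reasoning

  ↧*p≡↥ : ∀ p → 0ℚ ≤ℚ p → p *ℚ fromℕ (↧ₙ p) ≡ fromℕ ℤ.∣ ↥ p ∣
  ↧*p≡↥ p 0≤p = ℚ.toℚᵘ-injective $ begin
    ℚ.toℚᵘ (p *ℚ fromℕ (↧ₙ p))                 ≈⟨ ℚ.toℚᵘ-homo-* p (fromℕ (↧ₙ p)) ⟩
    ℚ.toℚᵘ p ℚᵘ.* ℚ.toℚᵘ (fromℕ (↧ₙ p))        ≈⟨ ℚᵘ.*-cong (ℚᵘ.≃-refl {ℚ.toℚᵘ p}) (fromℕ-toℚᵘ (↧ₙ p)) ⟩
    ℚ.toℚᵘ p ℚᵘ.* ℚᵘ.mkℚᵘ (ℤ.+ ↧ₙ p) 0         ≈⟨ ℚᵘ.*≡* (numerators p) ⟩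
    ℚᵘ.mkℚᵘ (↥ p) 0                            ≡⟨ cong (λ i → ℚᵘ.mkℚᵘ i 0) (sym (ℤ.0≤i⇒+∣i∣≡i (ℤ.nonNegative⁻¹ (↥ p) {{0≤↥ p (ℚ.nonNegative 0≤p)}}))) ⟩
    ℚᵘ.mkℚᵘ (ℤ.+ ℤ.∣ ↥ p ∣) 0                  ≈⟨ fromℕ-toℚᵘ ℤ.∣ ↥ p ∣ ⟨
    ℚ.toℚᵘ (fromℕ ℤ.∣ ↥ p ∣)                   ∎
    where
    open ℚᵘ.≃-Reasoning
    0≤↥ : ∀ p → ℚ.NonNegative p → ℤ.NonNegative (↥ p)
    0≤↥ record{} 0≤p = 0≤p
    numerators : ∀ p → (ℚᵘ.↥ (ℚ.toℚᵘ p ℚᵘ.* ℚᵘ.mkℚᵘ (ℤ.+ ↧ₙ p) 0)) ℤ.* ℤ.+ 1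
      ≡ ↥ p ℤ.* (ℚᵘ.↧ (ℚ.toℚᵘ p ℚᵘ.* ℚᵘ.mkℚᵘ (ℤ.+ ↧ₙ p) 0))
    numerators p@record{} = trans (ℤ.*-identityʳ (↥ p ℤ.* ↧ p))
      (cong (λ k → ↥ p ℤ.* (ℤ.+ k)) (sym (ℕ.*-identityʳ (↧ₙ p))))

fromℕ-nonNeg : ∀ n → 0ℚ ≤ℚ fromℕ n
fromℕ-nonNeg n = fromℕ-mono {0} {n} z≤n

fromℕ-1≤ : ∀ {n} → 1 ≤ n → 1ℚ ≤ℚ fromℕ n
fromℕ-1≤ = fromℕ-mono

fromℕ-pos : ∀ {n} → 1 ≤ n → 0ℚ <ℚ fromℕ n
fromℕ-pos 1≤n = ℚ.<-≤-trans 0<1 (fromℕ-1≤ 1≤n)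

fromℕ-suc : ∀ n → fromℕ (suc n) ≡ 1ℚ +ℚ fromℕ n
fromℕ-suc = fromℕ-+ 1

fromℕ-^ : ∀ m n → fromℕ (m ℕ.^ n) ≡ fromℕ m ^ n
fromℕ-^ m zero    = refl
fromℕ-^ m (suc n) = trans (fromℕ-* m (m ℕ.^ n)) (cong (fromℕ m *ℚ_) (fromℕ-^ m n))

÷₀-* : ∀ p {q} → 0ℚ <ℚ q → (p ÷₀ q) *ℚ q ≡ p
÷₀-* p {q} 0<q with q ℚ.≟ 0ℚ
... | yes refl = contradiction 0<q (ℚ.<-irrefl refl)
... | no  q≢0  = begin
  p *ℚ 1/q *ℚ q    ≡⟨ ℚ.*-assoc p 1/q q ⟩
  p *ℚ (1/q *ℚ q)  ≡⟨ cong (p *ℚ_) (ℚ.*-inverseˡ q {{ℚ.≢-nonZero q≢0}}) ⟩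
  p *ℚ 1ℚ          ≡⟨ ℚ.*-identityʳ p ⟩
  p                ∎
  where
  open ≡-Reasoning
  1/q = (ℚ.1/ q) {{ℚ.≢-nonZero q≢0}}

≤-÷₀ : ∀ {p q r} → 0ℚ <ℚ q → r *ℚ q ≤ℚ p → r ≤ℚ p ÷₀ q
≤-÷₀ {p} 0<q r*q≤p = *-cancelʳ 0<q (ℚ.≤-trans r*q≤p (ℚ.≤-reflexive (sym (÷₀-* p 0<q))))

÷₀-pos : ∀ {p q} → 0ℚ <ℚ p → 0ℚ <ℚ q → 0ℚ <ℚ p ÷₀ q
÷₀-pos {p} {q} 0<p 0<q = ℚ.*-cancelʳ-<-nonNeg q {{ℚ.nonNegative (ℚ.<⇒≤ 0<q)}} $
  ℚ.≤-<-trans (ℚ.≤-reflexive (ℚ.*-zeroˡ q))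
    (ℚ.<-≤-trans 0<p (ℚ.≤-reflexive (sym (÷₀-* p 0<q))))

bernoulli {δ} zero 0≤δ = ℚ.≤-reflexive (trans (cong (1ℚ +ℚ_) (ℚ.*-zeroˡ δ)) (ℚ.+-identityʳ 1ℚ))
bernoulli {δ} (suc n) 0≤δ = ℚ.≤-trans
  (≤-fromDifference (fromℕ n *ℚ (δ *ℚ δ)) (*-nonNeg (fromℕ-nonNeg n) (*-nonNeg 0≤δ 0≤δ)) $
    subst (λ x → (1ℚ +ℚ δ) *ℚ (1ℚ +ℚ fromℕ n *ℚ δ)
        ≡ 1ℚ +ℚ x *ℚ δ +ℚ fromℕ n *ℚ (δ *ℚ δ)) (sym (fromℕ-suc n)) $
      solve 2 (λ δ n → (con 1ℚ :+ δ) :* (con 1ℚ :+ n :* δ)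
        := con 1ℚ :+ (con 1ℚ :+ n) :* δ :+ n :* (δ :* δ)) refl δ (fromℕ n))
  (*-monoʳ (+-nonNeg 0≤1 0≤δ) (bernoulli n 0≤δ))
  where open ℚ-Solver

-- (1 + δ)ⁿ ≤ 1 / (1 - n δ)
reverse-bernoulli : ∀ {δ} n → 0ℚ ≤ℚ δ → (1ℚ +ℚ δ) ^ n *ℚ (1ℚ -ℚ fromℕ n *ℚ δ) ≤ℚ 1ℚ
reverse-bernoulli {δ} zero 0≤δ = ℚ.≤-reflexive $
  solve 1 (λ δ → con 1ℚ :* (con 1ℚ :- con 0ℚ :* δ) := con 1ℚ) refl δ
  where open ℚ-Solver
reverse-bernoulli {δ} (suc n) 0≤δ = ℚ.≤-trans
  (≤-fromDifference ((1ℚ +ℚ fromℕ n) *ℚ (δ *ℚ δ) *ℚ (1ℚ +ℚ δ) ^ n)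
    (*-nonNeg (*-nonNeg (+-nonNeg 0≤1 (fromℕ-nonNeg n)) (*-nonNeg 0≤δ 0≤δ))
      (^-nonNeg n (+-nonNeg 0≤1 0≤δ))) $
    subst (λ x → (1ℚ +ℚ δ) ^ n *ℚ (1ℚ -ℚ fromℕ n *ℚ δ) ≡
        (1ℚ +ℚ δ) *ℚ (1ℚ +ℚ δ) ^ n *ℚ (1ℚ -ℚ x *ℚ δ)
          +ℚ (1ℚ +ℚ fromℕ n) *ℚ (δ *ℚ δ) *ℚ (1ℚ +ℚ δ) ^ n) (sym (fromℕ-suc n)) $
      solve 3 (λ δ n p → p :* (con 1ℚ :- n :* δ) :=
        (con 1ℚ :+ δ) :* p :* (con 1ℚ :- (con 1ℚ :+ n) :* δ)
          :+ (con 1ℚ :+ n) :* (δ :* δ) :* p) refl δ (fromℕ n) ((1ℚ +ℚ δ) ^ n))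
  (reverse-bernoulli n 0≤δ)
  where open ℚ-Solver

archimedean : ∀ p → ∃[ n ] p ≤ℚ fromℕ n
archimedean p with ℚ.≤-total 0ℚ p
... | inj₂ p≤0 = 0 , p≤0
... | inj₁ 0≤p = ℤ.∣ ↥ p ∣ , ℚ.≤-trans
  (ℚ.≤-trans (ℚ.≤-reflexive (sym (ℚ.*-identityʳ p)))
    (*-monoʳ 0≤p (fromℕ-1≤ (ℕ.>-nonZero⁻¹ (↧ₙ p)))))
  (ℚ.≤-reflexive (↧*p≡↥ p 0≤p))

^-unbounded : ∀ {δ} p → 0ℚ <ℚ δ → ∃[ n ] p ≤ℚ (1ℚ +ℚ δ) ^ n
^-unbounded {δ} p 0<δ with archimedean (p ÷₀ δ)
... | n , p/δ≤n = n , (begin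
  p                     ≡⟨ ÷₀-* p 0<δ ⟨
  (p ÷₀ δ) *ℚ δ         ≤⟨ *-monoˡ (ℚ.<⇒≤ 0<δ) p/δ≤n ⟩
  fromℕ n *ℚ δ          ≤⟨ q≤p+q 0≤1 ⟩
  1ℚ +ℚ fromℕ n *ℚ δ    ≤⟨ bernoulli n (ℚ.<⇒≤ 0<δ) ⟩
  (1ℚ +ℚ δ) ^ n         ∎)
  where open ℚ.≤-Reasoning

-- Program logic

-- Phases write arrays in increasing order, except for the output array,
-- which is written last.
rank : Ty → ℕ → ℕ
rank nat a = if a ≡ᵇ 2 then 100 else a
rank rat a = a

record Agree (t : ℕ) (s s′ : State) : Set where
  constructor agreeing
  field
    at : ∀ τ a {_ : T (rank τ a <ᵇ t)} i j → read τ s′ a i j ≡ read τ s a i j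

open Agree public

Agree-refl : ∀ {t s} → Agree t s s
Agree-refl = agreeing λ _ _ _ _ → refl

Agree-trans : ∀ {t s s′ s″} → Agree t s s′ → Agree t s′ s″ → Agree t s s″
Agree-trans p q = agreeing λ τ a {a<t} i j →
  trans (at q τ a {a<t} i j) (at p τ a {a<t} i j)

Agree-≤ : ∀ {t u s s′} → t ≤ u → Agree u s s′ → Agree t s s′
Agree-≤ t≤u p = agreeing λ τ a {a<t} →
  at p τ a {ℕ.<⇒<ᵇ (ℕ.<-≤-trans (ℕ.<ᵇ⇒< _ _ a<t) t≤u)}

narrow : ∀ t {u s s′} {_ : T (t ℕ.≤ᵇ u)} → Agree u s s′ → Agree t s s′
narrow t {u} {_} {_} {t≤u} = Agree-≤ (ℕ.≤ᵇ⇒≤ t u t≤u)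

≢⇒≡ᵇ-false : ∀ m n → m ≢ n → (m ≡ᵇ n) ≡ false
≢⇒≡ᵇ-false m n m≢n with m ≡ᵇ n in eq
... | true  = contradiction (ℕ.≡ᵇ⇒≡ m n (subst T (sym eq) tt)) m≢n
... | false = refl

write-Agree : ∀ {t} τ s a i j x → t ≤ rank τ a → Agree t s (write τ s a i j x)
write-Agree {t} τ s a i j x t≤a = agreeing (unchanged τ x t≤a)
  where
  distinct : ∀ τ a′ → t ≤ rank τ a → T (rank τ a′ <ᵇ t) → (a ≡ᵇ a′) ≡ false
  distinct τ a′ t≤a a′<t = ≢⇒≡ᵇ-false a a′ λ where
    refl → ℕ.<-irrefl refl (ℕ.<-≤-trans (ℕ.<ᵇ⇒< _ _ a′<t) t≤a)
  unchanged : ∀ τ x → t ≤ rank τ a → ∀ τ′ a′ {_ : T (rank τ′ a′ <ᵇ t)} i′ j′ →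
    read τ′ (write τ s a i j x) a′ i′ j′ ≡ read τ′ s a′ i′ j′
  unchanged nat x t≤a nat a′ {a′<t} i′ j′ rewrite distinct nat a′ t≤a a′<t = refl
  unchanged nat x t≤a rat a′ i′ j′ = refl
  unchanged rat x t≤a nat a′ i′ j′ = refl
  unchanged rat x t≤a rat a′ {a′<t} i′ j′ rewrite distinct rat a′ t≤a a′<t = refl

above : ℕ → Program → Bool
above t skip                 = true
above t (P ⨾ Q)              = above t P ∧ above t Q
above t (assign {τ} a i j e) = t <ᵇ suc (rank τ a)
above t (ifElse b P Q)       = above t P ∧ above t Q
above t (while b P)          = above t P

T-∧ˡ : ∀ {x y} → T (x ∧ y) → T x
T-∧ˡ {true} _ = tt

T-∧ʳ : ∀ {x y} → T (x ∧ y) → T y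
T-∧ʳ {true} p = p

exec-Agree : ∀ {P s s′ t b} → T (above b P) → ⟨ P , s ⟩⇓⟨ s′ , t ⟩ → Agree b s s′
exec-Agree p skip = Agree-refl
exec-Agree {P ⨾ Q} p (seq d e) =
  Agree-trans (exec-Agree (T-∧ˡ p) d) (exec-Agree (T-∧ʳ {above _ P} p) e)
exec-Agree p (assign {τ} {a} {s = s}) =
  write-Agree τ s a _ _ _ (ℕ.≤-pred (ℕ.<ᵇ⇒< _ _ p))
exec-Agree p (if-true _ d) = exec-Agree (T-∧ˡ p) d
exec-Agree {ifElse b P Q} p (if-false _ d) = exec-Agree (T-∧ʳ {above _ P} p) d
exec-Agree p (while-true _ d e) = Agree-trans (exec-Agree p d) (exec-Agree p e)
exec-Agree p (while-false _) = Agree-refl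

sameTy : Ty → Ty → Bool
sameTy nat nat = true
sameTy nat rat = false
sameTy rat nat = false
sameTy rat rat = true

untouched : Ty → ℕ → Program → Bool
untouched τ a skip                   = true
untouched τ a (P ⨾ Q)                = untouched τ a P ∧ untouched τ a Q
untouched τ a (assign {τ′} a′ i j e) = not (sameTy τ τ′ ∧ (a′ ≡ᵇ a))
untouched τ a (ifElse b P Q)         = untouched τ a P ∧ untouched τ a Q
untouched τ a (while b P)            = untouched τ a P

write-untouched : ∀ τ a {τ′} s a′ i j x → T (not (sameTy τ τ′ ∧ (a′ ≡ᵇ a))) →
  ∀ i′ j′ → read τ (write τ′ s a′ i j x) a i′ j′ ≡ read τ s a i′ j′
write-untouched nat a {nat} s a′ i j x p i′ j′ with a′ ≡ᵇ a
... | false = refl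
write-untouched nat a {rat} s a′ i j x p i′ j′ = refl
write-untouched rat a {nat} s a′ i j x p i′ j′ = refl
write-untouched rat a {rat} s a′ i j x p i′ j′ with a′ ≡ᵇ a
... | false = refl

exec-untouched : ∀ {P s s′ t} τ a → T (untouched τ a P) → ⟨ P , s ⟩⇓⟨ s′ , t ⟩ →
  ∀ i j → read τ s′ a i j ≡ read τ s a i j
exec-untouched τ a p skip i j = refl
exec-untouched {P ⨾ Q} τ a p (seq d e) i j =
  trans (exec-untouched τ a (T-∧ʳ {untouched τ a P} p) e i j)
        (exec-untouched τ a (T-∧ˡ p) d i j)
exec-untouched τ a p (assign {s = s}) i j = write-untouched τ a s _ _ _ _ p i j
exec-untouched τ a p (if-true _ d) i j = exec-untouched τ a (T-∧ˡ p) d i j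
exec-untouched {ifElse b P Q} τ a p (if-false _ d) i j =
  exec-untouched τ a (T-∧ʳ {untouched τ a P} p) d i j
exec-untouched τ a p (while-true _ d e) i j =
  trans (exec-untouched τ a p e i j) (exec-untouched τ a p d i j)
exec-untouched τ a p (while-false _) i j = refl

record Run (P : Program) (s : State) (B : ℕ) (Q : State → Set) : Set where
  constructor run
  field
    {final} : State
    {time}  : ℕ
    exec    : ⟨ P , s ⟩⇓⟨ final , time ⟩
    time≤   : time ≤ B
    post    : Q final

run-map : ∀ {P s B Q R} → (∀ {s′} → Q s′ → R s′) → Run P s B Q → Run P s B R
run-map f (run d t q) = run d t (f q)

run-≤ : ∀ {P s B C Q} → B ≤ C → Run P s B Q → Run P s C Q
run-≤ B≤C (run d t q) = run d (ℕ.≤-trans t B≤C) q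

framed : ∀ {P s B Q} t {_ : T (above t P)} →
  Run P s B Q → Run P s B (λ s′ → Agree t s s′ × Q s′)
framed t {p} (run d b q) = run d b (exec-Agree p d , q)

record Keeps (P : Program) (s s′ : State) : Set where
  constructor keeping
  field
    kept : ∀ τ a {_ : T (untouched τ a P)} i j → read τ s′ a i j ≡ read τ s a i j

open Keeps public

keep : ∀ {P s B Q} → Run P s B Q → Run P s B (λ s′ → Keeps P s s′ × Q s′)
keep (run d b q) = run d b (keeping (λ τ a {p} → exec-untouched τ a p d) , q)

run-*1 : ∀ {P s c Q} → Run P s c Q → Run P s (c * 1) Q
run-*1 {c = c} = run-≤ (ℕ.≤-reflexive (sym (ℕ.*-identityʳ c)))

run-skip : ∀ {s} {Q : State → Set} → Q s → Run skip s 0 Q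
run-skip q = run skip z≤n q

run-assign : ∀ {τ a i j s} {e : Expr τ} {Q : State → Set} →
  Q (write τ s a (eval i s) (eval j s) (eval e s)) →
  Run (assign a i j e) s (suc (cost i + cost j + cost e)) Q
run-assign q = run assign ℕ.≤-refl q

assign-then : ∀ {τ a i j s P B Q} {e : Expr τ} →
  Run P (write τ s a (eval i s) (eval j s) (eval e s)) B Q →
  Run (assign a i j e ⨾ P) s (suc (cost i + cost j + cost e) + B) Q
assign-then (run d t q) = run (seq assign d) (ℕ.+-monoʳ-≤ _ t) q

straightCost : Program → ℕ
straightCost skip           = 0
straightCost (P ⨾ Q)        = straightCost P + straightCost Q
straightCost (assign a i j e) = suc (cost i + cost j + cost e)
straightCost (ifElse b P Q) = suc (costTest b + (straightCost P + straightCost Q))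
straightCost (while b P)    = 0

scaled-+ : ∀ a c Z → 1 ≤ Z → a + c * Z ≤ (a + c) * Z
scaled-+ a c Z 1≤Z = ℕ.≤-trans
  (ℕ.+-monoˡ-≤ (c * Z) (ℕ.≤-trans (ℕ.≤-reflexive (sym (ℕ.*-identityʳ a))) (ℕ.*-monoʳ-≤ a 1≤Z)))
  (ℕ.≤-reflexive (sym (ℕ.*-distribʳ-+ Z a c)))

assign-then* : ∀ {τ a i j s P Q} {e : Expr τ} c Z → 1 ≤ Z →
  Run P (write τ s a (eval i s) (eval j s) (eval e s)) (c * Z) Q →
  Run (assign a i j e ⨾ P) s ((straightCost (assign a i j e) + c) * Z) Q
assign-then* {a = a} {i} {j} {e = e} c Z 1≤Z r =
  run-≤ (scaled-+ (straightCost (assign a i j e)) c Z 1≤Z) (assign-then r)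

scaled-+ʳ : ∀ c a Z → 1 ≤ Z → c * Z + a ≤ (c + a) * Z
scaled-+ʳ c a Z 1≤Z = subst₂ _≤_ (ℕ.+-comm a (c * Z)) (cong (_* Z) (ℕ.+-comm a c))
  (scaled-+ a c Z 1≤Z)

infixr 4 _>>=_

_>>=_ : ∀ {P P′ s B B′ Q R} → Run P s B Q →
  (∀ {s′} → Q s′ → Run P′ s′ B′ R) → Run (P ⨾ P′) s (B + B′) R
run d t q >>= f with f q
... | run d′ t′ r = run (seq d d′) (ℕ.+-mono-≤ t t′) r

run-if : ∀ {b P P′ s B B′ Q} →
  (evalTest b s ≡ true → Run P s B Q) → (evalTest b s ≡ false → Run P′ s B′ Q) →
  Run (ifElse b P P′) s (suc (costTest b + (B + B′))) Q
run-if {b} {s = s} {B} {B′} f g with evalTest b s in eq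
... | true  with run d t q ← f refl =
  run (if-true eq d) (s≤s (ℕ.+-monoʳ-≤ (costTest b) (ℕ.≤-trans t (ℕ.m≤m+n B B′)))) q
... | false with run d t q ← g refl =
  run (if-false eq d) (s≤s (ℕ.+-monoʳ-≤ (costTest b) (ℕ.≤-trans t (ℕ.m≤n+m B′ B)))) q

run-while : ∀ {b P s B} n (J : ℕ → State → Set) →
  (∀ {k s} → k < n → J k s → evalTest b s ≡ true) →
  (∀ {s} → J n s → evalTest b s ≡ false) →
  (∀ {k s} → k < n → J k s → Run P s B (J (suc k))) →
  J 0 s → Run (while b P) s (n * (suc (costTest b) + B) + suc (costTest b)) (J n)
run-while {b} {P} {B = B} n J continue stop body J₀ = from n 0 (ℕ.+-identityʳ n) J₀
  where
  from : ∀ i k → i + k ≡ n → ∀ {s} → J k s →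
    Run (while b P) s (i * (suc (costTest b) + B) + suc (costTest b)) (J n)
  from zero    k refl q = run (while-false (stop q)) ℕ.≤-refl q
  from (suc i) k refl {s} q with run d t q′ ← body (s≤s (ℕ.m≤n+m k i)) q
    with run d′ t′ q″ ← from i (suc k) (ℕ.+-suc i k) q′ =
    run (while-true (continue (s≤s (ℕ.m≤n+m k i)) q) d d′)
      (ℕ.≤-trans (ℕ.+-mono-≤ (ℕ.+-monoʳ-≤ (suc (costTest b)) t) t′)
        (ℕ.≤-reflexive (sym (ℕ.+-assoc (suc (costTest b) + B) _ _)))) q″

loop≤ : ∀ c t n → n * (c + t) + c ≤ (c + t) * suc n
loop≤ c t n = ℕ.≤-trans (ℕ.+-monoʳ-≤ (n * (c + t)) (ℕ.m≤m+n c t))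
  (ℕ.≤-reflexive (trans (ℕ.+-comm (n * (c + t)) (c + t)) (ℕ.*-comm (suc n) (c + t))))

whileCost : Test → Program → ℕ
whileCost b P = suc (costTest b) + straightCost P

run-while* : ∀ {b P s} n (J : ℕ → State → Set) →
  (∀ {k s} → k < n → J k s → evalTest b s ≡ true) →
  (∀ {s} → J n s → evalTest b s ≡ false) →
  (∀ {k s} → k < n → J k s → Run P s (straightCost P) (J (suc k))) →
  J 0 s → Run (while b P) s (whileCost b P * suc n) (J n)
run-while* {b} {P} n J continue stop body J₀ =
  run-≤ (loop≤ (suc (costTest b)) (straightCost P) n) (run-while n J continue stop body J₀)

var : ∀ {τ} → ℕ → Expr τ
var x = cell x (lit 0) (lit 0)

_≔_ : ∀ {τ} → ℕ → Expr τ → Program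
x ≔ e = assign x (lit 0) (lit 0) e

infix 6 _≔_

for : ℕ → Expr nat → Program → Program
for x bound P =
  x ≔ lit {nat} 0 ⨾
  while (neg (leq bound (var x))) (P ⨾ x ≔ op add (lit 1) (var x))

≤ᵇ-true : ∀ {m n} → m ≤ n → (m ℕ.≤ᵇ n) ≡ true
≤ᵇ-true {m} {n} m≤n with m ℕ.≤ᵇ n in eq
... | true  = refl
... | false = ⊥-elim (subst T eq (ℕ.≤⇒≤ᵇ m≤n))

≤ᵇ-false : ∀ {m n} → n < m → (m ℕ.≤ᵇ n) ≡ false
≤ᵇ-false {m} {n} n<m with m ℕ.≤ᵇ n in eq
... | false = refl
... | true  = contradiction (ℕ.≤ᵇ⇒≤ m n (subst T (sym eq) tt)) (ℕ.<⇒≱ n<m)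

if-same : ∀ {A : Set} {b} {x y : A} → b ≡ true → (if b then x else y) ≡ x
if-same refl = refl

if-other : ∀ {A : Set} {b} {x y : A} → b ≡ false → (if b then x else y) ≡ y
if-other refl = refl

<ᵇ-true : ∀ {m n} → m < n → (m <ᵇ n) ≡ true
<ᵇ-true = ≤ᵇ-true

<ᵇ-false : ∀ {m n} → n ≤ m → (m <ᵇ n) ≡ false
<ᵇ-false n≤m = ≤ᵇ-false (s≤s n≤m)

≡ᵇ-refl : ∀ n → (n ≡ᵇ n) ≡ true
≡ᵇ-refl zero    = refl
≡ᵇ-refl (suc n) = ≡ᵇ-refl n

update-same : ∀ {A : Set} (M : Memory A) a i j x → update M a i j x a i j ≡ x
update-same M a i j x rewrite ≡ᵇ-refl a | ≡ᵇ-refl i | ≡ᵇ-refl j = refl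

forCost : Expr nat → ℕ
forCost bound =
  (suc (costTest (neg (leq bound (var 0)))) + cost (op add (lit 1) (var {nat} 0)) + 3)
  + (suc (costTest (neg (leq bound (var 0)))) + 4)

private
  forBound : ∀ n t a c Z → 1 ≤ Z →
    4 + (n * (t + (c * Z + (3 + a))) + t) ≤ (((t + a + 3) + (t + 4)) + c) * (Z * suc n)
  forBound n t a c (suc z) 1≤Z = ℕ.m+n≤o⇒m≤o _ {rest} (ℕ.≤-reflexive
    (solve 5 (λ n t a c z → con 4 :+ (n :* (t :+ (c :* (con 1 :+ z) :+ (con 3 :+ a))) :+ t)
        :+ (a :+ con 3 :+ t :+ c :+ n :* (t :+ con 4) :+ z :* (t :+ t :+ a :+ con 7 :+ c)
          :+ z :* n :* (t :+ a :+ con 3 :+ (t :+ con 4)))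
      := (((t :+ a :+ con 3) :+ (t :+ con 4)) :+ c) :* ((con 1 :+ z) :* (con 1 :+ n)))
      refl n t a c z))
    where
    open ℕ-Solver
    rest = a + 3 + t + c + n * (t + 4) + z * (t + t + a + 7 + c)
          + z * n * (t + a + 3 + (t + 4))

run-for : ∀ {x bound P s₀ n} c {Z} (I : ℕ → State → Set) →
  rank nat x ≡ x → T (above (suc x) P) →
  (∀ {s} → Agree x s₀ s → eval bound s ≡ n) →
  (∀ {k s v} → I k s → I k (write nat s x 0 0 v)) →
  1 ≤ Z →
  (∀ {k s} → k < n → Agree x s₀ s → nats s x 0 0 ≡ k → I k s → Run P s (c * Z) (I (suc k))) →
  I 0 s₀ → Run (for x bound P) s₀ ((forCost bound + c) * (Z * suc n)) (I n)
run-for {x} {bound} {P} {s₀} {n} c {Z} I rank-x above-P bound≡n stable 1≤Z body I₀ =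
  run-≤ (forBound n (suc (costTest (neg (leq bound (var 0))))) _ c Z 1≤Z) $
  run-map (λ (_ , _ , i) → i) $
  run-assign {Q = J 0} (set-Agree , update-same (nats s₀) x 0 0 0 , stable I₀) >>=
  run-while n J
    (λ k<n (A , x≡k , _) → cong not (≤ᵇ-false
      (subst₂ _<_ (sym x≡k) (sym (bound≡n A)) k<n)))
    (λ (A , x≡n , _) → cong not (≤ᵇ-true
      (ℕ.≤-reflexive (trans (bound≡n A) (sym x≡n)))))
    step
  where
  J : ℕ → State → Set
  J k s = Agree x s₀ s × nats s x 0 0 ≡ k × I k s
  set-Agree : ∀ {s v} → Agree x s (write nat s x 0 0 v)
  set-Agree {s} = write-Agree nat s x 0 0 _ (ℕ.≤-reflexive (sym rank-x))
  x<1+x : T (rank nat x <ᵇ suc x)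
  x<1+x = ℕ.<⇒<ᵇ (s≤s (ℕ.≤-reflexive rank-x))
  step : ∀ {k s} → k < n → J k s → Run (P ⨾ x ≔ op add (lit 1) (var x)) s _ (J (suc k))
  step k<n (A , x≡k , i) = framed (suc x) {above-P} (body k<n A x≡k i) >>= λ {s′} (A′ , i′) →
    run-assign ( Agree-trans (Agree-trans A (Agree-≤ (ℕ.n≤1+n x) A′)) set-Agree
               , trans (update-same (nats s′) x 0 0 _)
                   (cong suc (trans (at A′ nat x {x<1+x} 0 0) x≡k))
               , stable i′ )

-- The tree of tables

2^-pos : ∀ k → 1 ≤ 2 ℕ.^ k
2^-pos k = ℕ.m^n>0 2 k

2^-cancel-< : ∀ {k l} → 2 ℕ.^ k < 2 ℕ.^ l → k < l
2^-cancel-< {k} {l} lt with ℕ.<-≤-connex k l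
... | inj₁ k<l = k<l
... | inj₂ l≤k = contradiction (ℕ.^-monoʳ-≤ 2 l≤k) (ℕ.<⇒≱ lt)

sumTo : (ℕ → ℚ) → ℕ → ℚ
sumTo f zero    = 0ℚ
sumTo f (suc n) = sumTo f n +ℚ f n

sumTo-cong : ∀ {f g} n → (∀ {i} → i < n → f i ≡ g i) → sumTo f n ≡ sumTo g n
sumTo-cong zero    f≗g = refl
sumTo-cong (suc n) f≗g =
  cong₂ _+ℚ_ (sumTo-cong n (λ i<n → f≗g (ℕ.m≤n⇒m≤1+n i<n))) (f≗g ℕ.≤-refl)

sumTo-+ : ∀ f m n → sumTo f (m + n) ≡ sumTo f m +ℚ sumTo (λ i → f (m + i)) n
sumTo-+ f m zero    = trans (cong (sumTo f) (ℕ.+-identityʳ m)) (sym (ℚ.+-identityʳ (sumTo f m)))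
sumTo-+ f m (suc n) = begin
  sumTo f (m + suc n)                                       ≡⟨ cong (sumTo f) (ℕ.+-suc m n) ⟩
  sumTo f (m + n) +ℚ f (m + n)                              ≡⟨ cong (_+ℚ f (m + n)) (sumTo-+ f m n) ⟩
  sumTo f m +ℚ sumTo (λ i → f (m + i)) n +ℚ f (m + n)       ≡⟨ ℚ.+-assoc (sumTo f m) _ _ ⟩
  sumTo f m +ℚ sumTo (λ i → f (m + i)) (suc n)              ∎
  where open ≡-Reasoning

sumTo-head : ∀ f n → sumTo f (suc n) ≡ f 0 +ℚ sumTo (f ∘ suc) n
sumTo-head f n = trans (sumTo-+ f 1 n)
  (cong (_+ℚ sumTo (f ∘ suc) n) (ℚ.+-identityˡ (f 0)))

-- In heap order the children of node r are 2 r and 2 r + 1.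
treeSum : (ℕ → ℚ) → (height node : ℕ) → ℚ
treeSum f zero    r = f r
treeSum f (suc h) r = treeSum f h (2 * r) +ℚ treeSum f h (suc (2 * r))

2^-descend : ∀ h r → 2 ℕ.^ suc h * r ≡ 2 ℕ.^ h * (2 * r)
2^-descend h r = solve 2 (λ p r → (p :+ (p :+ con 0)) :* r := p :* (r :+ (r :+ con 0)))
  refl (2 ℕ.^ h) r
  where open ℕ-Solver

2^-descend′ : ∀ h r i → 2 ℕ.^ suc h * r + (2 ℕ.^ h + i) ≡ 2 ℕ.^ h * suc (2 * r) + i
2^-descend′ h r i = solve 3 (λ p r i → (p :+ (p :+ con 0)) :* r :+ (p :+ i)
    := p :* (con 1 :+ (r :+ (r :+ con 0))) :+ i)
  refl (2 ℕ.^ h) r i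
  where open ℕ-Solver

treeSum≡sumTo : ∀ f h r → treeSum f h r ≡ sumTo (λ j → f (2 ℕ.^ h * r + j)) (2 ℕ.^ h)
treeSum≡sumTo f zero r = sym (trans (ℚ.+-identityˡ _)
  (cong f (trans (ℕ.+-identityʳ _) (ℕ.+-identityʳ r))))
treeSum≡sumTo f (suc h) r = begin
  treeSum f h (2 * r) +ℚ treeSum f h (suc (2 * r))
    ≡⟨ cong₂ _+ℚ_ (treeSum≡sumTo f h (2 * r)) (treeSum≡sumTo f h (suc (2 * r))) ⟩
  sumTo (λ j → f (p * (2 * r) + j)) p +ℚ sumTo (λ j → f (p * suc (2 * r) + j)) p
    ≡⟨ cong₂ _+ℚ_
         (sumTo-cong p λ {j} _ → cong (λ x → f (x + j)) (sym (2^-descend h r)))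
         (sumTo-cong p λ {j} _ → cong f (sym (2^-descend′ h r j))) ⟩
  sumTo (λ j → f (2 * p * r + j)) p +ℚ sumTo (λ j → f (2 * p * r + (p + j))) p
    ≡⟨ sumTo-+ (λ j → f (2 * p * r + j)) p p ⟨
  sumTo (λ j → f (2 * p * r + j)) (p + p)
    ≡⟨ cong (sumTo (λ j → f (2 * p * r + j))) (cong (p +_) (ℕ.+-identityʳ p)) ⟨
  sumTo (λ j → f (2 * p * r + j)) (2 * p)
    ∎
  where
  open ≡-Reasoning
  p = 2 ℕ.^ h

treeSum-+ : ∀ f h k r → treeSum f (k + h) r ≡ treeSum (treeSum f h) k r
treeSum-+ f h zero    r = refl
treeSum-+ f h (suc k) r = cong₂ _+ℚ_ (treeSum-+ f h k (2 * r)) (treeSum-+ f h k (suc (2 * r)))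

treeSum-nonNeg : ∀ {f} → (∀ r → 0ℚ ≤ℚ f r) → ∀ h r → 0ℚ ≤ℚ treeSum f h r
treeSum-nonNeg 0≤f zero    r = 0≤f r
treeSum-nonNeg 0≤f (suc h) r =
  +-nonNeg (treeSum-nonNeg 0≤f h (2 * r)) (treeSum-nonNeg 0≤f h (suc (2 * r)))

mask : (ℕ → Bool) → (ℕ → ℚ) → ℕ → ℚ
mask σ f r = if σ r then f r else 0ℚ

record Tables : Set where
  constructor tables
  field
    flag   : ℕ → ℕ → ℕ
    weight : ℕ → ℕ → ℚ
    left   : ℕ → ℕ → ℕ
    right  : ℕ → ℕ → ℕ

open Tables public

Present : Tables → ℕ → ℕ → Set
Present t r c = 1 ≤ flag t r c

joined : Tables → (r a b : ℕ) → ℚ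
joined t r a b = weight t (2 * r) a +ℚ weight t (suc (2 * r)) b

-- Entry c of node r describes a set of items below r whose value is
-- approximately G c.  The 2ᵉ nodes of level e are the categories; b is a
-- lower bound on the positive values and B an upper bound on all sums.
record Scheme : Set where
  field
    d e K     : ℕ
    G         : ℕ → ℚ
    β ε₁ b B  : ℚ
    lo hi     : ℕ → ℚ
    val wt    : ℕ → ℚ
    1≤β       : 1ℚ ≤ℚ β
    β^≤ε₁     : β ^ suc (d + e) ≤ℚ ε₁
    0≤b       : 0ℚ ≤ℚ b
    G-zero    : G 0 ≡ 0ℚ
    G-range   : ∀ c → c ≤ K → G c ≡ 0ℚ ⊎ b ≤ℚ G c
    G-nonNeg  : ∀ c → 0ℚ ≤ℚ G c
    G-round   : ∀ V → V ≡ 0ℚ ⊎ b ≤ℚ V → V ≤ℚ B →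
                ∃[ c ] (c ≤ K × G c ≤ℚ V × V ≤ℚ β *ℚ G c)
    val-range : ∀ r → val r ≡ 0ℚ ⊎ b ≤ℚ val r
    val≥0     : ∀ r → 0ℚ ≤ℚ val r
    wt≥0      : ∀ r → 0ℚ ≤ℚ wt r
    1≤d       : 1 ≤ d

module TreeTables (𝒮 : Scheme) where
  open Scheme 𝒮

  P M : ℕ
  P = 2 ℕ.^ (d + e)
  M = 2 ℕ.^ e

  Rounds : ℚ → ℕ → Set
  Rounds V c = G c ≤ℚ V × V ≤ℚ β *ℚ G c

  Admissible : ℕ → ℕ → Set
  Admissible r c = M ≤ r → r < M + M →
    lo (r ∸ M) ≤ℚ ε₁ *ℚ G c × G c ≤ℚ hi (r ∸ M)

  Link : Tables → (r a b c : ℕ) → Set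
  Link t r a b c =
    Present t (2 * r) a × Present t (suc (2 * r)) b ×
    Rounds (G a +ℚ G b) c × Admissible r c

  Sound : Tables → ℕ → Set
  Sound t r = ∀ c → Present t r c →
    Link t r (left t r c) (right t r c) c ×
    weight t r c ≡ joined t r (left t r c) (right t r c)

  Complete : Tables → (r a b c : ℕ) → Set
  Complete t r a b c = Link t r a b c → Present t r c × weight t r c ≤ℚ joined t r a b

  LeafSound : Tables → ℕ → Set
  LeafSound t r = ∀ c → Present t r c →
    (c ≡ 0 × weight t r c ≡ 0ℚ) ⊎ (1 ≤ c × Rounds (val r) c × weight t r c ≡ wt r)

  LeafComplete : Tables → ℕ → Set
  LeafComplete t r = Present t r 0 ×
    (∀ c → c < K → Rounds (val r) (suc c) → Present t r (suc c))

  record Filled (t : Tables) : Set where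
    field
      leafSound    : ∀ r → P ≤ r → r < P + P → LeafSound t r
      leafComplete : ∀ r → P ≤ r → r < P + P → LeafComplete t r
      sound        : ∀ r → 1 ≤ r → r < P → Sound t r
      complete     : ∀ r → 1 ≤ r → r < P →
                     ∀ a b c → a ≤ K → b ≤ K → c ≤ K → Complete t r a b c

  record Node (h k r : ℕ) : Set where
    constructor at-level
    field
      height+level : h + k ≡ d + e
      first≤       : 2 ℕ.^ k ≤ r
      <next        : r < 2 ℕ.^ suc k

  open Node

  root : Node (d + e) 0 1
  root = at-level (ℕ.+-identityʳ (d + e)) (s≤s z≤n) (s≤s (s≤s z≤n))

  leftChild : ∀ {h k r} → Node (suc h) k r → Node h (suc k) (2 * r)
  leftChild {h} {k} (at-level h+k 2ᵏ≤r r<2ᵏ) =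
    at-level (trans (ℕ.+-suc h k) h+k) (ℕ.*-monoʳ-≤ 2 2ᵏ≤r) (ℕ.*-monoʳ-< 2 r<2ᵏ)

  rightChild : ∀ {h k r} → Node (suc h) k r → Node h (suc k) (suc (2 * r))
  rightChild {h} {k} {r} (at-level h+k 2ᵏ≤r r<2ᵏ) =
    at-level (trans (ℕ.+-suc h k) h+k) (ℕ.m≤n⇒m≤1+n (ℕ.*-monoʳ-≤ 2 2ᵏ≤r))
      (ℕ.≤-trans (ℕ.≤-reflexive (sym (ℕ.*-suc 2 r))) (ℕ.*-monoʳ-≤ 2 r<2ᵏ))

  node≥1 : ∀ {h k r} → Node h k r → 1 ≤ r
  node≥1 {k = k} (at-level _ 2ᵏ≤r _) = ℕ.≤-trans (2^-pos k) 2ᵏ≤r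

  inner<P : ∀ {h k r} → Node (suc h) k r → r < P
  inner<P {h} {k} (at-level h+k _ r<2ᵏ) = ℕ.<-≤-trans r<2ᵏ
    (ℕ.^-monoʳ-≤ 2 (ℕ.≤-trans (s≤s (ℕ.m≤n+m k h)) (ℕ.≤-reflexive h+k)))

  leaf-range : ∀ {k r} → Node 0 k r → P ≤ r × r < P + P
  leaf-range (at-level refl 2ᵏ≤r r<2ᵏ) =
    2ᵏ≤r , ℕ.<-≤-trans r<2ᵏ (ℕ.≤-reflexive (cong (P +_) (ℕ.+-identityʳ P)))

  category-height : ∀ {h k r} → Node h k r → M ≤ r → r < M + M → h ≡ d
  category-height {h} {k} (at-level h+k 2ᵏ≤r r<2ᵏ) M≤r r<2M =
    ℕ.+-cancelʳ-≡ e h d (trans (cong (h +_) (sym k≡e)) h+k)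
    where
    k≡e : k ≡ e
    k≡e = ℕ.≤-antisym
      (ℕ.≤-pred (2^-cancel-< (ℕ.≤-<-trans 2ᵏ≤r
        (ℕ.<-≤-trans r<2M (ℕ.≤-reflexive (cong (M +_) (sym (ℕ.+-identityʳ M))))))))
      (ℕ.≤-pred (2^-cancel-< (ℕ.≤-<-trans M≤r r<2ᵏ)))

  range-+ : ∀ {x y} → x ≡ 0ℚ ⊎ b ≤ℚ x → y ≡ 0ℚ ⊎ b ≤ℚ y → x +ℚ y ≡ 0ℚ ⊎ b ≤ℚ x +ℚ y
  range-+ (inj₁ refl) (inj₁ refl) = inj₁ refl
  range-+ {y = y} (inj₁ refl) (inj₂ b≤y) =
    inj₂ (ℚ.≤-trans b≤y (ℚ.≤-reflexive (sym (ℚ.+-identityˡ y))))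
  range-+ {y = y} (inj₂ b≤x) (inj₁ refl) =
    inj₂ (ℚ.≤-trans b≤x (p≤p+q ℚ.≤-refl))
  range-+ (inj₂ b≤x) (inj₂ b≤y) =
    inj₂ (ℚ.≤-trans b≤x (p≤p+q (ℚ.≤-trans 0≤b b≤y)))

  0≤β : 0ℚ ≤ℚ β
  0≤β = ℚ.≤-trans 0≤1 1≤β

  β^≤ : ∀ {h} → h ≤ d + e → β ^ suc h ≤ℚ ε₁
  β^≤ h≤ = ℚ.≤-trans (^-monoʳ 1≤β (s≤s h≤)) β^≤ε₁

  join-upper : ∀ n {x y a b′ c} → x ≤ℚ β ^ n *ℚ G a → y ≤ℚ β ^ n *ℚ G b′ →
    G a +ℚ G b′ ≤ℚ β *ℚ G c → x +ℚ y ≤ℚ β ^ suc n *ℚ G c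
  join-upper n {x} {y} {a} {b′} {c} x≤ y≤ sum≤ = begin
    x +ℚ y                             ≤⟨ ℚ.+-mono-≤ x≤ y≤ ⟩
    β ^ n *ℚ G a +ℚ β ^ n *ℚ G b′      ≡⟨ ℚ.*-distribˡ-+ (β ^ n) (G a) (G b′) ⟨
    β ^ n *ℚ (G a +ℚ G b′)             ≤⟨ *-monoʳ (^-nonNeg n 0≤β) sum≤ ⟩
    β ^ n *ℚ (β *ℚ G c)                ≡⟨ ℚ.*-assoc (β ^ n) β (G c) ⟨
    β ^ n *ℚ β *ℚ G c                  ≡⟨ cong (_*ℚ G c) (ℚ.*-comm (β ^ n) β) ⟩
    β ^ suc n *ℚ G c                   ∎
    where open ℚ.≤-Reasoning

  leaf-upper : ∀ {x c} → x ≤ℚ β *ℚ G c → x ≤ℚ β ^ 1 *ℚ G c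
  leaf-upper {x} {c} = subst (λ p → x ≤ℚ p *ℚ G c) (sym (ℚ.*-identityʳ β))

  unselected : ∀ {t r} → LeafSound t r → Present t r 0 → weight t r 0 ≡ 0ℚ
  unselected {t} leaf p with leaf 0 p
  ... | inj₁ (_ , w≡0) = w≡0
  ... | inj₂ (() , _)

  selected : ∀ {t r c} → LeafSound t r → Present t r (suc c) →
    Rounds (val r) (suc c) × weight t r (suc c) ≡ wt r
  selected {c = c} leaf p with leaf (suc c) p
  ... | inj₁ (() , _)
  ... | inj₂ (_ , q) = q

  module _ {t : Tables} (filled : Filled t) where
    open Filled filled

    module _ (σ : ℕ → Bool) where

      record Approximation (h r c : ℕ) : Set where
        constructor approximation
        field
          index≤  : c ≤ K
          present : Present t r c
          weight≤ : weight t r c ≤ℚ treeSum (mask σ wt) h r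
          lower   : G c ≤ℚ treeSum (mask σ val) h r
          upper   : treeSum (mask σ val) h r ≤ℚ β ^ suc h *ℚ G c

      open Approximation

      approximable-leaf : ∀ {r} → P ≤ r → r < P + P → val r ≤ℚ B → ∃ (Approximation 0 r)
      approximable-leaf {r} P≤r r<2P v≤B with σ r in σr
        | leafComplete r P≤r r<2P | leafSound r P≤r r<2P
      ... | false | present₀ , _ | leaf = 0 , record
        { index≤  = z≤n
        ; present = present₀
        ; weight≤ = ℚ.≤-reflexive (trans (unselected {t} leaf present₀) (masked wt))
        ; lower   = ℚ.≤-reflexive (trans G-zero (masked val))
        ; upper   = ℚ.≤-trans (ℚ.≤-reflexive (sym (masked val)))
                      (*-nonNeg (^-nonNeg 1 0≤β) (G-nonNeg 0))
        }
        where
        masked : ∀ f → 0ℚ ≡ mask σ f r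
        masked f rewrite σr = refl
      ... | true | present₀ , present₊ | leaf with G-round (val r) (val-range r) v≤B
      ...   | c , c≤K , G≤v , v≤βG = c , record
        { index≤  = c≤K
        ; present = present-at c c≤K G≤v v≤βG
        ; weight≤ = subst (weight t r c ≤ℚ_) (masked wt)
                      (weight-at c (present-at c c≤K G≤v v≤βG))
        ; lower   = subst (G c ≤ℚ_) (masked val) G≤v
        ; upper   = subst (_≤ℚ β ^ 1 *ℚ G c) (masked val) (leaf-upper {c = c} v≤βG)
        }
        where
        masked : ∀ f → f r ≡ mask σ f r
        masked f rewrite σr = refl
        present-at : ∀ c → c ≤ K → G c ≤ℚ val r → val r ≤ℚ β *ℚ G c → Present t r c
        present-at zero    _   _ _ = present₀
        present-at (suc c) c<K p q = present₊ c c<K (p , q)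
        weight-at : ∀ c → Present t r c → weight t r c ≤ℚ wt r
        weight-at zero    p = ℚ.≤-trans (ℚ.≤-reflexive (unselected {t} leaf p)) (wt≥0 r)
        weight-at (suc c) p = ℚ.≤-reflexive (proj₂ (selected {t} leaf p))

      masked≤ : ∀ h r → treeSum (mask σ val) h r ≤ℚ treeSum val h r
      masked≤ zero    r with σ r
      ... | true  = ℚ.≤-refl
      ... | false = val≥0 r
      masked≤ (suc h) r = ℚ.+-mono-≤ (masked≤ h (2 * r)) (masked≤ h (suc (2 * r)))

      module _
        (feasible : ∀ r → M ≤ r → r < M + M →
          lo (r ∸ M) ≤ℚ treeSum (mask σ val) d r ×
          treeSum (mask σ val) d r ≤ℚ hi (r ∸ M))
        where

        approximable-join : ∀ {h k r a b′} → Node (suc h) k r → treeSum val (suc h) r ≤ℚ B →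
          Approximation h (2 * r) a → Approximation h (suc (2 * r)) b′ →
          ∃ (Approximation (suc h) r)
        approximable-join {h} {k} {r} {a} {b′} node v≤B A A′
          with G-round (G a +ℚ G b′)
                 (range-+ (G-range a (index≤ A)) (G-range b′ (index≤ A′)))
                 (ℚ.≤-trans (ℚ.+-mono-≤ (lower A) (lower A′))
                   (ℚ.≤-trans (masked≤ (suc h) r) v≤B))
        ... | c , c≤K , G≤ , ≤βG = c , record
          { index≤  = c≤K
          ; present = proj₁ merged
          ; weight≤ = ℚ.≤-trans (proj₂ merged) (ℚ.+-mono-≤ (weight≤ A) (weight≤ A′))
          ; lower   = lower′
          ; upper   = upper′
          }
          where
          lower′ = ℚ.≤-trans G≤ (ℚ.+-mono-≤ (lower A) (lower A′))
          upper′ = join-upper (suc h) {c = c} (upper A) (upper A′) ≤βG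
          admissible : Admissible r c
          admissible M≤r r<2M
            with lo≤ , ≤hi ← subst (λ h′ → lo (r ∸ M) ≤ℚ treeSum (mask σ val) h′ r ×
                   treeSum (mask σ val) h′ r ≤ℚ hi (r ∸ M))
                   (sym (category-height node M≤r r<2M)) (feasible r M≤r r<2M) =
            ℚ.≤-trans lo≤ (ℚ.≤-trans upper′ (*-monoˡ {β ^ suc (suc h)} (G-nonNeg c)
              (β^≤ (ℕ.≤-trans (ℕ.m≤m+n (suc h) k) (ℕ.≤-reflexive (height+level node)))))) ,
            ℚ.≤-trans lower′ ≤hi
          merged = complete r (node≥1 node) (inner<P node) a b′ c
            (index≤ A) (index≤ A′) c≤K (present A , present A′ , (G≤ , ≤βG) , admissible)

        approximable : ∀ h k r → Node h k r → treeSum val h r ≤ℚ B →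
          ∃ (Approximation h r)
        approximable zero k r node v≤B =
          approximable-leaf (proj₁ (leaf-range node)) (proj₂ (leaf-range node)) v≤B
        approximable (suc h) k r node v≤B = approximable-join node v≤B
          (proj₂ (approximable h (suc k) (2 * r) (leftChild node)
            (ℚ.≤-trans (p≤p+q (treeSum-nonNeg val≥0 h (suc (2 * r)))) v≤B)))
          (proj₂ (approximable h (suc k) (suc (2 * r)) (rightChild node)
            (ℚ.≤-trans (q≤p+q (treeSum-nonNeg val≥0 h (2 * r))) v≤B)))

    module _
      (X : ℕ → ℕ)
      (traced : ∀ r → 1 ≤ r → r < P →
        X (2 * r) ≡ left t r (X r) × X (suc (2 * r)) ≡ right t r (X r))
      where

      chosen : ℕ → Bool
      chosen r = 0 <ᵇ X r

      children-present : ∀ {h k r} → Node (suc h) k r → Present t r (X r) →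
        Present t (2 * r) (X (2 * r)) × Present t (suc (2 * r)) (X (suc (2 * r)))
      children-present {r = r} node p
        with sound r (node≥1 node) (inner<P node) (X r) p | traced r (node≥1 node) (inner<P node)
      ... | (pˡ , pʳ , _) , _ | ≡ˡ , ≡ʳ =
        subst (Present t (2 * r)) (sym ≡ˡ) pˡ , subst (Present t (suc (2 * r))) (sym ≡ʳ) pʳ

      record Realized (h r : ℕ) : Set where
        constructor realized
        field
          weight≡ : treeSum (mask chosen wt) h r ≡ weight t r (X r)
          lower   : G (X r) ≤ℚ treeSum (mask chosen val) h r
          upper   : treeSum (mask chosen val) h r ≤ℚ β ^ suc h *ℚ G (X r)

      realize-leaf : ∀ {r} → P ≤ r → r < P + P → Present t r (X r) → Realized 0 r
      realize-leaf {r} P≤r r<2P p = let w≡ , l , u = entry (X r) p in realized w≡ l u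
        where
        entry : ∀ c → Present t r c → let masked = λ f → if 0 <ᵇ c then f r else 0ℚ in
          masked wt ≡ weight t r c × G c ≤ℚ masked val × masked val ≤ℚ β ^ 1 *ℚ G c
        entry zero p = sym (unselected {t} (leafSound r P≤r r<2P) p) ,
          ℚ.≤-reflexive G-zero , *-nonNeg (^-nonNeg 1 0≤β) (G-nonNeg 0)
        entry (suc c) p with (G≤v , v≤βG) , w≡ ← selected {t} (leafSound r P≤r r<2P) p =
          sym w≡ , G≤v , leaf-upper {c = suc c} v≤βG

      realize : ∀ h k r → Node h k r → Present t r (X r) → Realized h r
      realize zero k r node p =
        realize-leaf (proj₁ (leaf-range node)) (proj₂ (leaf-range node)) p
      realize (suc h) k r node p
        with realize h (suc k) (2 * r) (leftChild node) (proj₁ (children-present node p))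
           | realize h (suc k) (suc (2 * r)) (rightChild node) (proj₂ (children-present node p))
           | sound r (node≥1 node) (inner<P node) (X r) p
           | traced r (node≥1 node) (inner<P node)
      ... | realized wˡ lˡ uˡ | realized wʳ lʳ uʳ | (_ , _ , (G≤ , ≤βG) , _) , w≡ | ≡ˡ , ≡ʳ
        rewrite ≡ˡ | ≡ʳ = record
        { weight≡ = trans (cong₂ _+ℚ_ wˡ wʳ) (sym w≡)
        ; lower   = ℚ.≤-trans G≤ (ℚ.+-mono-≤ lˡ lʳ)
        ; upper   = join-upper (suc h) {c = X r} uˡ uʳ ≤βG
        }

      descend : ∀ j {h k r} → Node (j + h) k r → Present t r (X r) →
        ∀ {i} → i < 2 ℕ.^ j → let q = 2 ℕ.^ j * r + i in
        Node h (j + k) q × Present t q (X q)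
      descend zero {h} {k} {r} node p {zero} _ =
        subst (λ q → Node h k q × Present t q (X q))
          (sym (trans (ℕ.+-identityʳ (r + 0)) (ℕ.+-identityʳ r))) (node , p)
      descend zero node p {suc i} (s≤s ())
      descend (suc j) {h} {k} {r} node p {i} i< with ℕ.<-≤-connex i (2 ℕ.^ j)
      ... | inj₁ i<2ʲ =
        subst₂ (λ l q → Node h l (q + i) × Present t (q + i) (X (q + i)))
          (ℕ.+-suc j k) (sym (2^-descend j r))
          (descend j (leftChild node) (proj₁ (children-present node p)) i<2ʲ)
      ... | inj₂ 2ʲ≤i =
        subst₂ (λ l q → Node h l q × Present t q (X q))
          (ℕ.+-suc j k)
          (trans (sym (2^-descend′ j r (i ∸ 2 ℕ.^ j)))
            (cong (2 ℕ.^ suc j * r +_) (ℕ.m+[n∸m]≡n 2ʲ≤i)))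
          (descend j (rightChild node) (proj₂ (children-present node p))
            (ℕ.+-cancelˡ-< (2 ℕ.^ j) _ _ (ℕ.≤-<-trans (ℕ.≤-reflexive (ℕ.m+[n∸m]≡n 2ʲ≤i))
              (ℕ.<-≤-trans i< (ℕ.≤-reflexive (cong (2 ℕ.^ j +_) (ℕ.+-identityʳ (2 ℕ.^ j))))))))

      category-bounds : Present t 1 (X 1) → ∀ {i} → i < M →
        let V = treeSum (mask chosen val) d (M + i) in
        lo i ≤ℚ ε₁ *ℚ V × V ≤ℚ ε₁ *ℚ hi i
      category-bounds p {i} i<M = conclude d refl
        where
        at-category : Node d e (M + i) × Present t (M + i) (X (M + i))
        at-category = subst₂ (λ l q → Node d l (q + i) × Present t (q + i) (X (q + i)))
          (ℕ.+-identityʳ e) (ℕ.*-identityʳ M)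
          (descend e (subst (λ h → Node h 0 1) (ℕ.+-comm d e) root) p i<M)
        conclude : ∀ h → h ≡ d → let V = treeSum (mask chosen val) h (M + i) in
          lo i ≤ℚ ε₁ *ℚ V × V ≤ℚ ε₁ *ℚ hi i
        conclude zero refl = contradiction 1≤d λ ()
        conclude (suc h) refl
          with realized _ l u ← realize d e (M + i) (proj₁ at-category) (proj₂ at-category)
          with (_ , _ , _ , adm) , _ ←
                 sound (M + i) (node≥1 (proj₁ at-category)) (inner<P {h} (proj₁ at-category))
                   (X (M + i)) (proj₂ at-category)
          with lo≤ , ≤hi ← adm (ℕ.m≤m+n M i) (ℕ.+-monoʳ-< M i<M)
          rewrite ℕ.m+n∸m≡n M i =
          ℚ.≤-trans lo≤ (*-monoʳ 0≤ε₁ l) ,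
          ℚ.≤-trans u (*-mono 0≤ε₁ (G-nonNeg (X (M + i))) (β^≤ (ℕ.m≤m+n d e)) ≤hi)
          where
          0≤ε₁ : 0ℚ ≤ℚ ε₁
          0≤ε₁ = ℚ.≤-trans (^-nonNeg (suc (d + e)) 0≤β) β^≤ε₁

-- Merging the tables of the children

Leq : ∀ τ → ⟦ τ ⟧ → ⟦ τ ⟧ → Set
Leq nat = _≤_
Leq rat = _≤ℚ_

Holds : Test → State → Set
Holds (leq {τ} e f) s = Leq τ (eval e s) (eval f s)
Holds (and b c)     s = Holds b s × Holds c s
Holds (neg b)       s = ¬ Holds b s

Reflects : Bool → Set → Set
Reflects true  A = A
Reflects false A = ¬ A

T⇔-reflects : ∀ {A : Set} b → (T b → A) → (A → T b) → Reflects b A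
T⇔-reflects true  f g = f tt
T⇔-reflects false f g = g

reflects : ∀ b s → Reflects (evalTest b s) (Holds b s)
reflects (leq {nat} e f) s = T⇔-reflects _ (ℕ.≤ᵇ⇒≤ _ _) ℕ.≤⇒≤ᵇ
reflects (leq {rat} e f) s = T⇔-reflects _ ℚ.≤ᵇ⇒≤ ℚ.≤⇒≤ᵇ
reflects (and b c) s with evalTest b s | evalTest c s | reflects b s | reflects c s
... | true  | true  | p | q = p , q
... | true  | false | p | q = q ∘ proj₂
... | false | _     | p | q = p ∘ proj₁
reflects (neg b) s with evalTest b s | reflects b s
... | true  | p = _$ p
... | false | p = p

Holds-stable : ∀ b s → ¬ ¬ Holds b s → Holds b s
Holds-stable b s with evalTest b s | reflects b s
... | true  | p = λ _ → p
... | false | p = λ q → ⊥-elim (q p)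

test-true : ∀ b s → evalTest b s ≡ true → Holds b s
test-true b s eq = subst (λ x → Reflects x (Holds b s)) eq (reflects b s)

test-false : ∀ b s → evalTest b s ≡ false → ¬ Holds b s
test-false b s eq = subst (λ x → Reflects x (Holds b s)) eq (reflects b s)

-- Arrays 0 to 4 hold the input; the numbers not named here or below are
-- loop counters, except for 18, which holds the current node.
#width #count #factor #top #grid : ℕ
#width  = 7
#count  = 8
#factor = 14
#top    = 15
#grid   = 16

#flag #weight #left #right : ℕ
#flag   = 22
#weight = 23
#left   = 24
#right  = 25

tableOf : State → Tables
tableOf s = record
  { flag   = nats s #flag
  ; weight = rats s #weight
  ; left   = nats s #left
  ; right  = nats s #right
  }

Progress : (Tables → Tables → Set) → (Tables → Set) → (Tables → Set) → State → State → Set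
Progress R Inv Done s s′ = R (tableOf s) (tableOf s′) × Inv (tableOf s′) × Done (tableOf s′)

below-suc : ∀ {n} {Q : ℕ → Set} → (∀ k → k < n → Q k) → Q n → ∀ k → k < suc n → Q k
below-suc {n} {Q} below at-n k k<1+n with ℕ.m<1+n⇒m<n∨m≡n k<1+n
... | inj₁ k<n = below k k<n
... | inj₂ k≡n = subst Q (sym k≡n) at-n

run-for-each : ∀ {x bound P s₀ n} c Z
  (R : Tables → Tables → Set) (Inv : Tables → Set)
  (Done : ℕ → Tables → Set) →
  (∀ {t} → R t t) → (∀ {t t′ t″} → R t t′ → R t′ t″ → R t t″) →
  (∀ {k t t′} → R t t′ → Done k t → Done k t′) →
  rank nat x ≡ x → T (above (suc x) P) →
  (∀ s v → tableOf (write nat s x 0 0 v) ≡ tableOf s) →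
  (∀ {s} → Agree x s₀ s → eval bound s ≡ n) →
  1 ≤ Z → Inv (tableOf s₀) →
  (∀ {k s} → k < n → Agree x s₀ s → nats s x 0 0 ≡ k → Inv (tableOf s) →
    Run P s (c * Z) (Progress R Inv (Done k) s)) →
  Run (for x bound P) s₀ ((forCost bound + c) * (Z * suc n))
    (Progress R Inv (λ t → ∀ k → k < n → Done k t) s₀)
run-for-each {s₀ = s₀} c Z R Inv Done R-refl R-trans mono rank-x above-P same bound≡n 1≤Z inv body =
  run-for c (λ k → Progress R Inv (λ t → ∀ i → i < k → Done i t) s₀)
    rank-x above-P bound≡n
    (λ {k} {s} {v} → subst
      (λ t → R (tableOf s₀) t × Inv t × (∀ i → i < k → Done i t)) (sym (same s v)))
    1≤Z
    (λ k<n A x≡k (r , i , done) →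
      run-map (λ (r′ , i′ , done′) →
          R-trans r r′ , i′ , below-suc (λ j j<k → mono r′ (done j j<k)) done′)
        (body k<n A x≡k i))
    (R-refl , inv , λ _ ())

gridAt : Expr nat → Expr rat
gridAt c = cell #grid c (lit 0)

leafCount : Expr nat
leafCount = op mul (var #width) (var #count)

rows : Expr nat
rows = op add (lit 1) (var #top)

roundsTest : Expr rat → Expr nat → Test
roundsTest V c = and (leq (gridAt c) V) (leq V (op mul (var #factor) (gridAt c)))

module Merge (ε₁ : ℚ) where
  r̂ â b̂ ĉ : Expr nat
  r̂ = var 18
  â = var 19
  b̂ = var 20
  ĉ = var 21

  leftNode rightNode category : Expr nat
  leftNode  = op mul (lit 2) r̂
  rightNode = op add (lit 1) (op mul (lit 2) r̂)
  category  = op sub r̂ (var #count)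

  joinedWeight : Expr rat
  joinedWeight = op add (cell #weight leftNode â) (cell #weight rightNode b̂)

  isCategory boundsTest admissibleTest linkTest mergeTest : Test
  isCategory = and (leq (var #count) r̂) (neg (leq (op add (var #count) (var #count)) r̂))
  boundsTest = and (leq (cell 2 category (lit 0)) (op mul (lit ε₁) (gridAt ĉ)))
                   (leq (gridAt ĉ) (cell 3 category (lit 0)))
  admissibleTest = neg (and isCategory (neg boundsTest))
  linkTest = and (leq (lit {nat} 1) (cell #flag leftNode â))
    (and (leq (lit {nat} 1) (cell #flag rightNode b̂))
    (and (roundsTest (op add (gridAt â) (gridAt b̂)) ĉ) admissibleTest))
  mergeTest = and linkTest
    (neg (and (leq (lit {nat} 1) (cell #flag r̂ ĉ)) (leq (cell #weight r̂ ĉ) joinedWeight)))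

  mergeEntry mergeRow setNode mergeTables : Program
  mergeEntry = ifElse mergeTest
    ( assign {nat} #flag r̂ ĉ (lit 1) ⨾
      assign {rat} #weight r̂ ĉ joinedWeight ⨾
      assign {nat} #left r̂ ĉ â ⨾
      assign {nat} #right r̂ ĉ b̂ )
    skip
  mergeRow = for 19 rows (for 20 rows (for 21 rows mergeEntry))
  setNode = 18 ≔ op sub leafCount (op add (lit 1) (var 17))
  mergeTables = for 17 (op sub leafCount (lit 1))
    (setNode ⨾ mergeRow)

putEntry : Tables → (r c : ℕ) → ℚ → (a b : ℕ) → Tables
putEntry t r c w a b = record
  { flag   = λ r′ c′ → if (r ≡ᵇ r′) ∧ (c ≡ᵇ c′) then 1 else flag t r′ c′
  ; weight = λ r′ c′ → if (r ≡ᵇ r′) ∧ (c ≡ᵇ c′) then w else weight t r′ c′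
  ; left   = λ r′ c′ → if (r ≡ᵇ r′) ∧ (c ≡ᵇ c′) then a else left t r′ c′
  ; right  = λ r′ c′ → if (r ≡ᵇ r′) ∧ (c ≡ᵇ c′) then b else right t r′ c′
  }

module _ (𝒮 : Scheme) where
  open Scheme 𝒮
  open TreeTables 𝒮
  open Merge ε₁

  record Env (s : State) : Set where
    field
      width≡  : nats s #width 0 0 ≡ 2 ℕ.^ d
      count≡  : nats s #count 0 0 ≡ M
      factor≡ : rats s #factor 0 0 ≡ β
      top≡    : nats s #top 0 0 ≡ K
      grid≡   : ∀ c → rats s #grid c 0 ≡ G c
      lo≡     : ∀ i → rats s 2 i 0 ≡ lo i
      hi≡     : ∀ i → rats s 3 i 0 ≡ hi i
      val≡    : ∀ {i j} → i < M → j < 2 ℕ.^ d →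
                rats s 1 i j ≡ val (2 ℕ.^ d * (M + i) + j)
      wt≡     : ∀ {i j} → i < M → j < 2 ℕ.^ d →
                rats s 0 i j ≡ wt (2 ℕ.^ d * (M + i) + j)

    leafCount≡ : nats s #width 0 0 * nats s #count 0 0 ≡ P
    leafCount≡ = trans (cong₂ _*_ width≡ count≡) (sym (ℕ.^-distribˡ-+-* 2 d e))

  open Env

  Env-Agree : ∀ {u s s′} {_ : T (17 ℕ.≤ᵇ u)} → Agree u s s′ → Env s → Env s′
  Env-Agree {_} {_} {_} {17≤u} A′ E = record
    { width≡  = trans (at A nat #width 0 0) (width≡ E)
    ; count≡  = trans (at A nat #count 0 0) (count≡ E)
    ; factor≡ = trans (at A rat #factor 0 0) (factor≡ E)
    ; top≡    = trans (at A nat #top 0 0) (top≡ E)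
    ; grid≡   = λ c → trans (at A rat #grid c 0) (grid≡ E c)
    ; lo≡     = λ i → trans (at A rat 2 i 0) (lo≡ E i)
    ; hi≡     = λ i → trans (at A rat 3 i 0) (hi≡ E i)
    ; val≡    = λ i<M j<n → trans (at A rat 1 _ _) (val≡ E i<M j<n)
    ; wt≡     = λ i<M j<n → trans (at A rat 0 _ _) (wt≡ E i<M j<n)
    }
    where A = narrow 17 {_} {_} {_} {17≤u} A′

  record SameRow (r : ℕ) (t t′ : Tables) : Set where
    field
      flag≡   : ∀ c → flag t′ r c ≡ flag t r c
      weight≡ : ∀ c → weight t′ r c ≡ weight t r c
      left≡   : ∀ c → left t′ r c ≡ left t r c
      right≡  : ∀ c → right t′ r c ≡ right t r c

  open SameRow

  record Refines (r : ℕ) (t t′ : Tables) : Set where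
    field
      others : ∀ r′ → r′ ≢ r → SameRow r′ t t′
      grows  : ∀ c → Present t r c → Present t′ r c × weight t′ r c ≤ℚ weight t r c

  open Refines

  Refines-refl : ∀ {r t} → Refines r t t
  Refines-refl = record
    { others = λ _ _ → record
      { flag≡ = λ _ → refl ; weight≡ = λ _ → refl ; left≡ = λ _ → refl ; right≡ = λ _ → refl }
    ; grows  = λ _ p → p , ℚ.≤-refl
    }

  SameRow-trans : ∀ {r t t′ t″} → SameRow r t t′ → SameRow r t′ t″ → SameRow r t t″
  SameRow-trans p q = record
    { flag≡   = λ c → trans (flag≡ q c) (flag≡ p c)
    ; weight≡ = λ c → trans (weight≡ q c) (weight≡ p c)
    ; left≡   = λ c → trans (left≡ q c) (left≡ p c)
    ; right≡  = λ c → trans (right≡ q c) (right≡ p c)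
    }

  SameRow-sym : ∀ {r t t′} → SameRow r t t′ → SameRow r t′ t
  SameRow-sym p = record
    { flag≡   = λ c → sym (flag≡ p c)
    ; weight≡ = λ c → sym (weight≡ p c)
    ; left≡   = λ c → sym (left≡ p c)
    ; right≡  = λ c → sym (right≡ p c)
    }

  Refines-trans : ∀ {r t t′ t″} → Refines r t t′ → Refines r t′ t″ → Refines r t t″
  Refines-trans p q = record
    { others = λ r′ r′≢r → SameRow-trans (others p r′ r′≢r) (others q r′ r′≢r)
    ; grows  = λ c present → let present′ , w≤ = grows p c present
                                 present″ , w≤′ = grows q c present′
                             in present″ , ℚ.≤-trans w≤′ w≤
    }

  Link-SameRow : ∀ {t t′ r a b c} → SameRow (2 * r) t t′ → SameRow (suc (2 * r)) t t′ →
    Link t r a b c → Link t′ r a b c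
  Link-SameRow {a = a} {b} p q (presentˡ , presentʳ , rest) =
    subst (1 ≤_) (sym (flag≡ p a)) presentˡ ,
    subst (1 ≤_) (sym (flag≡ q b)) presentʳ , rest

  joined-SameRow : ∀ {t t′ r a b} → SameRow (2 * r) t t′ → SameRow (suc (2 * r)) t t′ →
    joined t′ r a b ≡ joined t r a b
  joined-SameRow {a = a} {b} p q = cong₂ _+ℚ_ (weight≡ p a) (weight≡ q b)

  Sound-SameRow : ∀ {t t′ r} → SameRow r t t′ →
    SameRow (2 * r) t t′ → SameRow (suc (2 * r)) t t′ → Sound t r → Sound t′ r
  Sound-SameRow {t} {t′} {r} o p q sound c present
    with link , w≡ ← sound c (subst (1 ≤_) (flag≡ o c) present)
    rewrite left≡ o c | right≡ o c =
    Link-SameRow {t} {t′} {r} p q link ,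
    trans (weight≡ o c) (trans w≡ (sym (joined-SameRow {t} {t′} {r} p q)))

  Complete-SameRow : ∀ {t t′ r a b c} → SameRow r t t′ →
    SameRow (2 * r) t t′ → SameRow (suc (2 * r)) t t′ → Complete t r a b c → Complete t′ r a b c
  Complete-SameRow {t} {t′} {r} {c = c} o p q complete link
    with complete (Link-SameRow {t′} {t} {r} (SameRow-sym p) (SameRow-sym q) link)
  ... | present , w≤ =
    subst (1 ≤_) (sym (flag≡ o c)) present ,
    subst₂ _≤ℚ_ (sym (weight≡ o c)) (sym (joined-SameRow {t} {t′} {r} p q)) w≤

  r<2r : ∀ {r} → 1 ≤ r → r < 2 * r
  r<2r {r} 1≤r = ℕ.≤-trans (ℕ.+-monoˡ-≤ r 1≤r) (ℕ.+-monoʳ-≤ r (ℕ.m≤m+n r 0))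

  2r≢r : ∀ {r} → 1 ≤ r → 2 * r ≢ r
  2r≢r {r} 1≤r eq = ℕ.<-irrefl (sym eq) (r<2r {r} 1≤r)

  1+2r≢r : ∀ {r} → 1 ≤ r → suc (2 * r) ≢ r
  1+2r≢r {r} 1≤r eq = ℕ.<-irrefl (sym eq) (ℕ.m<n⇒m<1+n (r<2r {r} 1≤r))

  Complete-Refines : ∀ {t t′ r a b c} → 1 ≤ r → Refines r t t′ →
    Complete t r a b c → Complete t′ r a b c
  Complete-Refines {t} {t′} {r} {c = c} 1≤r R complete link
    with p ← others R (2 * r) (2r≢r {r} 1≤r) | q ← others R (suc (2 * r)) (1+2r≢r {r} 1≤r)
    with present , w≤ ← complete (Link-SameRow {t′} {t} {r} (SameRow-sym p) (SameRow-sym q) link)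
    with present′ , w≤′ ← grows R c present =
    present′ ,
    ℚ.≤-trans w≤′ (ℚ.≤-trans w≤ (ℚ.≤-reflexive (sym (joined-SameRow {t} {t′} {r} p q))))

  ∧-≢ : ∀ {r r′} x → r′ ≢ r → ((r ≡ᵇ r′) ∧ x) ≡ false
  ∧-≢ {r} {r′} x r′≢r rewrite ≢⇒≡ᵇ-false r r′ (r′≢r ∘ sym) = refl

  module _ {t : Tables} {r a b c : ℕ} (1≤r : 1 ≤ r) where

    updated : Tables
    updated = putEntry t r c (joined t r a b) a b

    put-others : ∀ r′ → r′ ≢ r → SameRow r′ t updated
    put-others r′ r′≢r = record
      { flag≡   = λ c′ → if-other (∧-≢ (c ≡ᵇ c′) r′≢r)
      ; weight≡ = λ c′ → if-other (∧-≢ (c ≡ᵇ c′) r′≢r)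
      ; left≡   = λ c′ → if-other (∧-≢ (c ≡ᵇ c′) r′≢r)
      ; right≡  = λ c′ → if-other (∧-≢ (c ≡ᵇ c′) r′≢r)
      }

    put-Refines : (Present t r c → joined t r a b ≤ℚ weight t r c) → Refines r t updated
    put-Refines better = record { others = put-others ; grows = grow }
      where
      grow : ∀ c′ → Present t r c′ → Present updated r c′ × weight updated r c′ ≤ℚ weight t r c′
      grow c′ present with (r ≡ᵇ r) ∧ (c ≡ᵇ c′) in eq
      ... | false = present , ℚ.≤-refl
      ... | true with refl ← ℕ.≡ᵇ⇒≡ c c′ (T-∧ʳ {r ≡ᵇ r} (subst T (sym eq) tt)) =
        s≤s z≤n , better present

    put-present : Present updated r c × weight updated r c ≡ joined t r a b
    put-present rewrite ≡ᵇ-refl r | ≡ᵇ-refl c = s≤s z≤n , refl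

    put-Sound : Sound t r → Link t r a b c → Sound updated r
    put-Sound sound link c′ present with (r ≡ᵇ r) ∧ (c ≡ᵇ c′) in eq
    ... | true with refl ← ℕ.≡ᵇ⇒≡ c c′ (T-∧ʳ {r ≡ᵇ r} (subst T (sym eq) tt)) =
      Link-SameRow {t} {updated} {r} sameˡ sameʳ link , sym (joined-SameRow {t} {updated} {r} sameˡ sameʳ)
      where
      sameˡ = put-others (2 * r) (2r≢r {r} 1≤r)
      sameʳ = put-others (suc (2 * r)) (1+2r≢r {r} 1≤r)
    ... | false with link′ , w≡ ← sound c′ present =
      Link-SameRow {t} {updated} {r} sameˡ sameʳ link′ , trans w≡ (sym (joined-SameRow {t} {updated} {r} sameˡ sameʳ))
      where
      sameˡ = put-others (2 * r) (2r≢r {r} 1≤r)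
      sameʳ = put-others (suc (2 * r)) (1+2r≢r {r} 1≤r)

    put-Complete : Complete updated r a b c
    put-Complete _ = proj₁ put-present , ℚ.≤-reflexive (trans (proj₂ put-present)
      (sym (joined-SameRow {t} {updated} {r} (put-others (2 * r) (2r≢r {r} 1≤r))
        (put-others (suc (2 * r)) (1+2r≢r {r} 1≤r)))))

  module _ {s r a b c} (E : Env s) (r≡ : nats s 18 0 0 ≡ r) (a≡ : nats s 19 0 0 ≡ a)
    (b≡ : nats s 20 0 0 ≡ b) (c≡ : nats s 21 0 0 ≡ c) where

    Holds-admissible : Holds admissibleTest s → Admissible r c
    Holds-admissible p M≤r r<2M
      with lo≤ , ≤hi ← Holds-stable boundsTest s (λ q → p
        ( ( subst₂ _≤_ (sym (count≡ E)) (sym r≡) M≤r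
          , λ 2M≤r → ℕ.<⇒≱ r<2M (subst₂ _≤_ (cong₂ _+_ (count≡ E) (count≡ E)) r≡ 2M≤r) )
        , q ))
      rewrite r≡ | c≡ | count≡ E | grid≡ E c | lo≡ E (r ∸ M) | hi≡ E (r ∸ M) = lo≤ , ≤hi

    admissible-Holds : Admissible r c → Holds admissibleTest s
    admissible-Holds adm ((M≤r , r<2M) , q) = q (bounds (adm
      (subst₂ _≤_ (count≡ E) r≡ M≤r)
      (ℕ.≰⇒> λ 2M≤r → r<2M (subst₂ _≤_ (sym (cong₂ _+_ (count≡ E) (count≡ E))) (sym r≡) 2M≤r))))
      where
      bounds : lo (r ∸ M) ≤ℚ ε₁ *ℚ G c × G c ≤ℚ hi (r ∸ M) → Holds boundsTest s
      bounds p rewrite r≡ | c≡ | count≡ E | grid≡ E c | lo≡ E (r ∸ M) | hi≡ E (r ∸ M) = p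

    Holds-link : Holds linkTest s → Link (tableOf s) r a b c
    Holds-link (presentˡ , presentʳ , rounds , adm) =
      present , present′ , rounds′ rounds , Holds-admissible adm
      where
      present : Present (tableOf s) (2 * r) a
      present = subst₂ (λ r a → Present (tableOf s) (2 * r) a) r≡ a≡ presentˡ
      present′ : Present (tableOf s) (suc (2 * r)) b
      present′ = subst₂ (λ r b → Present (tableOf s) (suc (2 * r)) b) r≡ b≡ presentʳ
      rounds′ : Holds (roundsTest (op add (gridAt â) (gridAt b̂)) ĉ) s → Rounds (G a +ℚ G b) c
      rounds′ p rewrite a≡ | b≡ | c≡ | grid≡ E a | grid≡ E b | grid≡ E c | factor≡ E = p

    link-Holds : Link (tableOf s) r a b c → Holds linkTest s
    link-Holds (presentˡ , presentʳ , rounds , adm) =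
      subst₂ (λ r a → Present (tableOf s) (2 * r) a) (sym r≡) (sym a≡) presentˡ ,
      subst₂ (λ r b → Present (tableOf s) (suc (2 * r)) b) (sym r≡) (sym b≡) presentʳ ,
      rounds′ , admissible-Holds adm
      where
      rounds′ : Holds (roundsTest (op add (gridAt â) (gridAt b̂)) ĉ) s
      rounds′ rewrite a≡ | b≡ | c≡ | grid≡ E a | grid≡ E b | grid≡ E c | factor≡ E = rounds

  MergeStep : ℕ → (Tables → Set) → State → State → Set
  MergeStep r Done = Progress (Refines r) (λ t → Sound t r) Done

  run-mergeEntry : ∀ {s r a b c} → Env s → 1 ≤ r → nats s 18 0 0 ≡ r → nats s 19 0 0 ≡ a →
    nats s 20 0 0 ≡ b → nats s 21 0 0 ≡ c → Sound (tableOf s) r →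
    Run mergeEntry s (straightCost mergeEntry) (MergeStep r (λ t → Complete t r a b c) s)
  run-mergeEntry {s} {r} {a} {b} {c} E 1≤r refl refl refl refl sound = run-if
    (λ true≡ → let link , improves = test-true mergeTest s true≡
                   link′ = Holds-link E refl refl refl refl link
                   better = λ present → ℚ.<⇒≤ (ℚ.≰⇒> λ w≤ → improves (present , w≤)) in
      assign-then $ assign-then $ assign-then $ run-assign
        ( put-Refines {t} {r} {a} {b} {c} 1≤r better
        , put-Sound {t} {r} {a} {b} {c} 1≤r sound link′
        , put-Complete {t} {r} {a} {b} {c} 1≤r ))
    (λ false≡ → run-skip (Refines-refl , sound , λ link →
      Holds-stable noChange s λ q →
        test-false mergeTest s false≡ (link-Holds E refl refl refl refl link , q)))
    where
    t = tableOf s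
    noChange = and (leq (lit {nat} 1) (cell #flag r̂ ĉ)) (leq (cell #weight r̂ ĉ) joinedWeight)

module _ (𝒮 : Scheme) where
  open Scheme 𝒮
  open TreeTables 𝒮
  open Merge ε₁
  open Env
  open Refines

  rows≡ : ∀ {s s′ t} {17≤t : T (17 ℕ.≤ᵇ t)} → Env 𝒮 s → Agree t s s′ → eval rows s′ ≡ suc K
  rows≡ {_} {_} {t} {17≤t} E A = cong suc (top≡ (Env-Agree 𝒮 {t} {_} {_} {17≤t} A E))

  rowSize : ℕ → ℕ
  rowSize zero    = 1
  rowSize (suc n) = rowSize n * suc (suc K)

  rowSize-pos : ∀ n → 1 ≤ rowSize n
  rowSize-pos zero    = s≤s z≤n
  rowSize-pos (suc n) = ℕ.*-mono-≤ (rowSize-pos n) (s≤s z≤n)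

  entryCost columnCost sliceCost mergeRowCost : ℕ
  entryCost    = straightCost mergeEntry
  columnCost   = forCost rows + entryCost
  sliceCost    = forCost rows + columnCost
  mergeRowCost = forCost rows + sliceCost

  module _ {r : ℕ} where

    run-for-merge : ∀ {x P s₀} (c Z : ℕ) (Done : ℕ → Tables → Set) →
      rank nat x ≡ x → T (17 ℕ.≤ᵇ x) → T (above (suc x) P) →
      (∀ s v → tableOf (write nat s x 0 0 v) ≡ tableOf s) →
      (∀ {k t t′} → Refines 𝒮 r t t′ → Done k t → Done k t′) →
      1 ≤ Z → Env 𝒮 s₀ → Sound (tableOf s₀) r →
      (∀ {k s} → k < suc K → Agree x s₀ s → nats s x 0 0 ≡ k → Sound (tableOf s) r →
        Run P s (c * Z) (MergeStep 𝒮 r (Done k) s)) →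
      Run (for x rows P) s₀ ((forCost rows + c) * (Z * suc (suc K)))
        (MergeStep 𝒮 r (λ t → ∀ k → k < suc K → Done k t) s₀)
    run-for-merge c Z Done rank-x 17≤x above-P same mono 1≤Z E sound body =
      run-for-each c Z (Refines 𝒮 r) (λ t → Sound t r) Done (Refines-refl 𝒮) (Refines-trans 𝒮) mono rank-x above-P same
        (rows≡ {17≤t = 17≤x} E) 1≤Z sound body

    run-mergeColumn : ∀ {a b s} → Env 𝒮 s → 1 ≤ r → nats s 18 0 0 ≡ r →
      nats s 19 0 0 ≡ a → nats s 20 0 0 ≡ b → Sound (tableOf s) r →
      Run (for 21 rows mergeEntry) s (columnCost * rowSize 1)
        (MergeStep 𝒮 r (λ t → ∀ c → c < suc K → Complete t r a b c) s)
    run-mergeColumn {a} {b} E 1≤r r≡ a≡ b≡ sound =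
      run-for-merge entryCost (rowSize 0) (λ c t → Complete t r a b c)
        refl _ _ (λ _ _ → refl)
        (λ {_} {t} {t′} R → Complete-Refines 𝒮 {t} {t′} 1≤r R)
        (rowSize-pos 0) E sound λ _ A c≡ sound′ →
          run-*1
            (run-mergeEntry 𝒮 (Env-Agree 𝒮 A E) 1≤r
              (trans (at A nat 18 0 0) r≡) (trans (at A nat 19 0 0) a≡)
              (trans (at A nat 20 0 0) b≡) c≡ sound′)

    run-mergeSlice : ∀ {a s} → Env 𝒮 s → 1 ≤ r → nats s 18 0 0 ≡ r →
      nats s 19 0 0 ≡ a → Sound (tableOf s) r →
      Run (for 20 rows (for 21 rows mergeEntry)) s (sliceCost * rowSize 2)
        (MergeStep 𝒮 r (λ t → ∀ b → b < suc K → ∀ c → c < suc K → Complete t r a b c) s)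
    run-mergeSlice {a} E 1≤r r≡ a≡ sound =
      run-for-merge columnCost (rowSize 1) (λ b t → ∀ c → c < suc K → Complete t r a b c)
        refl _ _ (λ _ _ → refl)
        (λ {_} {t} {t′} R q c c<K → Complete-Refines 𝒮 {t} {t′} 1≤r R (q c c<K))
        (rowSize-pos 1) E sound λ _ A b≡ sound′ →
          run-mergeColumn (Env-Agree 𝒮 A E) 1≤r
            (trans (at A nat 18 0 0) r≡) (trans (at A nat 19 0 0) a≡) b≡ sound′

    RowComplete : Tables → Set
    RowComplete t = ∀ a → a < suc K → ∀ b → b < suc K → ∀ c → c < suc K → Complete t r a b c

    run-mergeRow : ∀ {s} → Env 𝒮 s → 1 ≤ r → nats s 18 0 0 ≡ r → Sound (tableOf s) r →
      Run mergeRow s (mergeRowCost * rowSize 3) (MergeStep 𝒮 r RowComplete s)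
    run-mergeRow E 1≤r r≡ sound =
      run-for-merge sliceCost (rowSize 2)
        (λ a t → ∀ b → b < suc K → ∀ c → c < suc K → Complete t r a b c)
        refl _ _ (λ _ _ → refl)
        (λ {_} {t} {t′} R q b b<K c c<K → Complete-Refines 𝒮 {t} {t′} 1≤r R (q b b<K c c<K))
        (rowSize-pos 2) E sound λ _ A a≡ sound′ →
          run-mergeSlice (Env-Agree 𝒮 A E) 1≤r
            (trans (at A nat 18 0 0) r≡) a≡ sound′

  open SameRow

  record MergedAbove (k : ℕ) (t : Tables) : Set where
    field
      leaf-sound    : ∀ r → P ≤ r → r < P + P → LeafSound t r
      leaf-complete : ∀ r → P ≤ r → r < P + P → LeafComplete t r
      merged        : ∀ r → P ∸ k ≤ r → r < P → Sound t r × RowComplete {r} t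
      absent        : ∀ r → r < P ∸ k → ∀ c → ¬ Present t r c

  open MergedAbove

  LeafSound-SameRow : ∀ {t t′ r} → SameRow 𝒮 r t t′ → LeafSound t r → LeafSound t′ r
  LeafSound-SameRow o leaf c present
    with leaf c (subst (1 ≤_) (flag≡ o c) present)
  ... | inj₁ (c≡0 , w≡) = inj₁ (c≡0 , trans (weight≡ o c) w≡)
  ... | inj₂ (1≤c , v≈ , w≡) = inj₂ (1≤c , v≈ , trans (weight≡ o c) w≡)

  LeafComplete-SameRow : ∀ {t t′ r} → SameRow 𝒮 r t t′ → LeafComplete t r → LeafComplete t′ r
  LeafComplete-SameRow o (p₀ , p) =
    subst (1 ≤_) (sym (flag≡ o 0)) p₀ ,
    λ c c<K q → subst (1 ≤_) (sym (flag≡ o (suc c))) (p c c<K q)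

  merge-step : ∀ {k t t′} → let r = P ∸ suc k in k < P ∸ 1 →
    Refines 𝒮 r t t′ → Sound t′ r → RowComplete {r} t′ → MergedAbove k t → MergedAbove (suc k) t′
  merge-step {k} {t} {t′} k<P-1 R sound complete m = record
    { leaf-sound    = λ q P≤q q<2P → LeafSound-SameRow (same q (below P≤q)) (leaf-sound m q P≤q q<2P)
    ; leaf-complete = λ q P≤q q<2P → LeafComplete-SameRow (same q (below P≤q)) (leaf-complete m q P≤q q<2P)
    ; merged        = merged′
    ; absent        = λ q q<r c present →
        absent m q (ℕ.<-≤-trans q<r (ℕ.∸-monoʳ-≤ P (ℕ.n≤1+n k))) c
          (subst (1 ≤_) (flag≡ (same q (λ { refl → ℕ.<-irrefl refl q<r })) c) present)
    }
    where
    r = P ∸ suc k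
    P-k≡1+r : P ∸ k ≡ suc r
    P-k≡1+r = sym (trans (sym (ℕ.+-∸-assoc 1 (ℕ.≤-trans k<P-1 (ℕ.m∸n≤m P 1)))) refl)
    1≤r : 1 ≤ r
    1≤r = ℕ.m<n⇒0<n∸m (ℕ.≤-trans (ℕ.+-monoʳ-≤ 1 k<P-1)
      (ℕ.≤-reflexive (ℕ.m+[n∸m]≡n (2^-pos (d + e)))))
    r<P : r < P
    r<P = ℕ.≤-trans (ℕ.≤-reflexive (sym P-k≡1+r)) (ℕ.m∸n≤m P k)
    below : ∀ {q} → P ≤ q → q ≢ r
    below P≤q refl = ℕ.<⇒≱ r<P P≤q
    same : ∀ q → q ≢ r → SameRow 𝒮 q t t′
    same = others R
    merged′ : ∀ q → r ≤ q → q < P → Sound t′ q × RowComplete {q} t′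
    merged′ q r≤q q<P with ℕ.m≤n⇒m<n∨m≡n r≤q
    ... | inj₂ refl = sound , complete
    ... | inj₁ r<q with sound′ , complete′ ← merged m q (ℕ.≤-trans (ℕ.≤-reflexive P-k≡1+r) r<q) q<P =
      Sound-SameRow 𝒮 o p p′ sound′ ,
      λ a a<K b b<K c c<K → Complete-SameRow 𝒮 {t} {t′} {q} {a} {b} {c} o p p′ (complete′ a a<K b b<K c c<K)
      where
      r<2q : r < 2 * q
      r<2q = ℕ.<-≤-trans r<q (ℕ.m≤m+n q (q + 0))
      o  = same q (λ { refl → ℕ.<-irrefl refl r<q })
      p  = same (2 * q) (λ eq → ℕ.<-irrefl (sym eq) r<2q)
      p′ = same (suc (2 * q)) (λ eq → ℕ.<-irrefl (sym eq) (ℕ.m<n⇒m<1+n r<2q))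

  mergeCost mergeSize : ℕ
  mergeCost = forCost (op sub leafCount (lit 1)) + (straightCost setNode + mergeRowCost)
  mergeSize = rowSize 3 * suc (P ∸ 1)

  run-mergeTables : ∀ {s} → Env 𝒮 s → MergedAbove 0 (tableOf s) →
    Run mergeTables s (mergeCost * mergeSize) (λ s′ → Filled (tableOf s′))
  run-mergeTables {s₀} E leaves = run-map filled $
    run-for (straightCost setNode + mergeRowCost) {rowSize 3} (λ k s → MergedAbove k (tableOf s))
      refl _
      (λ A → cong (_∸ 1) (leafCount≡ (Env-Agree 𝒮 A E)))
      (λ m → m)
      (rowSize-pos  3)
      (λ {k} {s} k<n A k≡ m →
        assign-then* mergeRowCost (rowSize 3) (rowSize-pos 3) $
        run-map (λ (R , sound , complete) → merge-step k<n R sound complete m) $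
        run-mergeRow {P ∸ suc k}
          (Env-Agree 𝒮 (Agree-trans A (write-Agree nat s 18 0 0 _ (ℕ.≤ᵇ⇒≤ 17 18 _))) E)
          (ℕ.m<n⇒0<n∸m (ℕ.≤-trans (ℕ.+-monoʳ-≤ 1 k<n)
            (ℕ.≤-reflexive (ℕ.m+[n∸m]≡n (2^-pos (d + e))))))
          (cong₂ (λ p i → p ∸ suc i) (leafCount≡ (Env-Agree 𝒮 A E)) k≡)
          (λ c present → contradiction present (absent m (P ∸ suc k)
            (ℕ.∸-monoʳ-< (ℕ.n<1+n k) (ℕ.≤-trans k<n (ℕ.m∸n≤m P 1))) c)))
      leaves
    where
    filled : ∀ {t} → MergedAbove (P ∸ 1) t → Filled t
    filled m = record
      { leafSound    = leaf-sound m
      ; leafComplete = leaf-complete m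
      ; sound        = λ r 1≤r r<P → proj₁ (merged m r (above-root 1≤r) r<P)
      ; complete     = λ r 1≤r r<P a b c a≤K b≤K c≤K →
          proj₂ (merged m r (above-root 1≤r) r<P) a (s≤s a≤K) b (s≤s b≤K) c (s≤s c≤K)
      }
      where
      above-root : ∀ {r} → 1 ≤ r → P ∸ (P ∸ 1) ≤ r
      above-root 1≤r = ℕ.≤-trans (ℕ.≤-reflexive (ℕ.m∸[m∸n]≡n (2^-pos (d + e)))) 1≤r

-- Filling the leaves

module Leaves where
  î ĵ ĉ⁺ leafNode : Expr nat
  î        = var 17
  ĵ        = var 18
  ĉ⁺       = op add (lit 1) (var 21)
  leafNode = op add (op mul (var #width) (op add (var #count) î)) ĵ

  itemValue : Expr rat
  itemValue = cell 1 î ĵ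

  fillEntry fillZero fillLeaf fillLeaves : Program
  fillEntry = ifElse (roundsTest itemValue ĉ⁺)
    ( assign {nat} #flag leafNode ĉ⁺ (lit 1) ⨾
      assign {rat} #weight leafNode ĉ⁺ (cell 0 î ĵ) )
    skip
  fillZero = assign {nat} #flag leafNode (lit 0) (lit 1)
  fillLeaf = for 21 (var #top) fillEntry ⨾ fillZero
  fillLeaves = for 17 (var #count) (for 18 (var #width) fillLeaf)

module _ (𝒮 : Scheme) where
  open Scheme 𝒮
  open TreeTables 𝒮
  open Leaves
  open Env

  record LeafEntries (t : Tables) : Set where
    field
      is-leaf     : ∀ r c → Present t r c → P ≤ r
      entry-sound : ∀ r c → Present t r (suc c) →
                    Rounds (val r) (suc c) × weight t r (suc c) ≡ wt r
      zero-weight : ∀ r → weight t r 0 ≡ 0ℚ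

  open LeafEntries

  record Grows (t t′ : Tables) : Set where
    constructor growing
    field
      grown : ∀ r c → Present t r c → Present t′ r c

  open Grows

  putLeaf : Tables → (r c : ℕ) → ℚ → Tables
  putLeaf t r c w = record t
    { flag   = λ r′ c′ → if (r ≡ᵇ r′) ∧ (c ≡ᵇ c′) then 1 else flag t r′ c′
    ; weight = λ r′ c′ → if (r ≡ᵇ r′) ∧ (c ≡ᵇ c′) then w else weight t r′ c′
    }

  putZero : Tables → ℕ → Tables
  putZero t r = record t
    { flag = λ r′ c′ → if (r ≡ᵇ r′) ∧ (0 ≡ᵇ c′) then 1 else flag t r′ c′ }

  put-grows : ∀ b {n} → 1 ≤ n → 1 ≤ (if b then 1 else n)
  put-grows true  _   = s≤s z≤n
  put-grows false 1≤n = 1≤n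

  putLeaf-present : ∀ {t} r c {w} → Present (putLeaf t r c w) r c
  putLeaf-present r c rewrite ≡ᵇ-refl r | ≡ᵇ-refl c = s≤s z≤n

  both-≡ : ∀ r r′ c c′ → ((r ≡ᵇ r′) ∧ (c ≡ᵇ c′)) ≡ true → r ≡ r′ × c ≡ c′
  both-≡ r r′ c c′ eq = ℕ.≡ᵇ⇒≡ r r′ (T-∧ˡ (subst T (sym eq) tt)) ,
    ℕ.≡ᵇ⇒≡ c c′ (T-∧ʳ {r ≡ᵇ r′} (subst T (sym eq) tt))

  ∧-false : ∀ b → b ∧ false ≡ false
  ∧-false true  = refl
  ∧-false false = refl

  putLeaf-LeafEntries : ∀ {t r c} → P ≤ r → Rounds (val r) (suc c) →
    LeafEntries t → LeafEntries (putLeaf t r (suc c) (wt r))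
  putLeaf-LeafEntries {t} {r} {c} P≤r rounds L = record
    { is-leaf = leaf ; entry-sound = sound ; zero-weight = zeroWeight }
    where
    t′ = putLeaf t r (suc c) (wt r)
    leaf : ∀ r′ c′ → Present t′ r′ c′ → P ≤ r′
    leaf r′ c′ p with (r ≡ᵇ r′) ∧ (suc c ≡ᵇ c′) in eq
    ... | true with refl , refl ← both-≡ r r′ (suc c) c′ eq = P≤r
    ... | false = is-leaf L r′ c′ p
    sound : ∀ r′ c′ → Present t′ r′ (suc c′) →
      Rounds (val r′) (suc c′) × weight t′ r′ (suc c′) ≡ wt r′
    sound r′ c′ p with (r ≡ᵇ r′) ∧ (c ≡ᵇ c′) in eq
    ... | true with refl , refl ← both-≡ r r′ c c′ eq = rounds , refl
    ... | false = entry-sound L r′ c′ p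
    zeroWeight : ∀ r′ → weight t′ r′ 0 ≡ 0ℚ
    zeroWeight r′ rewrite ∧-false (r ≡ᵇ r′) = zero-weight L r′

  putZero-LeafEntries : ∀ {t r} → P ≤ r → LeafEntries t → LeafEntries (putZero t r)
  putZero-LeafEntries {t} {r} P≤r L = record
    { is-leaf = leaf ; entry-sound = sound ; zero-weight = zero-weight L }
    where
    leaf : ∀ r′ c′ → Present (putZero t r) r′ c′ → P ≤ r′
    leaf r′ c′ p with (r ≡ᵇ r′) ∧ (0 ≡ᵇ c′) in eq
    ... | true with refl , _ ← both-≡ r r′ 0 c′ eq = P≤r
    ... | false = is-leaf L r′ c′ p
    sound : ∀ r′ c′ → Present (putZero t r) r′ (suc c′) →
      Rounds (val r′) (suc c′) × weight t r′ (suc c′) ≡ wt r′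
    sound r′ c′ p rewrite ∧-false (r ≡ᵇ r′) = entry-sound L r′ c′ p

  leaf : ℕ → ℕ → ℕ
  leaf i j = 2 ℕ.^ d * (M + i) + j

  P≡ : P ≡ 2 ℕ.^ d * M
  P≡ = ℕ.^-distribˡ-+-* 2 d e

  P≤leaf : ∀ i j → P ≤ leaf i j
  P≤leaf i j = ℕ.≤-trans (ℕ.≤-reflexive P≡)
    (ℕ.≤-trans (ℕ.*-monoʳ-≤ (2 ℕ.^ d) (ℕ.m≤m+n M i)) (ℕ.m≤m+n _ j))

  leaf-surjective : ∀ r → P ≤ r → r < P + P →
    ∃[ i ] ∃[ j ] (i < M × j < 2 ℕ.^ d × leaf i j ≡ r)
  leaf-surjective r P≤r r<2P =
    r / n ∸ M , r % n , q∸M<M , ℕ.m%n<n r n , (begin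
      n * (M + (r / n ∸ M)) + r % n   ≡⟨ cong (λ q → n * q + r % n) (ℕ.m+[n∸m]≡n M≤q) ⟩
      n * (r / n) + r % n             ≡⟨ cong (_+ r % n) (ℕ.*-comm n (r / n)) ⟩
      r / n * n + r % n               ≡⟨ ℕ.+-comm (r / n * n) (r % n) ⟩
      r % n + r / n * n               ≡⟨ ℕ.m≡m%n+[m/n]*n r n ⟨
      r                               ∎)
    where
    open ≡-Reasoning
    n = 2 ℕ.^ d
    instance
      n≢0 : NonZero n
      n≢0 = ℕ.m^n≢0 2 d
    M≤q : M ≤ r / n
    M≤q = ℕ.≤-trans (ℕ.≤-reflexive (sym (trans (cong (_/ n) (trans P≡ (ℕ.*-comm n M))) (ℕ.m*n/n≡m M n))))
      (ℕ./-monoˡ-≤ n P≤r)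
    q<2M : r / n < M + M
    q<2M = ℕ.m<n*o⇒m/o<n (ℕ.<-≤-trans r<2P (ℕ.≤-reflexive
      (trans (cong₂ _+_ P≡ P≡) (trans (sym (ℕ.*-distribˡ-+ n M M)) (ℕ.*-comm n (M + M))))))
    q∸M<M : r / n ∸ M < M
    q∸M<M = ℕ.+-cancelˡ-< M _ _ (ℕ.≤-<-trans (ℕ.≤-reflexive (ℕ.m+[n∸m]≡n M≤q)) q<2M)

  Fill : (Tables → Set) → State → State → Set
  Fill = Progress Grows LeafEntries

  Grows-refl : ∀ {t} → Grows t t
  Grows-refl = growing λ _ _ p → p

  Grows-trans : ∀ {t t′ t″} → Grows t t′ → Grows t′ t″ → Grows t t″
  Grows-trans p q = growing λ r c → grown q r c ∘ grown p r c

  fillLeafCost fillRowCost leavesCost : ℕ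
  fillLeafCost = forCost (var #top) + straightCost fillEntry + straightCost fillZero
  fillRowCost  = forCost (var #width) + fillLeafCost
  leavesCost   = forCost (var #count) + fillRowCost

  module _ {i j : ℕ} (i<M : i < M) (j<n : j < 2 ℕ.^ d) where

    leafNode≡ : ∀ {s} → Env 𝒮 s → nats s 17 0 0 ≡ i → nats s 18 0 0 ≡ j →
      eval leafNode s ≡ leaf i j
    leafNode≡ E refl refl = cong₂ (λ n m → n * (m + i) + j) (width≡ E) (count≡ E)

    run-fillEntry : ∀ {s c} → Env 𝒮 s → nats s 17 0 0 ≡ i → nats s 18 0 0 ≡ j →
      nats s 21 0 0 ≡ c → LeafEntries (tableOf s) →
      Run fillEntry s (straightCost fillEntry)
        (Fill (λ t → Rounds (val (leaf i j)) (suc c) → Present t (leaf i j) (suc c)) s)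
    run-fillEntry {s} {c} E i≡ j≡ c≡ L = run-if
      (λ true≡ → assign-then $ run-assign $
        subst Goal (sym put≡)
          ( growing (λ r′ c′ → put-grows ((leaf i j ≡ᵇ r′) ∧ (suc c ≡ᵇ c′)))
          , putLeaf-LeafEntries (P≤leaf i j) (to (test-true (roundsTest itemValue ĉ⁺) s true≡)) L
          , λ _ → putLeaf-present {tableOf s} (leaf i j) (suc c) {wt (leaf i j)} ))
      (λ false≡ → run-skip
        (Grows-refl , L , λ rounds →
          ⊥-elim (test-false (roundsTest itemValue ĉ⁺) s false≡ (from rounds))))
      where
      Goal : Tables → Set
      Goal t = Grows (tableOf s) t × LeafEntries t ×
        (Rounds (val (leaf i j)) (suc c) → Present t (leaf i j) (suc c))
      value≡ : eval itemValue s ≡ val (leaf i j)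
      value≡ = trans (cong₂ (rats s 1) i≡ j≡) (val≡ E i<M j<n)
      put≡ : putLeaf (tableOf s) (eval leafNode s) (eval ĉ⁺ s) (eval (cell 0 î ĵ) s)
        ≡ putLeaf (tableOf s) (leaf i j) (suc c) (wt (leaf i j))
      put≡ rewrite leafNode≡ E i≡ j≡ | c≡ | i≡ | j≡ | wt≡ E i<M j<n = refl
      to : Holds (roundsTest itemValue ĉ⁺) s → Rounds (val (leaf i j)) (suc c)
      to p rewrite i≡ | j≡ | val≡ E i<M j<n | c≡ | grid≡ E (suc c) | factor≡ E = p
      from : Rounds (val (leaf i j)) (suc c) → Holds (roundsTest itemValue ĉ⁺) s
      from p rewrite i≡ | j≡ | val≡ E i<M j<n | c≡ | grid≡ E (suc c) | factor≡ E = p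

    LeafDone : Tables → Set
    LeafDone t = Present t (leaf i j) 0 ×
      (∀ c → c < K → Rounds (val (leaf i j)) (suc c) → Present t (leaf i j) (suc c))

    run-fillLeaf : ∀ {s} → Env 𝒮 s → nats s 17 0 0 ≡ i → nats s 18 0 0 ≡ j →
      LeafEntries (tableOf s) →
      Run fillLeaf s (fillLeafCost * (1 * suc K)) (Fill LeafDone s)
    run-fillLeaf {s₀} E i≡ j≡ L =
      run-≤ (scaled-+ʳ (forCost (var #top) + straightCost fillEntry) (straightCost fillZero) (1 * suc K) (s≤s z≤n)) $
      framed 20 (run-for-each (straightCost fillEntry) 1 Grows LeafEntries
        (λ c t → Rounds (val (leaf i j)) (suc c) → Present t (leaf i j) (suc c))
        Grows-refl Grows-trans
        (λ R done rounds → grown R _ _ (done rounds))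
        refl _ (λ _ _ → refl)
        (λ A → top≡ (Env-Agree 𝒮 A E))
        (s≤s z≤n) L
        (λ _ A c≡ L′ → run-*1
          (run-fillEntry (Env-Agree 𝒮 A E)
            (trans (at A nat 17 0 0) i≡) (trans (at A nat 18 0 0) j≡) c≡ L′)))
      >>= λ {s} (A , R , L′ , done) → run-assign $
        subst (λ r → let t = putZero (tableOf s) r in
            Grows (tableOf s₀) t × LeafEntries t × LeafDone t)
          (sym (leafNode≡ (Env-Agree 𝒮 A E)
            (trans (at A nat 17 0 0) i≡) (trans (at A nat 18 0 0) j≡)))
          ( growing (λ r′ c′ p → put-grows ((leaf i j ≡ᵇ r′) ∧ (0 ≡ᵇ c′)) (grown R r′ c′ p))
          , putZero-LeafEntries (P≤leaf i j) L′
          , ( ℕ.≤-reflexive (sym (if-same (cong (_∧ true) (≡ᵇ-refl (leaf i j)))))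
            , λ c c<K rounds → put-grows ((leaf i j ≡ᵇ leaf i j) ∧ false) (done c c<K rounds) ) )

  leavesSize : ℕ
  leavesSize = 1 * suc K * suc (2 ℕ.^ d) * suc M

  run-fillLeaves : ∀ {s} → Env 𝒮 s → (∀ r c → nats s #flag r c ≡ 0) →
    (∀ r c → rats s #weight r c ≡ 0ℚ) →
    Run fillLeaves s (leavesCost * leavesSize) (λ s′ → MergedAbove 𝒮 0 (tableOf s′))
  run-fillLeaves {s₀} E no-flags no-weights = run-map (λ {s} → filled {s}) $
    run-for-each fillRowCost (1 * suc K * suc (2 ℕ.^ d)) Grows LeafEntries
      (λ i t → ∀ j → j < 2 ℕ.^ d → i < M → LeafDone′ i j t)
      Grows-refl Grows-trans
      (λ R done j j<n i<M → grow R (done j j<n i<M))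
      refl _ (λ _ _ → refl) (λ A → count≡ (Env-Agree 𝒮 A E)) (ℕ.*-mono-≤ {1} {1 * suc K} (s≤s z≤n) (s≤s z≤n))
      empty
      λ {i} i<M A i≡ L → run-map (λ (R , L′ , done) → R , L′ , λ j j<n _ → done j j<n) $
    run-for-each fillLeafCost (1 * suc K) Grows LeafEntries
      (λ j t → LeafDone′ i j t)
      Grows-refl Grows-trans grow
      refl _ (λ _ _ → refl)
      (λ A′ → width≡ (Env-Agree 𝒮 A′ (Env-Agree 𝒮 A E)))
      (s≤s z≤n) L
      λ {j} j<n A′ j≡ L′ →
    run-fillLeaf i<M j<n
      (Env-Agree 𝒮 A′ (Env-Agree 𝒮 A E))
      (trans (at A′ nat 17 0 0) i≡) j≡ L′
    where
    LeafDone′ : ℕ → ℕ → Tables → Set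
    LeafDone′ i j t = Present t (leaf i j) 0 ×
      (∀ c → c < K → Rounds (val (leaf i j)) (suc c) → Present t (leaf i j) (suc c))
    grow : ∀ {i j t t′} → Grows t t′ → LeafDone′ i j t → LeafDone′ i j t′
    grow R (p , q) = grown R _ _ p , λ c c<K rounds → grown R _ _ (q c c<K rounds)
    empty : LeafEntries (tableOf s₀)
    empty = record
      { is-leaf     = λ r c p → absent r c p
      ; entry-sound = λ r c p → absent r (suc c) p
      ; zero-weight = λ r → no-weights r 0
      }
      where
      absent : ∀ {A : Set} r c → Present (tableOf s₀) r c → A
      absent r c p = ⊥-elim (ℕ.<⇒≢ p (sym (no-flags r c)))
    filled : ∀ {s} → Fill (λ t → ∀ i → i < M → ∀ j → j < 2 ℕ.^ d → i < M → LeafDone′ i j t) s₀ s →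
      MergedAbove 𝒮 0 (tableOf s)
    filled {s} (_ , L , done) = record
      { leaf-sound = λ r _ _ c p → sound r c p
      ; leaf-complete = λ r P≤r r<2P →
          let i , j , i<M , j<n , leaf≡r = leaf-surjective r P≤r r<2P
          in subst (LeafComplete (tableOf s)) leaf≡r (done i i<M j j<n i<M)
      ; merged = λ r P≤r r<P → contradiction P≤r (ℕ.<⇒≱ r<P)
      ; absent = λ r r<P c p → ℕ.<⇒≱ r<P (is-leaf L r c p)
      }
      where
      sound : ∀ r → LeafSound (tableOf s) r
      sound r zero    p = inj₁ (refl , zero-weight L r)
      sound r (suc c) p = inj₂ (s≤s z≤n , entry-sound L r c p)

-- Choosing an entry of the root and tracing it down

#found #best #chosen : ℕ
#found  = 27
#best   = 28
#chosen = 29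

module Selection (ε₁ : ℚ) where
  ĉ n̂ î ĵ leafNode : Expr nat
  ĉ = var 26
  n̂ = op add (lit 1) (var 26)
  î = var 30
  ĵ = var 31
  leafNode = op add (op mul (var #width) (op add (var #count) î)) ĵ

  rootWeight : Expr rat
  rootWeight = cell #weight (lit 1) ĉ

  eligibleTest betterTest : Test
  eligibleTest = and (leq (lit {nat} 1) (cell #flag (lit 1) ĉ))
                     (leq (var 4) (op mul (lit ε₁) (gridAt ĉ)))
  betterTest = and eligibleTest (neg (and (leq (lit {nat} 1) (var #found)) (leq (var #best) rootWeight)))

  -- Entry 0 of a leaf leaves its item out, so the entry chosen at a leaf
  -- is itself the output.
  selectEntry selectRoot traceNode traceTables writeItem writeOutput : Program
  selectEntry = ifElse betterTest
    ( #found ≔ lit {nat} 1 ⨾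
      #best ≔ rootWeight ⨾
      assign {nat} #chosen (lit 1) (lit 0) ĉ )
    skip
  selectRoot = for 26 rows selectEntry
  traceNode =
    assign {nat} #chosen (op mul (lit 2) n̂) (lit 0) (cell #left n̂ (cell #chosen n̂ (lit 0))) ⨾
    assign {nat} #chosen (op add (lit 1) (op mul (lit 2) n̂)) (lit 0)
      (cell #right n̂ (cell #chosen n̂ (lit 0)))
  traceTables = for 26 (op sub leafCount (lit 1)) traceNode
  writeItem   = assign {nat} 2 î ĵ (cell #chosen leafNode (lit 0))
  writeOutput = for 30 (var #count) (for 31 (var #width) writeItem)

chosenAt : State → ℕ → ℕ
chosenAt s r = nats s #chosen r 0

module _ (𝒮 : Scheme) where
  open Scheme 𝒮
  open TreeTables 𝒮
  open Selection ε₁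
  open Env

  Eligible : Tables → ℚ → ℕ → Set
  Eligible t L c = Present t 1 c × L ≤ℚ ε₁ *ℚ G c

  Selected : Tables → ℚ → ℕ → Set
  Selected t L x = ∀ c → c ≤ K → Eligible t L c →
    Eligible t L x × weight t 1 x ≤ℚ weight t 1 c

  selectCost : ℕ
  selectCost = forCost rows + straightCost selectEntry

  run-selectRoot : ∀ {s L} → Env 𝒮 s → rats s 4 0 0 ≡ L → nats s #found 0 0 ≡ 0 →
    Run selectRoot s (selectCost * (1 * suc (suc K)))
      (λ s′ → Selected (tableOf s) L (chosenAt s′ 1))
  run-selectRoot {s₀} {L} E L≡ found≡0 = run-map (λ {s} → conclude {s}) $
    run-for (straightCost selectEntry) {1} I refl _
      (λ A → rows≡ 𝒮 E A) (λ i → i) (s≤s z≤n)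
      (λ k<n A k≡ i → run-*1 (entry A k≡ i))
      ((λ 1≤0 → ⊥-elim (ℕ.<⇒≢ 1≤0 (sym found≡0))) , λ _ ())
    where
    t = tableOf s₀
    Current : ℕ → ℚ → ℕ → Set
    Current found best x = 1 ≤ found → Eligible t L x × best ≡ weight t 1 x
    Bounded : ℕ → ℚ → ℕ → Set
    Bounded found best c = Eligible t L c → 1 ≤ found × best ≤ℚ weight t 1 c
    I : ℕ → State → Set
    I k s = Current (nats s #found 0 0) (rats s #best 0 0) (chosenAt s 1) ×
      (∀ c → c < k → Bounded (nats s #found 0 0) (rats s #best 0 0) c)
    conclude : ∀ {s} → I (suc K) s → Selected t L (chosenAt s 1)
    conclude (current , bounded) c c≤K eligible with bounded c (s≤s c≤K) eligible
    ... | found , best≤ with current found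
    ...   | eligible′ , best≡ = eligible′ , subst (_≤ℚ weight t 1 c) best≡ best≤
    entry : ∀ {k s} → Agree 26 s₀ s → nats s 26 0 0 ≡ k → I k s →
      Run selectEntry s (straightCost selectEntry) (I (suc k))
    entry {k} {s} A refl (current , bounded) = run-if
      (λ true≡ → let eligible , better = test-true betterTest s true≡ in
        assign-then $ assign-then $ run-assign
          ( (λ _ → to eligible , weight≡)
          , below-suc
              (λ c c<k e → s≤s z≤n , improve better (bounded c c<k e))
              (λ _ → s≤s z≤n , ℚ.≤-reflexive weight≡) ))
      (λ false≡ → run-skip
        ( current
        , below-suc bounded λ e →
            let found , best≤ = Holds-stable notBetter s
                  (λ q → test-false betterTest s false≡ (from e , q))
            in found , subst (rats s #best 0 0 ≤ℚ_) weight≡ best≤ ))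
      where
      E′ = Env-Agree 𝒮 A E
      notBetter = and (leq (lit {nat} 1) (var #found)) (leq (var #best) rootWeight)
      weight≡ : rats s #weight 1 k ≡ weight t 1 k
      weight≡ = at A rat #weight 1 k
      to : Holds eligibleTest s → Eligible t L k
      to (p , q) = subst (1 ≤_) (at A nat #flag 1 k) p ,
        subst₂ (λ x y → x ≤ℚ ε₁ *ℚ y) (trans (at A rat 4 0 0) L≡) (grid≡ E′ k) q
      from : Eligible t L k → Holds eligibleTest s
      from (p , q) = subst (1 ≤_) (sym (at A nat #flag 1 k)) p ,
        subst₂ (λ x y → x ≤ℚ ε₁ *ℚ y) (sym (trans (at A rat 4 0 0) L≡)) (sym (grid≡ E′ k)) q
      improve : ∀ {y} → ¬ (1 ≤ nats s #found 0 0 × rats s #best 0 0 ≤ℚ rats s #weight 1 k) →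
        1 ≤ nats s #found 0 0 × rats s #best 0 0 ≤ℚ y → rats s #weight 1 k ≤ℚ y
      improve better (found , best≤) =
        ℚ.≤-trans (ℚ.<⇒≤ (ℚ.≰⇒> λ best≤w → better (found , best≤w))) best≤

  TracedTo : ℕ → Tables → (ℕ → ℕ) → Set
  TracedTo k t X = ∀ r → 1 ≤ r → r < k →
    X (2 * r) ≡ left t r (X r) × X (suc (2 * r)) ≡ right t r (X r)

  set : (ℕ → ℕ) → ℕ → ℕ → ℕ → ℕ
  set X i x i′ = if (i ≡ᵇ i′) ∧ true then x else X i′

  set-same : ∀ X i x → set X i x i ≡ x
  set-same X i x rewrite ≡ᵇ-refl i = refl

  set-other : ∀ X i x {i′} → i′ ≢ i → set X i x i′ ≡ X i′
  set-other X i x {i′} i′≢i rewrite ≢⇒≡ᵇ-false i i′ (i′≢i ∘ sym) = refl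

  trace-step : ∀ {k t X} → let r = suc k
                               X₁ = set X (2 * r) (left t r (X r)) in
    TracedTo r t X → let X₂ = set X₁ (suc (2 * r)) (right t r (X₁ r)) in
    X₂ 1 ≡ X 1 × TracedTo (suc r) t X₂
  trace-step {k} {t} {X} traced =
    unchanged (ℕ.≤-<-trans (s≤s z≤n) (r<2r 𝒮 {r} (s≤s z≤n))) ,
    λ { q 1≤q q≤r → step q 1≤q (ℕ.m≤n⇒m<n∨m≡n (ℕ.≤-pred q≤r)) }
    where
    r  = suc k
    X₁ = set X (2 * r) (left t r (X r))
    X₂ = set X₁ (suc (2 * r)) (right t r (X₁ r))
    r<2*r : r < 2 * r
    r<2*r = r<2r 𝒮 {r} (s≤s z≤n)
    unchanged : ∀ {q} → q < 2 * r → X₂ q ≡ X q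
    unchanged q<2r = trans
      (set-other X₁ (suc (2 * r)) _ (ℕ.<⇒≢ (ℕ.m<n⇒m<1+n q<2r)))
      (set-other X (2 * r) _ (ℕ.<⇒≢ q<2r))
    step : ∀ q → 1 ≤ q → q < r ⊎ q ≡ r →
      X₂ (2 * q) ≡ left t q (X₂ q) × X₂ (suc (2 * q)) ≡ right t q (X₂ q)
    step q 1≤q (inj₁ q<r) with traced q 1≤q q<r
    ... | ≡ˡ , ≡ʳ =
      trans (unchanged (ℕ.*-monoʳ-< 2 q<r)) (trans ≡ˡ (cong (left t q) (sym same))) ,
      trans (unchanged (ℕ.<-≤-trans (s≤s (s≤s ℕ.≤-refl))
        (ℕ.≤-trans (ℕ.≤-reflexive (sym (ℕ.*-suc 2 q))) (ℕ.*-monoʳ-≤ 2 q<r))))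
        (trans ≡ʳ (cong (right t q) (sym same)))
      where
      same : X₂ q ≡ X q
      same = unchanged (ℕ.<-trans q<r r<2*r)
    step q 1≤q (inj₂ refl) =
      trans (set-other X₁ (suc (2 * r)) _ (ℕ.<⇒≢ ℕ.≤-refl))
        (trans (set-same X (2 * r) _) (cong (left t r) (sym (unchanged r<2*r)))) ,
      trans (set-same X₁ (suc (2 * r)) _)
        (cong (right t r) (trans (set-other X (2 * r) _ (ℕ.<⇒≢ r<2*r)) (sym (unchanged r<2*r))))

  TracedTo-cong : ∀ {k t t′ X} → (∀ r c → left t′ r c ≡ left t r c) →
    (∀ r c → right t′ r c ≡ right t r c) → TracedTo k t X → TracedTo k t′ X
  TracedTo-cong left≡ right≡ traced r 1≤r r<k with traced r 1≤r r<k
  ... | ≡ˡ , ≡ʳ = trans ≡ˡ (sym (left≡ r _)) , trans ≡ʳ (sym (right≡ r _))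

  traceCost : ℕ
  traceCost = forCost (op sub leafCount (lit 1)) + straightCost traceNode

  run-traceTables : ∀ {s} → Env 𝒮 s →
    Run traceTables s (traceCost * (1 * suc (P ∸ 1)))
      (λ s′ → chosenAt s′ 1 ≡ chosenAt s 1 × TracedTo P (tableOf s) (chosenAt s′))
  run-traceTables {s₀} E =
    run-map (λ {s} (x₁ , traced) → x₁ ,
        subst (λ k → TracedTo k (tableOf s₀) (chosenAt s)) (ℕ.m+[n∸m]≡n (2^-pos (d + e))) traced) $
    run-for (straightCost traceNode) {1} I refl _
      (λ A → cong (_∸ 1) (leafCount≡ (Env-Agree 𝒮 A E)))
      (λ i → i) (s≤s z≤n)
      (λ {k} {s} k<n A k≡ i → run-*1
        (entry A k≡ i))
      (refl , λ { r 1≤r r<1 → contradiction 1≤r (ℕ.<⇒≱ r<1) })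
    where
    I : ℕ → State → Set
    I k s = chosenAt s 1 ≡ chosenAt s₀ 1 × TracedTo (suc k) (tableOf s₀) (chosenAt s)
    entry : ∀ {k s} → Agree 26 s₀ s → nats s 26 0 0 ≡ k → I k s →
      Run traceNode s (straightCost traceNode) (I (suc k))
    entry {k} {s} A refl (x₁ , traced) =
      let traced′ = TracedTo-cong {t = tableOf s₀} {tableOf s} (at A nat #left) (at A nat #right) traced
          x₁′ , traced″ = trace-step {k} {tableOf s} {chosenAt s} traced′
      in assign-then $ run-assign
        ( trans x₁′ x₁
        , TracedTo-cong {t = tableOf s} {tableOf s₀} (λ r c → sym (at A nat #left r c))
            (λ r c → sym (at A nat #right r c)) traced″ )

  itemCost outputCost : ℕ
  itemCost   = forCost (var #width) + straightCost writeItem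
  outputCost = forCost (var #count) + itemCost

  run-writeOutput : ∀ {s} → Env 𝒮 s →
    Run writeOutput s (outputCost * (1 * suc (2 ℕ.^ d) * suc M))
      (λ s′ → ∀ i → i < M → ∀ j → j < 2 ℕ.^ d →
        nats s′ 2 i j ≡ chosenAt s (2 ℕ.^ d * (M + i) + j))
  run-writeOutput {s₀} E =
    run-for itemCost {1 * suc (2 ℕ.^ d)} Rows refl _
      (λ A → count≡ (Env-Agree 𝒮 A E))
      (λ i → i) (s≤s z≤n)
      (λ {i} i<M A i≡ rows → run-map (λ (above , row) → below-suc above row) $
        run-for (straightCost writeItem) {1}
          (λ j s → Rows i s × (∀ j′ → j′ < j → Written i j′ s)) refl _
          (λ A′ → width≡ (Env-Agree 𝒮 A′
            (Env-Agree 𝒮 A E)))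
          (λ i → i) (s≤s z≤n)
          (λ {j} {s} j<n A′ j≡ (above , row) →
            run-*1 $
            item (Agree-trans A (narrow 30 A′))
              (trans (at A′ nat 30 0 0) i≡) j≡ above row)
          (rows , λ _ ()))
      (λ _ ())
    where
    Written : ℕ → ℕ → State → Set
    Written i j s = nats s 2 i j ≡ chosenAt s₀ (2 ℕ.^ d * (M + i) + j)
    Rows : ℕ → State → Set
    Rows k s = ∀ i → i < k → ∀ j → j < 2 ℕ.^ d → Written i j s
    item : ∀ {i j s} → Agree 30 s₀ s → nats s 30 0 0 ≡ i → nats s 31 0 0 ≡ j →
      Rows i s → (∀ j′ → j′ < j → Written i j′ s) →
      Run writeItem s (straightCost writeItem)
        (λ s → Rows i s × (∀ j′ → j′ < suc j → Written i j′ s))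
    item {i} {j} {s} A refl refl above row = run-assign
      ( (λ i′ i′<i j′ j′<n → trans (otherRow i′<i j′) (above i′ i′<i j′ j′<n))
      , below-suc (λ j′ j′<j → trans (otherColumn j′<j) (row j′ j′<j))
          (trans (update-same (nats s) 2 i j _) value≡) )
      where
      E′ = Env-Agree 𝒮 A E
      x = eval (cell {nat} #chosen leafNode (lit 0)) s
      value≡ : x ≡ chosenAt s₀ (2 ℕ.^ d * (M + i) + j)
      value≡ = trans (cong₂ (λ n m → chosenAt s (n * (m + i) + j)) (width≡ E′) (count≡ E′))
        (at A nat #chosen _ 0)
      otherRow : ∀ {i′} → i′ < i → ∀ j′ → update (nats s) 2 i j x 2 i′ j′ ≡ nats s 2 i′ j′
      otherRow {i′} i′<i j′ rewrite ≢⇒≡ᵇ-false i i′ (λ eq → ℕ.<⇒≢ i′<i (sym eq)) = refl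
      otherColumn : ∀ {j′} → j′ < j → update (nats s) 2 i j x 2 i j′ ≡ nats s 2 i j′
      otherColumn {j′} j′<j rewrite ≡ᵇ-refl i | ≢⇒≡ᵇ-false j j′ (λ eq → ℕ.<⇒≢ j′<j (sym eq)) = refl

-- Preparing the scalars and the grid

least : ∀ {Q : ℕ → Set} → (∀ n → Dec (Q n)) → ∀ n → Q n →
  ∃[ k ] (k ≤ n × Q k × (∀ j → j < k → ¬ Q j))
least {Q} Q? n q = search n 0 (ℕ.+-identityʳ n) (λ _ ())
  where
  search : ∀ fuel k → fuel + k ≡ n → (∀ j → j < k → ¬ Q j) →
    ∃[ k ] (k ≤ n × Q k × (∀ j → j < k → ¬ Q j))
  search zero k refl none = k , ℕ.≤-refl , q , none
  search (suc fuel) k eq none with Q? k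
  ... | yes qk = k , ℕ.≤-trans (ℕ.m≤n+m k (suc fuel)) (ℕ.≤-reflexive eq) , qk , none
  ... | no ¬qk = search fuel (suc k) (trans (ℕ.+-suc fuel k) eq) (below-suc none ¬qk)

n≤2^n : ∀ n → n ≤ 2 ℕ.^ n
n≤2^n zero    = z≤n
n≤2^n (suc n) = ℕ.≤-trans (ℕ.+-mono-≤ (2^-pos n) (n≤2^n n))
  (ℕ.≤-reflexive (cong (2 ℕ.^ n +_) (sym (ℕ.+-identityʳ (2 ℕ.^ n)))))

log : ∀ a n → ∃[ k ] (n ≤ 2 ℕ.^ (k + a) × (∀ j → j < k → 2 ℕ.^ (j + a) < n))
log a n with least (λ k → n ℕ.≤? 2 ℕ.^ (k + a)) n
                   (ℕ.≤-trans (n≤2^n n) (ℕ.^-monoʳ-≤ 2 (ℕ.m≤m+n n a)))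
... | k , _ , n≤ , larger = k , n≤ , λ j j<k → ℕ.≰⇒> (larger j j<k)

#maxSize #depth #base #total : ℕ
#maxSize = 6
#depth   = 9
#base    = 12
#total   = 13

module Preparation (ε : ℚ) where
  sizeStep findMaxSize scanItem scanItems setFactor growGrid buildGrid : Program
  sizeStep = #maxSize ≔ op add (var {nat} #maxSize) (op sub (cell 1 (var 5) (lit 0)) (var #maxSize))
  findMaxSize = #maxSize ≔ lit {nat} 0 ⨾ for 5 (var 0) sizeStep

  doubling : ℕ → Program
  doubling x = x ≔ op add (var {nat} x) (var x) ⨾ #depth ≔ op add (lit 1) (var {nat} #depth)

  double : ℕ → ℕ → Program
  double x y = while (neg (leq (var {nat} y) (var x))) (doubling x)

  setWidth setCount : Program
  setWidth = #width ≔ lit {nat} 2 ⨾ #depth ≔ lit {nat} 2 ⨾ double #width #maxSize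
  setCount = #count ≔ lit {nat} 1 ⨾ double #count 0

  itemValue : Expr rat
  itemValue = cell 1 (var 10) (var 11)

  baseTest : Test
  baseTest = and (neg (leq itemValue (lit {rat} 0ℚ)))
    (neg (and (neg (leq (var #base) (lit {rat} 0ℚ))) (leq (var #base) itemValue)))

  scanItem = ifElse baseTest (#base ≔ itemValue) skip ⨾
             #total ≔ op add (var {rat} #total) itemValue
  scanItems = #base ≔ lit {rat} 0ℚ ⨾ #total ≔ lit {rat} 0ℚ ⨾
    for 10 (var #count) (for 11 (var #width) scanItem)

  setFactor = #factor ≔ op add (lit 1ℚ) (op div (lit (½ *ℚ ε)) (toRat (var #depth)))

  notCovered : Test
  notCovered = neg (leq (var #total) (gridAt (var #top)))

  growGrid =
    assign {rat} #grid (op add (lit 1) (var #top)) (lit 0)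
      (op mul (var #factor) (gridAt (var #top))) ⨾
    #top ≔ op add (lit 1) (var {nat} #top)
  buildGrid = #top ≔ lit {nat} 1 ⨾ assign {rat} #grid (lit 1) (lit 0) (var #base) ⨾
    while notCovered growGrid

module _ (ε : ℚ) where
  open Preparation ε

  findCost scanCost scanItemsCost gridCost : ℕ
  findCost      = straightCost (#maxSize ≔ lit {nat} 0) + (forCost (var 0) + straightCost sizeStep)
  scanCost      = forCost (var #count) + (forCost (var #width) + straightCost scanItem)
  scanItemsCost = straightCost (#base ≔ lit {rat} 0ℚ) + (straightCost (#total ≔ lit {rat} 0ℚ) + scanCost)
  gridCost      = straightCost (#top ≔ lit {nat} 1) +
    (straightCost (assign {rat} #grid (lit 1) (lit 0) (var #base)) + whileCost notCovered growGrid)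

  doubleCost : ℕ → ℕ → ℕ
  doubleCost x y = whileCost (neg (leq (var {nat} y) (var x))) (doubling x)

  run-findMaxSize : ∀ {s m} (size : ℕ → ℕ) N → nats s 0 0 0 ≡ m →
    (∀ i → nats s 1 i 0 ≡ size i) → (∀ i → size i ≤ N) →
    Run findMaxSize s (findCost * (1 * suc m))
      (λ s′ → (∀ i → i < m → size i ≤ nats s′ #maxSize 0 0) × nats s′ #maxSize 0 0 ≤ N)
  run-findMaxSize {s₀} {m} size N m≡ size≡ size≤N =
    assign-then* (forCost (var 0) + straightCost sizeStep) (1 * suc m) (s≤s z≤n) $
    run-for (straightCost sizeStep) {1}
      (λ k s → (∀ i → i < k → size i ≤ nats s #maxSize 0 0) × nats s #maxSize 0 0 ≤ N)
      refl _ (λ A → trans (at A nat 0 0 0) m≡) (λ i → i) (s≤s z≤n)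
      (λ {k} {s} k<m A k≡ (bound , ≤N) →
        run-*1 $
        let x = nats s #maxSize 0 0
            y≡ = trans (cong (λ k → nats s 1 k 0) k≡) (trans (at A nat 1 k 0) (size≡ k)) in
        run-assign
          ( below-suc (λ i i<k → ℕ.≤-trans (bound i i<k) (ℕ.m≤m+n x _))
              (ℕ.≤-trans (ℕ.m≤n+m∸n (size k) x)
                (ℕ.≤-reflexive (cong (λ y → x + (y ∸ x)) (sym y≡))))
          , subst (λ y → x + (y ∸ x) ≤ N) (sym y≡) (max≤ x (size k) ≤N (size≤N k)) ))
      ((λ _ ()) , z≤n)
    where
    max≤ : ∀ x y → x ≤ N → y ≤ N → x + (y ∸ x) ≤ N
    max≤ x y x≤N y≤N with ℕ.≤-total x y
    ... | inj₁ x≤y = ℕ.≤-trans (ℕ.≤-reflexive (ℕ.m+[n∸m]≡n x≤y)) y≤N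
    ... | inj₂ y≤x = ℕ.≤-trans (ℕ.≤-reflexive
      (trans (cong (x +_) (ℕ.m≤n⇒m∸n≡0 y≤x)) (ℕ.+-identityʳ x))) x≤N

  run-double : ∀ {s bound D₀} x y a k →
    T (rank nat y <ᵇ x) → rank nat x ≡ x → x ≤ #depth →
    (∀ s v → nats (write nat s x 0 0 v) #depth 0 0 ≡ nats s #depth 0 0) →
    (∀ s v → nats (write nat s #depth 0 0 v) x 0 0 ≡ nats s x 0 0) →
    nats s y 0 0 ≡ bound → bound ≤ 2 ℕ.^ (k + a) → (∀ j → j < k → 2 ℕ.^ (j + a) < bound) →
    nats s x 0 0 ≡ 2 ℕ.^ a → nats s #depth 0 0 ≡ D₀ →
    Run (double x y) s
      (doubleCost x y * suc k)
      (λ s′ → nats s′ x 0 0 ≡ 2 ℕ.^ (k + a) × nats s′ #depth 0 0 ≡ k + D₀)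
  run-double {s₀} {bound} {D₀} x y a k y<x rank-x x≤depth keep-depth keep-x y≡ bound≤ larger x≡ depth≡ =
    run-map proj₂ $
    run-while* k J
      (λ j<k (A , x≡ , _) → cong not (≤ᵇ-false
        (subst₂ _<_ (sym x≡) (sym (trans (at A nat y {y<x} 0 0) y≡)) (larger _ j<k))))
      (λ (A , x≡ , _) → cong not (≤ᵇ-true
        (subst₂ _≤_ (sym (trans (at A nat y {y<x} 0 0) y≡)) (sym x≡) bound≤)))
      (λ {j} {s} _ (A , x≡ , depth≡) →
        let s′ = write nat s x 0 0 (nats s x 0 0 + nats s x 0 0) in
        assign-then $ run-assign
        ( Agree-trans A (Agree-trans
            (write-Agree nat s x 0 0 _ (ℕ.≤-reflexive (sym rank-x)))
            (write-Agree nat s′ #depth 0 0 _ x≤depth))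
        , trans (keep-x s′ _) (trans (update-same (nats s) x 0 0 _)
            (trans (cong₂ _+_ x≡ x≡) (cong (2 ℕ.^ (j + a) +_) (sym (ℕ.+-identityʳ _)))))
        , cong suc (trans (keep-depth s _) depth≡) ))
      (Agree-refl , x≡ , depth≡)
    where
    J : ℕ → State → Set
    J j s = Agree x s₀ s × nats s x 0 0 ≡ 2 ℕ.^ (j + a) × nats s #depth 0 0 ≡ j + D₀

  IsBase : ℚ → ℚ → Set
  IsBase μ x = x ≡ 0ℚ ⊎ (0ℚ <ℚ x × μ ≤ℚ x)

  Covers : ℚ → ℚ → Set
  Covers x y = 0ℚ <ℚ y → 0ℚ <ℚ x × x ≤ℚ y

  run-scanItems : ∀ {s m n} (f : ℕ → ℕ → ℚ) μ → nats s #count 0 0 ≡ m → nats s #width 0 0 ≡ n →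
    (∀ i j → rats s 1 i j ≡ f i j) → (∀ i j → 0ℚ <ℚ f i j → μ ≤ℚ f i j) →
    Run scanItems s
      (scanItemsCost * (1 * suc n * suc m))
      (λ s′ → IsBase μ (rats s′ #base 0 0) ×
        (∀ i → i < m → ∀ j → j < n → Covers (rats s′ #base 0 0) (f i j)) ×
        rats s′ #total 0 0 ≡ sumTo (λ i → sumTo (f i) n) m)
  run-scanItems {s₀} {m} {n} f μ m≡ n≡ f≡ μ≤ =
    assign-then* (straightCost (#total ≔ lit {rat} 0ℚ) + scanCost) (1 * suc n * suc m) 1≤area $
    assign-then* scanCost (1 * suc n * suc m) 1≤area $
    run-for (forCost (var #width) + straightCost scanItem) {1 * suc n}
      Rows refl _ (λ A → trans (at A nat #count 0 0) m≡) (λ r → r) (s≤s z≤n)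
      (λ {i} _ A i≡ (base , covers , total≡) →
        run-map (λ (base , covers , row , total≡) → base , below-suc covers row , total≡) $
        run-for (straightCost scanItem) {1} (Columns i)
          refl _ (λ A′ → trans (at A′ nat #width 0 0) (trans (at A nat #width 0 0) n≡))
          (λ r → r) (s≤s z≤n)
          (λ {j} {s} _ A′ j≡ r → run-*1
            (item (trans (cong₂ (rats s 1) (trans (at A′ nat 10 0 0) i≡) j≡)
              (trans (at A′ rat 1 i j) (trans (at A rat 1 i j) (f≡ i j)))) r))
          (base , covers , (λ _ ()) , trans total≡ (sym (ℚ.+-identityʳ _))))
      (inj₁ refl , (λ _ ()) , refl)
    where
    1≤area : 1 ≤ 1 * suc n * suc m
    1≤area = ℕ.*-mono-≤ {1} {1 * suc n} (s≤s z≤n) (s≤s z≤n)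
    Rows : ℕ → State → Set
    Rows k s = IsBase μ (rats s #base 0 0) ×
      (∀ i → i < k → ∀ j → j < n → Covers (rats s #base 0 0) (f i j)) ×
      rats s #total 0 0 ≡ sumTo (λ i → sumTo (f i) n) k
    Columns : ℕ → ℕ → State → Set
    Columns i k s = IsBase μ (rats s #base 0 0) ×
      (∀ i′ → i′ < i → ∀ j → j < n → Covers (rats s #base 0 0) (f i′ j)) ×
      (∀ j → j < k → Covers (rats s #base 0 0) (f i j)) ×
      rats s #total 0 0 ≡ sumTo (λ i → sumTo (f i) n) i +ℚ sumTo (f i) k
    lower : ∀ {x x′ y} → (0ℚ <ℚ x → 0ℚ <ℚ x′ × x′ ≤ℚ x) → Covers x y → Covers x′ y
    lower ≤x c 0<y with c 0<y
    ... | 0<x , x≤y with ≤x 0<x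
    ...   | 0<x′ , x′≤x = 0<x′ , ℚ.≤-trans x′≤x x≤y
    item : ∀ {i j s} → eval itemValue s ≡ f i j → Columns i j s →
      Run scanItem s (straightCost scanItem) (Columns i (suc j))
    item {i} {j} {s} v≡ (base , covers , row , total≡) = run-if {Q = Q}
      (λ true≡ → let v≰0 , better = test-true baseTest s true≡
                     0<v = ℚ.≰⇒> v≰0
                     0<f = subst (0ℚ <ℚ_) v≡ 0<v
                     improves = λ 0<b → 0<v , ℚ.<⇒≤ (ℚ.≰⇒> λ b≤v → better
                       ((λ b≤0 → ℚ.<-irrefl refl (ℚ.<-≤-trans 0<b b≤0)) , b≤v)) in
        run-assign
          ( inj₂ (0<v , ℚ.≤-trans (μ≤ i j 0<f) (ℚ.≤-reflexive (sym v≡)))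
          , (λ i′ i′<i j′ j′<n → lower improves (covers i′ i′<i j′ j′<n))
          , below-suc (λ j′ j′<j → lower improves (row j′ j′<j))
              (λ _ → 0<v , ℚ.≤-reflexive v≡)
          , total≡ , v≡ ))
      (λ false≡ → run-skip (base , covers , below-suc row (kept-base false≡) , total≡ , v≡))
      >>= λ {s′} (base , covers , row , total≡ , v≡) → run-assign
        ( base , covers , row
        , trans (cong₂ _+ℚ_ total≡ v≡) (ℚ.+-assoc (sumTo (λ i → sumTo (f i) n) i) (sumTo (f i) j) (f i j)) )
      where
      Q : State → Set
      Q s = IsBase μ (rats s #base 0 0) ×
        (∀ i′ → i′ < i → ∀ j → j < n → Covers (rats s #base 0 0) (f i′ j)) ×
        (∀ j′ → j′ < suc j → Covers (rats s #base 0 0) (f i j′)) ×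
        rats s #total 0 0 ≡ sumTo (λ i → sumTo (f i) n) i +ℚ sumTo (f i) j ×
        eval itemValue s ≡ f i j
      kept-base : evalTest baseTest s ≡ false → Covers (rats s #base 0 0) (f i j)
      kept-base false≡ 0<f
        with b≰0 , b≤v ← Holds-stable (and (neg (leq (var #base) (lit {rat} 0ℚ))) (leq (var #base) itemValue)) s
               (λ q → test-false baseTest s false≡
                 ((λ v≤0 → ℚ.<-irrefl refl (ℚ.<-≤-trans (subst (0ℚ <ℚ_) (sym v≡) 0<f) v≤0)) , q)) =
        ℚ.≰⇒> b≰0 , ℚ.≤-trans b≤v (ℚ.≤-reflexive v≡)

  gridValue : ℚ → ℚ → ℕ → ℕ → ℚ
  gridValue b β K zero    = 0ℚ
  gridValue b β K (suc c) = if c <ᵇ K then b *ℚ β ^ c else 0ℚ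

  run-buildGrid : ∀ {s β b B} κ → rats s #factor 0 0 ≡ β → rats s #base 0 0 ≡ b →
    rats s #total 0 0 ≡ B → (∀ c → rats s #grid c 0 ≡ 0ℚ) →
    B ≤ℚ b *ℚ β ^ κ → (∀ j → j < κ → ¬ B ≤ℚ b *ℚ β ^ j) →
    Run buildGrid s
      (gridCost * suc κ)
      (λ s′ → nats s′ #top 0 0 ≡ suc κ × (∀ c → rats s′ #grid c 0 ≡ gridValue b β (suc κ) c))
  run-buildGrid {s₀} {β} {b} {B} κ β≡ b≡ B≡ grid≡0 B≤ B≰ = run-map proj₂ $
    assign-then* (straightCost (assign {rat} #grid (lit 1) (lit 0) (var #base)) + whileCost notCovered growGrid)
      (suc κ) (s≤s z≤n) $
    assign-then* (whileCost notCovered growGrid) (suc κ) (s≤s z≤n) $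
    run-while* κ J
      (λ {k} {s} k<κ (A , top≡ , grid≡) → cong not (≤ᵇℚ-false
        (λ le → B≰ k k<κ (subst₂ _≤ℚ_ (trans (at A rat #total 0 0) B≡) (last k s top≡ grid≡) le))))
      (λ {s} (A , top≡ , grid≡) → cong not (≤ᵇℚ-true
        (subst₂ _≤ℚ_ (sym (trans (at A rat #total 0 0) B≡)) (sym (last κ s top≡ grid≡)) B≤)))
      (λ {k} {s} _ (A , top≡ , grid≡) → assign-then $ run-assign
        ( Agree-trans A (Agree-trans
            (write-Agree rat s #grid (suc (nats s #top 0 0)) 0 _ (ℕ.≤ᵇ⇒≤ 15 16 _))
            (write-Agree nat _ #top 0 0 _ (ℕ.≤ᵇ⇒≤ 15 15 _)))
        , cong suc top≡
        , grow k s (trans (at A rat #factor 0 0) β≡) top≡ grid≡ ))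
      ( Agree-trans (write-Agree nat s₀ #top 0 0 _ (ℕ.≤ᵇ⇒≤ 15 15 _))
          (write-Agree rat _ #grid 1 0 _ (ℕ.≤ᵇ⇒≤ 15 16 _))
      , refl , start )
    where
    J : ℕ → State → Set
    J k s = Agree 15 s₀ s × nats s #top 0 0 ≡ suc k ×
      (∀ c → rats s #grid c 0 ≡ gridValue b β (suc k) c)
    ≤ᵇℚ-true : ∀ {p q} → p ≤ℚ q → (p ℚ.≤ᵇ q) ≡ true
    ≤ᵇℚ-true {p} {q} p≤q with p ℚ.≤ᵇ q | ℚ.≤⇒≤ᵇ p≤q
    ... | true | _ = refl
    ≤ᵇℚ-false : ∀ {p q} → ¬ p ≤ℚ q → (p ℚ.≤ᵇ q) ≡ false
    ≤ᵇℚ-false {p} {q} p≰q with p ℚ.≤ᵇ q in eq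
    ... | false = refl
    ... | true  = contradiction (ℚ.≤ᵇ⇒≤ (subst T (sym eq) tt)) p≰q
    last : ∀ k s → nats s #top 0 0 ≡ suc k → (∀ c → rats s #grid c 0 ≡ gridValue b β (suc k) c) →
      rats s #grid (nats s #top 0 0) 0 ≡ b *ℚ β ^ k
    last k s top≡ grid≡ = trans (cong (λ c → rats s #grid c 0) top≡)
      (trans (grid≡ (suc k)) (if-same (<ᵇ-true (ℕ.n<1+n k))))
    start : ∀ c → update (rats s₀) #grid 1 0 (rats s₀ #base 0 0) #grid c 0 ≡ gridValue b β 1 c
    start 0             = grid≡0 0
    start 1             = trans b≡ (sym (ℚ.*-identityʳ b))
    start (suc (suc c)) = grid≡0 (suc (suc c))
    unextended : ∀ k c → c ≢ suc k → gridValue b β (suc k) (suc c) ≡ gridValue b β (suc (suc k)) (suc c)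
    unextended k c c≢ with ℕ.<-cmp c (suc k)
    ... | Tri.tri≈ _ c≡ _ = contradiction c≡ c≢
    ... | Tri.tri< c< _ _ = trans (if-same (<ᵇ-true c<)) (sym (if-same (<ᵇ-true (ℕ.m<n⇒m<1+n c<))))
    ... | Tri.tri> _ _ c> = trans (if-other (<ᵇ-false (ℕ.<⇒≤ c>))) (sym (if-other (<ᵇ-false c>)))
    grow : ∀ k s → rats s #factor 0 0 ≡ β → nats s #top 0 0 ≡ suc k →
      (∀ c → rats s #grid c 0 ≡ gridValue b β (suc k) c) →
      ∀ c → update (rats s) #grid (suc (nats s #top 0 0)) 0
              (rats s #factor 0 0 *ℚ rats s #grid (nats s #top 0 0) 0) #grid c 0
            ≡ gridValue b β (suc (suc k)) c
    grow k s β≡ top≡ grid≡ zero = grid≡ 0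
    grow k s β≡ top≡ grid≡ (suc c) rewrite top≡ with c ℕ.≟ suc k
    ... | no c≢ = trans (if-other (cong (_∧ true) (≢⇒≡ᵇ-false (suc k) c (c≢ ∘ sym))))
      (trans (grid≡ (suc c)) (unextended k c c≢))
    ... | yes refl = trans (if-same (cong (_∧ true) (≡ᵇ-refl k))) (begin
      rats s #factor 0 0 *ℚ rats s #grid (suc k) 0
        ≡⟨ cong₂ _*ℚ_ β≡ (trans (grid≡ (suc k)) (if-same (<ᵇ-true (ℕ.n<1+n k)))) ⟩
      β *ℚ (b *ℚ β ^ k)     ≡⟨ solve 3 (λ β b p → β :* (b :* p) := b :* (β :* p)) refl β b (β ^ k) ⟩
      b *ℚ (β *ℚ β ^ k)     ≡⟨ if-same (<ᵇ-true (ℕ.n<1+n k)) ⟨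
      gridValue b β (suc (suc k)) (suc (suc k)) ∎)
      where
      open ≡-Reasoning
      open ℚ-Solver

-- Instances as padded tables

extend-toℕ : ∀ {A : Set} {n} d (f : Fin n → A) i → extend d f (toℕ i) ≡ f i
extend-toℕ d f Fin.zero    = refl
extend-toℕ d f (Fin.suc i) = extend-toℕ d (f ∘ Fin.suc) i

extend-beyond : ∀ {A : Set} {n} d (f : Fin n → A) {k} → n ≤ k → extend d f k ≡ d
extend-beyond {n = zero}  d f _         = refl
extend-beyond {n = suc n} d f (s≤s n≤k) = extend-beyond d (f ∘ Fin.suc) n≤k

extend-all : ∀ {A : Set} {n} (Q : A → Set) {d} {f : Fin n → A} →
  Q d → (∀ i → Q (f i)) → ∀ k → Q (extend d f k)
extend-all {n = zero}  Q qd qf k       = qd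
extend-all {n = suc n} Q qd qf zero    = qf Fin.zero
extend-all {n = suc n} Q qd qf (suc k) = extend-all Q qd (qf ∘ Fin.suc) k

sumTo-zero : ∀ {f} n → (∀ i → f i ≡ 0ℚ) → sumTo f n ≡ 0ℚ
sumTo-zero zero    f≡0 = refl
sumTo-zero (suc n) f≡0 = cong₂ _+ℚ_ (sumTo-zero n f≡0) (f≡0 n)

sum≡sumTo : ∀ {n N} (f : Fin n → ℚ) (h : ℕ → ℚ) → n ≤ N →
  (∀ i → h (toℕ i) ≡ f i) → (∀ k → n ≤ k → h k ≡ 0ℚ) → sum f ≡ sumTo h N
sum≡sumTo {zero} {N} f h _ _ beyond = sym (sumTo-zero N (λ k → beyond k z≤n))
sum≡sumTo {suc n} {suc N} f h (s≤s n≤N) inside beyond =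
  trans (cong₂ _+ℚ_ (sym (inside Fin.zero))
          (sum≡sumTo (f ∘ Fin.suc) (h ∘ suc) n≤N (inside ∘ Fin.suc) (λ k n≤k → beyond (suc k) (s≤s n≤k))))
    (sym (sumTo-head h N))

sum-≤ : ∀ {n} {g : Fin n → ℚ} (size : Fin n → ℕ) {x} →
  (∀ i → g i ≤ℚ fromℕ (size i) *ℚ x) →
  sum g ≤ℚ fromℕ (ListAction.sum (List.tabulate size)) *ℚ x
sum-≤ {zero}  size {x} g≤ = ℚ.≤-reflexive (sym (ℚ.*-zeroˡ x))
sum-≤ {suc n} {g} size {x} g≤ = begin
  g Fin.zero +ℚ sum (g ∘ Fin.suc)
    ≤⟨ ℚ.+-mono-≤ (g≤ Fin.zero) (sum-≤ (size ∘ Fin.suc) (g≤ ∘ Fin.suc)) ⟩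
  fromℕ (size Fin.zero) *ℚ x +ℚ fromℕ rest *ℚ x
    ≡⟨ ℚ.*-distribʳ-+ x (fromℕ (size Fin.zero)) (fromℕ rest) ⟨
  (fromℕ (size Fin.zero) +ℚ fromℕ rest) *ℚ x
    ≡⟨ cong (_*ℚ x) (fromℕ-+ (size Fin.zero) rest) ⟨
  fromℕ (size Fin.zero + rest) *ℚ x ∎
  where
  open ℚ.≤-Reasoning
  rest = ListAction.sum (List.tabulate (size ∘ Fin.suc))

sum-≤-const : ∀ {n} {g : Fin n → ℚ} {x} → (∀ i → g i ≤ℚ x) → sum g ≤ℚ fromℕ n *ℚ x
sum-≤-const {zero}  {x = x} g≤ = ℚ.≤-reflexive (sym (ℚ.*-zeroˡ x))
sum-≤-const {suc n} {g} {x} g≤ = begin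
  g Fin.zero +ℚ sum (g ∘ Fin.suc)   ≤⟨ ℚ.+-mono-≤ (g≤ Fin.zero) (sum-≤-const (g≤ ∘ Fin.suc)) ⟩
  x +ℚ fromℕ n *ℚ x                 ≡⟨ cong (_+ℚ fromℕ n *ℚ x) (ℚ.*-identityˡ x) ⟨
  1ℚ *ℚ x +ℚ fromℕ n *ℚ x           ≡⟨ ℚ.*-distribʳ-+ x 1ℚ (fromℕ n) ⟨
  (1ℚ +ℚ fromℕ n) *ℚ x              ≡⟨ cong (_*ℚ x) (fromℕ-suc n) ⟨
  fromℕ (suc n) *ℚ x                ∎
  where open ℚ.≤-Reasoning

module _ (I : Instance) where
  open Instance I

  ∈-values : ∀ i j → v i j List.∈ values I
  ∈-values i j = List.∈-concat⁺′ (List.∈-tabulate⁺ j) (List.∈-tabulate⁺ {f = λ i → List.tabulate (v i)} i)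

  v≤vmax : ∀ i j → v i j ≤ℚ vmax I
  v≤vmax i j = All.lookup (Extremaℚ.xs≤max 0ℚ (values I)) (∈-values i j)

  vmax-pos : 0ℚ <ℚ vmax I
  vmax-pos with i , j , 0<v ← someValuePositive = ℚ.<-≤-trans 0<v (v≤vmax i j)

  vmin≤v : ∀ i j → 0ℚ <ℚ v i j → vmin I ≤ℚ v i j
  vmin≤v i j 0<v = All.lookup
    (Extremaℚ.min≤xs (vmax I) (List.filter (0ℚ ℚ.<?_) (values I)))
    (List.∈-filter⁺ (0ℚ ℚ.<?_) (∈-values i j) 0<v)

  vmin-pos : 0ℚ <ℚ vmin I
  vmin-pos = uncurry ≤∧≢⇒< $ Extremaℚ.v<min⁺ (<⇒≤∧≢ vmax-pos)
    (All.map <⇒≤∧≢ (All.all-filter (0ℚ ℚ.<?_) (values I)))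
    where
    ≤∧≢⇒< : ∀ {p q} → p ≤ℚ q → p ≢ q → p <ℚ q
    ≤∧≢⇒< {p} {q} p≤q p≢q = ℚ.≰⇒> λ q≤p → p≢q (ℚ.≤-antisym p≤q q≤p)
    <⇒≤∧≢ : ∀ {p q} → p <ℚ q → p ≤ℚ q × p ≢ q
    <⇒≤∧≢ p<q = ℚ.<⇒≤ p<q , ℚ.<⇒≢ p<q

  size≤maxSize : ∀ i → size i ≤ maxSize I
  size≤maxSize i = All.lookup (Extremaℕ.xs≤max 0 (List.tabulate size)) (List.∈-tabulate⁺ i)

  1≤m : 1 ≤ m
  1≤m with i , _ ← someValuePositive = ℕ.≤-trans (s≤s z≤n) (Fin.toℕ<n i)

  table-toℕ : ∀ f i j → table I f (toℕ i) j ≡ extend 0ℚ (f i) j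
  table-toℕ f i j = extend-toℕ 0ℚ (λ k → extend 0ℚ (f k) j) i

  table-all : ∀ (Q : ℚ → Set) {f} → Q 0ℚ → (∀ i j → Q (f i j)) → ∀ i j → Q (table I f i j)
  table-all Q q₀ q i j = extend-all Q q₀ (λ k → extend-all Q q₀ (q k) j) i

  masked : (ℕ → ℕ → Bool) → ((i : Fin m) → Fin (size i) → ℚ) → ℕ → ℕ → ℚ
  masked b f i j = if b i j then table I f i j else 0ℚ

  record Encodes (b : ℕ → ℕ → Bool) (S : Selection I) : Set where
    constructor encodes
    field
      encoded : ∀ i j → b (toℕ i) (toℕ j) ≡ lookup (S i) j

  open Encodes

  encoding : Selection I → ℕ → ℕ → Bool
  encoding S i j = extend false (λ k → extend false (lookup (S k)) j) i

  encoding-Encodes : ∀ S → Encodes (encoding S) S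
  encoding-Encodes S = encodes λ i j → trans (extend-toℕ false (λ k → extend false (lookup (S k)) (toℕ j)) i)
    (extend-toℕ false (lookup (S i)) j)

  if-zero : ∀ b {x} → x ≡ 0ℚ → (if b then x else 0ℚ) ≡ 0ℚ
  if-zero true  x≡0 = x≡0
  if-zero false _   = refl

  module _ {b S} (enc : Encodes b S) {n′} (size≤n′ : ∀ i → size i ≤ n′) where

    categorySum≡ : ∀ f i → categorySum I f S i ≡ sumTo (masked b f (toℕ i)) n′
    categorySum≡ f i = sum≡sumTo _ (masked b f (toℕ i)) (size≤n′ i)
      (λ j → cong₂ (choose 0ℚ) (encoded enc i j)
        (trans (table-toℕ f i (toℕ j)) (extend-toℕ 0ℚ (f i) j)))
      (λ k size≤k → if-zero (b (toℕ i) k)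
        (trans (table-toℕ f i k) (extend-beyond 0ℚ (f i) size≤k)))
      where
      choose : ∀ {A : Set} → A → Bool → A → A
      choose y b x = if b then x else y

    totalSum≡ : ∀ f {M} → m ≤ M →
      sum (categorySum I f S) ≡ sumTo (λ i → sumTo (masked b f i) n′) M
    totalSum≡ f m≤M = sum≡sumTo (categorySum I f S) (λ i → sumTo (masked b f i) n′) m≤M
      (λ i → sym (categorySum≡ f i))
      (λ k m≤k → sumTo-zero n′ λ j → if-zero (b k j)
        (extend-beyond 0ℚ (λ i → extend 0ℚ (f i) j) m≤k))

  allValues : ℕ → ℕ → ℚ
  allValues M n′ = sumTo (λ i → sumTo (table I v i) n′) M

  allValues≤ : ∀ {M n′} → m ≤ M → (∀ i → size i ≤ n′) →
    allValues M n′ ≤ℚ fromℕ (itemCount I) *ℚ vmax I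
  allValues≤ {M} {n′} m≤M size≤n′ = ℚ.≤-trans
    (ℚ.≤-reflexive (sym (sum≡sumTo (λ i → sum (v i)) _ m≤M
      (λ i → sym (sum≡sumTo (v i) (table I v (toℕ i)) (size≤n′ i)
        (λ j → trans (table-toℕ v i (toℕ j)) (extend-toℕ 0ℚ (v i) j))
        (λ k size≤k → trans (table-toℕ v i k) (extend-beyond 0ℚ (v i) size≤k))))
      (λ k m≤k → sumTo-zero n′ λ j → extend-beyond 0ℚ (λ i → extend 0ℚ (v i) j) m≤k))))
    (sum-≤ size (λ i → sum-≤-const (v≤vmax i)))

-- The scheme of an instance and the correctness of its tables

0<½ : 0ℚ <ℚ ½
0<½ = toWitness {a? = 0ℚ ℚ.<? ½} _

-- The quotients must not be unfolded when terms mentioning them are compared.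
abstract
  step : ℚ → ℕ → ℕ → ℚ
  step ε d e = (½ *ℚ ε) ÷₀ fromℕ (suc (d + e))

  step≡ : ∀ ε d e → step ε d e ≡ (½ *ℚ ε) ÷₀ fromℕ (suc (d + e))
  step≡ ε d e = refl

  step-pos : ∀ {ε} d e → 0ℚ <ℚ ε → 0ℚ <ℚ step ε d e
  step-pos d e 0<ε = ÷₀-pos (*-pos 0<½ 0<ε) (fromℕ-pos {suc (d + e)} (s≤s z≤n))

  step-* : ∀ ε d e → step ε d e *ℚ fromℕ (suc (d + e)) ≡ ½ *ℚ ε
  step-* ε d e = ÷₀-* (½ *ℚ ε) (fromℕ-pos {suc (d + e)} (s≤s z≤n))

factor : ℚ → ℕ → ℕ → ℚ
factor ε d e = 1ℚ +ℚ step ε d e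

record Setup (I : Instance) (ε : ℚ) : Set where
  open Instance I
  field
    d e κ        : ℕ
    b            : ℚ
    1≤d          : 1 ≤ d
    m≤M          : m ≤ 2 ℕ.^ e
    M≤2m         : 2 ℕ.^ e ≤ 2 * m
    size≤        : ∀ i → size i ≤ 2 ℕ.^ d
    width≤       : 2 ℕ.^ d ≤ 2 * maxSize I
    0<b          : 0ℚ <ℚ b
    vmin≤b       : vmin I ≤ℚ b
    b≤           : ∀ i j → i < 2 ℕ.^ e → j < 2 ℕ.^ d →
                   0ℚ <ℚ table I v i j → b ≤ℚ table I v i j
    total≤       : allValues I (2 ℕ.^ e) (2 ℕ.^ d) ≤ℚ b *ℚ factor ε d e ^ κ
    total≰       : ∀ j → j < κ → ¬ allValues I (2 ℕ.^ e) (2 ℕ.^ d) ≤ℚ b *ℚ factor ε d e ^ j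

module Rounding {I : Instance} {ε : ℚ} (0<ε : 0ℚ <ℚ ε) (ε<1 : ε <ℚ 1ℚ) (setup : Setup I ε) where
  open Instance I
  open Setup setup

  D : ℕ
  D = suc (d + e)

  δ : ℚ
  δ = step ε d e

  0<δ : 0ℚ <ℚ δ
  0<δ = step-pos d e 0<ε

  D*δ : fromℕ D *ℚ δ ≡ ½ *ℚ ε
  D*δ = trans (ℚ.*-comm (fromℕ D) δ) (step-* ε d e)

  1<factor : 1ℚ <ℚ factor ε d e
  1<factor = ℚ.≤-<-trans (ℚ.≤-reflexive (sym (ℚ.+-identityʳ 1ℚ))) (ℚ.+-monoʳ-< 1ℚ 0<δ)

  0≤factor : 0ℚ ≤ℚ factor ε d e
  0≤factor = ℚ.≤-trans 0≤1 (ℚ.<⇒≤ 1<factor)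

  factor^D≤ : factor ε d e ^ D ≤ℚ 1ℚ +ℚ ε
  factor^D≤ = *-cancelʳ 0<1-½ε $ begin
    factor ε d e ^ D *ℚ (1ℚ -ℚ ½ *ℚ ε)     ≡⟨ cong (λ x → factor ε d e ^ D *ℚ (1ℚ -ℚ x)) D*δ ⟨
    factor ε d e ^ D *ℚ (1ℚ -ℚ fromℕ D *ℚ δ) ≤⟨ reverse-bernoulli D (ℚ.<⇒≤ 0<δ) ⟩
    1ℚ                                     ≤⟨ ≤-fromDifference (½ *ℚ (ε *ℚ (1ℚ -ℚ ε)))
                                                (*-nonNeg (ℚ.<⇒≤ 0<½) (*-nonNeg (ℚ.<⇒≤ 0<ε) (0≤q-p (ℚ.<⇒≤ ε<1))))
                                                (solve 1 (λ ε → (con 1ℚ :+ ε) :* (con 1ℚ :- con ½ :* ε)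
                                                  := con 1ℚ :+ con ½ :* (ε :* (con 1ℚ :- ε))) refl ε) ⟩
    (1ℚ +ℚ ε) *ℚ (1ℚ -ℚ ½ *ℚ ε)            ∎
    where
    open ℚ.≤-Reasoning
    open ℚ-Solver
    0<1-½ε : 0ℚ <ℚ 1ℚ -ℚ ½ *ℚ ε
    0<1-½ε = ℚ.<-≤-trans 0<½ $ ≤-fromDifference (½ *ℚ (1ℚ -ℚ ε))
      (*-nonNeg (ℚ.<⇒≤ 0<½) (0≤q-p (ℚ.<⇒≤ ε<1)))
      (solve 1 (λ ε → con 1ℚ :- con ½ :* ε := con ½ :+ con ½ :* (con 1ℚ :- ε)) refl ε)

  ≤factor^2D : 1ℚ +ℚ ε ≤ℚ factor ε d e ^ (2 * D)
  ≤factor^2D = ℚ.≤-trans (ℚ.≤-reflexive (cong (1ℚ +ℚ_) (begin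
    ε                                     ≡⟨ solve 1 (λ ε → ε := con ½ :* ε :+ con ½ :* ε) refl ε ⟩
    ½ *ℚ ε +ℚ ½ *ℚ ε                      ≡⟨ cong₂ _+ℚ_ D*δ D*δ ⟨
    fromℕ D *ℚ δ +ℚ fromℕ D *ℚ δ          ≡⟨ ℚ.*-distribʳ-+ δ (fromℕ D) (fromℕ D) ⟨
    (fromℕ D +ℚ fromℕ D) *ℚ δ             ≡⟨ cong (_*ℚ δ) (fromℕ-+ D D) ⟨
    fromℕ (D + D) *ℚ δ                    ≡⟨ cong (λ k → fromℕ (D + k) *ℚ δ) (ℕ.+-identityʳ D) ⟨
    fromℕ (2 * D) *ℚ δ                    ∎))) (bernoulli (2 * D) (ℚ.<⇒≤ 0<δ))
    where
    open ≡-Reasoning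
    open ℚ-Solver

  instance
    width≢0 : NonZero (2 ℕ.^ d)
    width≢0 = ℕ.m^n≢0 2 d

  atLeaf : ∀ {A : Set} → (ℕ → ℕ → A) → ℕ → A
  atLeaf F r = F (r / 2 ℕ.^ d ∸ 2 ℕ.^ e) (r % 2 ℕ.^ d)

  atLeaf≡ : ∀ {A : Set} (F : ℕ → ℕ → A) i {j} → j < 2 ℕ.^ d →
    atLeaf F (2 ℕ.^ d * (2 ℕ.^ e + i) + j) ≡ F i j
  atLeaf≡ F i {j} j<n = cong₂ F quotient remainder
    where
    open ≡-Reasoning
    n = 2 ℕ.^ d
    q = 2 ℕ.^ e + i
    node≡ : n * q + j ≡ j + q * n
    node≡ = trans (ℕ.+-comm (n * q) j) (cong (j +_) (ℕ.*-comm n q))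
    remainder : (n * q + j) % n ≡ j
    remainder = trans (cong (_% n) node≡) (trans (ℕ.[m+kn]%n≡m%n j q n) (ℕ.m<n⇒m%n≡m j<n))
    quotient : (n * q + j) / n ∸ 2 ℕ.^ e ≡ i
    quotient = begin
      (n * q + j) / n ∸ 2 ℕ.^ e      ≡⟨ cong (λ x → x / n ∸ 2 ℕ.^ e) node≡ ⟩
      (j + q * n) / n ∸ 2 ℕ.^ e      ≡⟨ cong (_∸ 2 ℕ.^ e) (ℕ.+-distrib-/-∣ʳ j (ℕ.n∣m*n q)) ⟩
      (j / n + q * n / n) ∸ 2 ℕ.^ e  ≡⟨ cong₂ (λ x y → x + y ∸ 2 ℕ.^ e) (ℕ.m<n⇒m/n≡0 j<n) (ℕ.m*n/n≡m q n) ⟩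
      q ∸ 2 ℕ.^ e                    ≡⟨ ℕ.m+n∸m≡n (2 ℕ.^ e) i ⟩
      i                              ∎

  total : ℚ
  total = allValues I (2 ℕ.^ e) (2 ℕ.^ d)

  value-range : ∀ i j → table I v i j ≡ 0ℚ ⊎ b ≤ℚ table I v i j
  value-range i j with 0ℚ ℚ.<? table I v i j
  ... | no ≯0 = inj₁ (ℚ.≤-antisym (ℚ.≮⇒≥ ≯0) (table-all I (0ℚ ≤ℚ_) ℚ.≤-refl v≥0 i j))
  ... | yes >0 with i ℕ.<? 2 ℕ.^ e | j ℕ.<? 2 ℕ.^ d
  ...   | yes i<M | yes j<n = inj₂ (b≤ i j i<M j<n >0)
  ...   | no i≮M | _ = inj₁ (extend-beyond 0ℚ (λ k → extend 0ℚ (v k) j) (ℕ.≤-trans m≤M (ℕ.≮⇒≥ i≮M)))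
  ...   | yes _ | no j≮n = inj₁ (extend-all (_≡ 0ℚ) refl
    (λ k → extend-beyond 0ℚ (v k) (ℕ.≤-trans (size≤ k) (ℕ.≮⇒≥ j≮n))) i)

  grid : ℕ → ℚ
  grid = gridValue ε b (factor ε d e) (suc κ)

  power≤ : ∀ c → b ≤ℚ b *ℚ factor ε d e ^ c
  power≤ c = ℚ.≤-trans (ℚ.≤-reflexive (sym (ℚ.*-identityʳ b)))
    (*-monoʳ (ℚ.<⇒≤ 0<b) (1≤^ c (ℚ.<⇒≤ 1<factor)))

  grid-suc : ∀ {c} → c ≤ κ → grid (suc c) ≡ b *ℚ factor ε d e ^ c
  grid-suc c≤κ = if-same (<ᵇ-true (s≤s c≤κ))

  grid-round : ∀ V → V ≡ 0ℚ ⊎ b ≤ℚ V → V ≤ℚ total →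
    ∃[ c ] (c ≤ suc κ × grid c ≤ℚ V × V ≤ℚ factor ε d e *ℚ grid c)
  grid-round V (inj₁ refl) _ = 0 , z≤n , ℚ.≤-refl , *-nonNeg 0≤factor ℚ.≤-refl
  grid-round V (inj₂ b≤V) V≤
    with least (λ j → V ℚ.≤? b *ℚ factor ε d e ^ j) κ (ℚ.≤-trans V≤ total≤)
  ... | zero , _ , V≤b , _ = 1 , s≤s z≤n ,
    ℚ.≤-trans (ℚ.≤-reflexive (trans (grid-suc z≤n) (ℚ.*-identityʳ b))) b≤V ,
    ℚ.≤-trans V≤b (ℚ.≤-trans (q≤p*q (ℚ.<⇒≤ 1<factor) (*-nonNeg (ℚ.<⇒≤ 0<b) 0≤1))
      (ℚ.≤-reflexive (cong (factor ε d e *ℚ_) (sym (grid-suc z≤n)))))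
  ... | suc j , j<κ , V≤next , above = suc j , s≤s (ℕ.<⇒≤ j<κ) ,
    ℚ.≤-trans (ℚ.≤-reflexive (grid-suc (ℕ.<⇒≤ j<κ))) (ℚ.<⇒≤ (ℚ.≰⇒> (above j ℕ.≤-refl))) ,
    ℚ.≤-trans V≤next (ℚ.≤-reflexive (trans
      (solve 3 (λ b f p → b :* (f :* p) := f :* (b :* p)) refl b (factor ε d e) (factor ε d e ^ j))
      (cong (factor ε d e *ℚ_) (sym (grid-suc (ℕ.<⇒≤ j<κ))))))
    where open ℚ-Solver

  grid-nonNeg : ∀ c → 0ℚ ≤ℚ grid c
  grid-nonNeg zero = ℚ.≤-refl
  grid-nonNeg (suc c) with c <ᵇ suc κ
  ... | true  = *-nonNeg (ℚ.<⇒≤ 0<b) (^-nonNeg c 0≤factor)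
  ... | false = ℚ.≤-refl

  grid-range : ∀ c → c ≤ suc κ → grid c ≡ 0ℚ ⊎ b ≤ℚ grid c
  grid-range zero    _         = inj₁ refl
  grid-range (suc c) (s≤s c≤κ) = inj₂ (ℚ.≤-trans (power≤ c) (ℚ.≤-reflexive (sym (grid-suc c≤κ))))

  scheme : Scheme
  scheme = record
    { d = d ; e = e ; K = suc κ ; G = grid ; β = factor ε d e ; ε₁ = 1ℚ +ℚ ε ; b = b ; B = total
    ; lo = extend 0ℚ l ; hi = extend 0ℚ u
    ; val = atLeaf (table I v) ; wt = atLeaf (table I w)
    ; 1≤β = ℚ.<⇒≤ 1<factor
    ; β^≤ε₁ = factor^D≤
    ; 0≤b = ℚ.<⇒≤ 0<b
    ; G-zero = refl
    ; G-range = grid-range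
    ; G-nonNeg = grid-nonNeg
    ; G-round = grid-round
    ; val-range = λ r → value-range (r / 2 ℕ.^ d ∸ 2 ℕ.^ e) (r % 2 ℕ.^ d)
    ; val≥0 = λ r → table-all I (0ℚ ≤ℚ_) ℚ.≤-refl v≥0 (r / 2 ℕ.^ d ∸ 2 ℕ.^ e) (r % 2 ℕ.^ d)
    ; wt≥0 = λ r → table-all I (0ℚ ≤ℚ_) ℚ.≤-refl w≥0 (r / 2 ℕ.^ d ∸ 2 ℕ.^ e) (r % 2 ℕ.^ d)
    ; 1≤d = 1≤d
    }

  open TreeTables scheme using (P; M; Filled; approximable; realize; category-bounds; root; Realized; module Approximation)

  categoryTree : ∀ g (h : ℕ → ℕ → ℚ) i → i < M →
    (∀ j → j < 2 ℕ.^ d → g (2 ℕ.^ d * (M + i) + j) ≡ h i j) →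
    treeSum g d (M + i) ≡ sumTo (h i) (2 ℕ.^ d)
  categoryTree g h i i<M g≡h =
    trans (treeSum≡sumTo g d (M + i)) (sumTo-cong (2 ℕ.^ d) (λ j<n → g≡h _ j<n))

  wholeTree : ∀ g (h : ℕ → ℕ → ℚ) →
    (∀ i → i < M → ∀ j → j < 2 ℕ.^ d → g (2 ℕ.^ d * (M + i) + j) ≡ h i j) →
    treeSum g (d + e) 1 ≡ sumTo (λ i → sumTo (h i) (2 ℕ.^ d)) M
  wholeTree g h g≡h = begin
    treeSum g (d + e) 1                                ≡⟨ cong (λ k → treeSum g k 1) (ℕ.+-comm d e) ⟩
    treeSum g (e + d) 1                                ≡⟨ treeSum-+ g d e 1 ⟩
    treeSum (treeSum g d) e 1                          ≡⟨ treeSum≡sumTo (treeSum g d) e 1 ⟩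
    sumTo (λ i → treeSum g d (M * 1 + i)) M            ≡⟨ sumTo-cong M (λ {i} i<M →
                                                            trans (cong (λ x → treeSum g d (x + i)) (ℕ.*-identityʳ M))
                                                              (categoryTree g h i i<M (g≡h i i<M))) ⟩
    sumTo (λ i → sumTo (h i) (2 ℕ.^ d)) M              ∎
    where open ≡-Reasoning

  -- because (1 - ε)(1 + ε) ≤ 1
  shrink : ∀ {p q} → 0ℚ ≤ℚ q → p ≤ℚ (1ℚ +ℚ ε) *ℚ q → (1ℚ -ℚ ε) *ℚ p ≤ℚ q
  shrink {p} {q} 0≤q p≤ = begin
    (1ℚ -ℚ ε) *ℚ p                    ≤⟨ *-monoʳ (0≤q-p (ℚ.<⇒≤ ε<1)) p≤ ⟩
    (1ℚ -ℚ ε) *ℚ ((1ℚ +ℚ ε) *ℚ q)     ≤⟨ ≤-fromDifference (ε *ℚ ε *ℚ q)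
                                           (*-nonNeg (*-nonNeg (ℚ.<⇒≤ 0<ε) (ℚ.<⇒≤ 0<ε)) 0≤q)
                                           (solve 2 (λ ε q → q := (con 1ℚ :- ε) :* ((con 1ℚ :+ ε) :* q)
                                             :+ ε :* ε :* q) refl ε q) ⟩
    q                                 ∎
    where
    open ℚ.≤-Reasoning
    open ℚ-Solver

  atLeafMask : ∀ (c : ℕ → ℕ → Bool) f {i j} → j < 2 ℕ.^ d →
    mask (atLeaf c) (atLeaf (table I f)) (2 ℕ.^ d * (M + i) + j) ≡ masked I c f i j
  atLeafMask c f {i} {j} j<n = atLeaf≡ (masked I c f) i j<n

  feasible-eligible : ∀ {t} → Filled t → ∀ {S} → Feasible I S →
    ∃[ c ] (c ≤ suc κ × Eligible scheme t L c × weight t 1 c ≤ℚ totalWeight I S)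
  feasible-eligible {t} filled {S} (bounds , L≤) =
    let c , a = approximated in
    c , Approximation.index≤ a ,
    ( Approximation.present a
    , ℚ.≤-trans L≤ (ℚ.≤-trans (ℚ.≤-reflexive (whole v)) (ℚ.≤-trans (Approximation.upper a)
        (*-monoˡ (grid-nonNeg c) factor^D≤))) ) ,
    ℚ.≤-trans (Approximation.weight≤ a) (ℚ.≤-reflexive (sym (whole w)))
    where
    code = encoding I S
    σ = atLeaf code
    whole : ∀ f → sum (categorySum I f S) ≡ treeSum (mask σ (atLeaf (table I f))) (d + e) 1
    whole f = trans (totalSum≡ I (encoding-Encodes I S) size≤ f m≤M)
      (sym (wholeTree _ (masked I code f) (λ i _ j j<n → atLeafMask code f j<n)))
    InBounds : ℕ → ℚ → Set
    InBounds i V = extend 0ℚ l i ≤ℚ V × V ≤ℚ extend 0ℚ u i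
    padded-bounds : ∀ i → InBounds i (sumTo (masked I code v i) (2 ℕ.^ d))
    padded-bounds i with i ℕ.<? m
    ... | yes i<m = subst (λ i → InBounds i (sumTo (masked I code v i) (2 ℕ.^ d))) (Fin.toℕ-fromℕ< i<m) $
      subst₂ _≤ℚ_ (sym (extend-toℕ 0ℚ l k)) (categorySum≡ I (encoding-Encodes I S) size≤ v k) (proj₁ (bounds k)) ,
      subst₂ _≤ℚ_ (categorySum≡ I (encoding-Encodes I S) size≤ v k) (sym (extend-toℕ 0ℚ u k)) (proj₂ (bounds k))
      where k = Fin.fromℕ< i<m
    ... | no i≮m = ℚ.≤-reflexive (trans (extend-beyond 0ℚ l m≤i) (sym zero≡)) ,
      ℚ.≤-reflexive (trans zero≡ (sym (extend-beyond 0ℚ u m≤i)))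
      where
      m≤i = ℕ.≮⇒≥ i≮m
      zero≡ : sumTo (masked I code v i) (2 ℕ.^ d) ≡ 0ℚ
      zero≡ = sumTo-zero (2 ℕ.^ d) λ j → if-zero I (code i j)
        (extend-beyond 0ℚ (λ k → extend 0ℚ (v k) j) m≤i)
    feasible : ∀ r → M ≤ r → r < M + M → InBounds (r ∸ M) (treeSum (mask σ (atLeaf (table I v))) d r)
    feasible r M≤r r<2M = subst (InBounds (r ∸ M)) (sym (trans
      (cong (treeSum (mask σ (atLeaf (table I v))) d) (sym (ℕ.m+[n∸m]≡n M≤r)))
      (categoryTree _ (masked I code v) (r ∸ M)
        (ℕ.+-cancelˡ-< M _ _ (ℕ.≤-<-trans (ℕ.≤-reflexive (ℕ.m+[n∸m]≡n M≤r)) r<2M))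
        (λ j j<n → atLeafMask code v j<n)))) (padded-bounds (r ∸ M))
    approximated = approximable filled σ feasible (d + e) 0 1 root
      (ℚ.≤-reflexive (wholeTree _ _ λ i _ j j<n → atLeaf≡ (table I v) i j<n))

  module _ {t : Tables} (filled : Filled t) (X : ℕ → ℕ)
    (traced : TracedTo scheme P t X) (best : Selected scheme t L (X 1)) {s : State}
    (written : ∀ i → i < M → ∀ j → j < 2 ℕ.^ d → nats s 2 i j ≡ X (2 ℕ.^ d * (M + i) + j)) where

    picked : ℕ → ℕ → Bool
    picked i j = 0 <ᵇ X (2 ℕ.^ d * (M + i) + j)

    picked-Encodes : Encodes I picked (output I s)
    picked-Encodes = encodes λ i j → trans
      (cong (0 <ᵇ_) (sym (written (toℕ i) (ℕ.<-≤-trans (Fin.toℕ<n i) m≤M) (toℕ j)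
        (ℕ.<-≤-trans (Fin.toℕ<n j) (size≤ i)))))
      (sym (Vec.lookup∘tabulate (λ j → 0 <ᵇ nats s 2 (toℕ i) (toℕ j)) j))

    chosen : ℕ → Bool
    chosen r = 0 <ᵇ X r

    picked-leaf : ∀ f i {j} → j < 2 ℕ.^ d →
      mask chosen (atLeaf (table I f)) (2 ℕ.^ d * (M + i) + j) ≡ masked I picked f i j
    picked-leaf f i {j} j<n = cong (λ x → if picked i j then x else 0ℚ) (atLeaf≡ (table I f) i j<n)

    whole-output : ∀ f →
      sum (categorySum I f (output I s)) ≡ treeSum (mask chosen (atLeaf (table I f))) (d + e) 1
    whole-output f = trans (totalSum≡ I picked-Encodes size≤ f m≤M)
      (sym (wholeTree _ (masked I picked f) (λ i _ j j<n → picked-leaf f i j<n)))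

    category-output : ∀ k →
      categoryValue I (output I s) k ≡ treeSum (mask chosen (atLeaf (table I v))) d (M + toℕ k)
    category-output k = trans (categorySum≡ I picked-Encodes size≤ v k)
      (sym (categoryTree _ (masked I picked v) (toℕ k) (ℕ.<-≤-trans (Fin.toℕ<n k) m≤M)
        (λ j j<n → picked-leaf v (toℕ k) j<n)))

    module _ {S₀} (feasible₀ : Feasible I S₀) where

      root-eligible : Eligible scheme t L (X 1)
      root-eligible = let c , c≤K , ok , _ = feasible-eligible filled {S₀} feasible₀
                      in proj₁ (best c c≤K ok)

      whole : Realized filled X traced (d + e) 1
      whole = realize filled X traced (d + e) 0 1 root (proj₁ root-eligible)

      output-weight≤ : ∀ {S} → Feasible I S → totalWeight I (output I s) ≤ℚ totalWeight I S
      output-weight≤ {S} feasible =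
        let c , c≤K , ok , weight≤ = feasible-eligible filled {S} feasible in
        ℚ.≤-trans (ℚ.≤-reflexive (trans (whole-output w) (Realized.weight≡ whole)))
          (ℚ.≤-trans (proj₂ (best c c≤K ok)) weight≤)

      output-value : (1ℚ -ℚ ε) *ℚ L ≤ℚ totalValue I (output I s)
      output-value = ℚ.≤-trans
        (shrink (grid-nonNeg (X 1)) (proj₂ root-eligible))
        (ℚ.≤-trans (Realized.lower whole) (ℚ.≤-reflexive (sym (whole-output v))))

      chosen-nonNeg : ∀ r → 0ℚ ≤ℚ mask chosen (atLeaf (table I v)) r
      chosen-nonNeg r with chosen r
      ... | true  = table-all I (0ℚ ≤ℚ_) ℚ.≤-refl v≥0 (r / 2 ℕ.^ d ∸ 2 ℕ.^ e) (r % 2 ℕ.^ d)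
      ... | false = ℚ.≤-refl

      output-category : ∀ k → (1ℚ -ℚ ε) *ℚ l k ≤ℚ categoryValue I (output I s) k ×
        categoryValue I (output I s) k ≤ℚ (1ℚ +ℚ ε) *ℚ u k
      output-category k = lower , upper
        where
        open ℚ.≤-Reasoning
        V : ℚ
        V = treeSum (mask chosen (atLeaf (table I v))) d (M + toℕ k)
        bounds : extend 0ℚ l (toℕ k) ≤ℚ (1ℚ +ℚ ε) *ℚ V × V ≤ℚ (1ℚ +ℚ ε) *ℚ extend 0ℚ u (toℕ k)
        bounds = category-bounds filled X traced (proj₁ root-eligible)
          (ℕ.<-≤-trans (Fin.toℕ<n k) m≤M)
        lower : (1ℚ -ℚ ε) *ℚ l k ≤ℚ categoryValue I (output I s) k
        lower = begin
          (1ℚ -ℚ ε) *ℚ l k                    ≡⟨ cong ((1ℚ -ℚ ε) *ℚ_) (extend-toℕ 0ℚ l k) ⟨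
          (1ℚ -ℚ ε) *ℚ extend 0ℚ l (toℕ k)    ≤⟨ shrink (treeSum-nonNeg chosen-nonNeg d (M + toℕ k)) (proj₁ bounds) ⟩
          V                                   ≡⟨ category-output k ⟨
          categoryValue I (output I s) k      ∎
        upper : categoryValue I (output I s) k ≤ℚ (1ℚ +ℚ ε) *ℚ u k
        upper = begin
          categoryValue I (output I s) k      ≡⟨ category-output k ⟩
          V                                   ≤⟨ proj₂ bounds ⟩
          (1ℚ +ℚ ε) *ℚ extend 0ℚ u (toℕ k)    ≡⟨ cong ((1ℚ +ℚ ε) *ℚ_) (extend-toℕ 0ℚ u k) ⟩
          (1ℚ +ℚ ε) *ℚ u k                    ∎

    output-approximates : (∃[ S ] Feasible I S) → ApproxSolution I ε (output I s)
    output-approximates (S₀ , feasible₀) =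
      (λ W ((S , feasible , weight≡W) , _) →
        ℚ.≤-trans (output-weight≤ {S₀} feasible₀ {S} feasible) (ℚ.≤-reflexive weight≡W)) ,
      output-category {S₀} feasible₀ ,
      output-value {S₀} feasible₀

-- The whole program

module _ (ε : ℚ) where
  open Preparation ε
  open Merge (1ℚ +ℚ ε)
  open Leaves using (fillLeaves)
  open Selection (1ℚ +ℚ ε)

  prepare search algorithm : Program
  prepare   = findMaxSize ⨾ setWidth ⨾ setCount ⨾ scanItems ⨾ setFactor
  search    = buildGrid ⨾ fillLeaves ⨾ mergeTables ⨾ selectRoot ⨾ traceTables ⨾ writeOutput
  algorithm = prepare ⨾ search

m≤2^k⇒2^k≤2m : ∀ {n} a k → 2 ℕ.^ a ≤ 2 * n → (∀ j → j < k → 2 ℕ.^ (j + a) < n) →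
  2 ℕ.^ (k + a) ≤ 2 * n
m≤2^k⇒2^k≤2m a zero    2ᵃ≤ _      = 2ᵃ≤
m≤2^k⇒2^k≤2m a (suc k) _   larger = ℕ.*-monoʳ-≤ 2 (ℕ.<⇒≤ (larger k ℕ.≤-refl))

suc≤2* : ∀ {n} → 1 ≤ n → suc n ≤ 2 * n
suc≤2* {n} 1≤n = ℕ.≤-trans (ℕ.+-monoˡ-≤ n 1≤n) (ℕ.≤-reflexive (cong (n +_) (sym (ℕ.+-identityʳ n))))

-- A record rather than a bound c * X, from which c and X cannot be inferred.
record Scaled (X : ℕ) (P : Program) (s : State) (c : ℕ) (Q : State → Set) : Set where
  constructor scaled
  field
    unscaled : Run P s (c * X) Q

open Scaled

infixr 4 _>>=*_

_>>=*_ : ∀ {X P P′ s c c′ Q R} → Scaled X P s c Q →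
  (∀ {s′} → Q s′ → Scaled X P′ s′ c′ R) → Scaled X (P ⨾ P′) s (c + c′) R
_>>=*_ {X} {c = c} {c′} r f =
  scaled (run-≤ (ℕ.≤-reflexive (sym (ℕ.*-distribʳ-+ X c c′))) (unscaled r >>= λ q → unscaled (f q)))

recost : ∀ {X P s c c′ Q} → c ≡ c′ → Scaled X P s c Q → Scaled X P s c′ Q
recost refl r = r

framed* : ∀ {X P s c Q} t {_ : T (above t P)} →
  Scaled X P s c Q → Scaled X P s c (λ s′ → Agree t s s′ × Q s′)
framed* t {p} (scaled r) = scaled (framed t {p} r)

keep* : ∀ {X P s c Q} → Scaled X P s c Q → Scaled X P s c (λ s′ → Keeps P s s′ × Q s′)
keep* (scaled r) = scaled (keep r)

map* : ∀ {X P s c Q R} → (∀ {s′} → Q s′ → R s′) → Scaled X P s c Q → Scaled X P s c R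
map* f (scaled r) = scaled (run-map f r)

scale : ∀ {P s Q} c {Y} k {X} → Y ≤ k * X → Run P s (c * Y) Q → Scaled X P s (c * k) Q
scale c k {X} Y≤kX r = scaled $
  run-≤ (ℕ.≤-trans (ℕ.*-monoʳ-≤ c Y≤kX) (ℕ.≤-reflexive (sym (ℕ.*-assoc c k X)))) r

constant : ∀ {P s c X Q} → 1 ≤ X → Run P s c Q → Scaled X P s c Q
constant {c = c} 1≤X r = scaled $
  run-≤ (ℕ.≤-trans (ℕ.≤-reflexive (sym (ℕ.*-identityʳ c))) (ℕ.*-monoʳ-≤ c 1≤X)) r

module _ (I : Instance) (ε : ℚ) where
  open Instance I
  open Preparation ε

  record Prepared (d e : ℕ) (s : State) : Set where
    field
      inputs  : Agree 5 (input I) s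
      1≤d     : 1 ≤ d
      m≤M     : m ≤ 2 ℕ.^ e
      M≤2m    : 2 ℕ.^ e ≤ 2 * m
      size≤   : ∀ i → size i ≤ 2 ℕ.^ d
      width≤  : 2 ℕ.^ d ≤ 2 * maxSize I
      0<b     : 0ℚ <ℚ rats s #base 0 0
      vmin≤b  : vmin I ≤ℚ rats s #base 0 0
      b≤      : ∀ i j → i < 2 ℕ.^ e → j < 2 ℕ.^ d →
                0ℚ <ℚ table I v i j → rats s #base 0 0 ≤ℚ table I v i j
      width≡  : nats s #width 0 0 ≡ 2 ℕ.^ d
      count≡  : nats s #count 0 0 ≡ 2 ℕ.^ e
      total≡  : rats s #total 0 0 ≡ allValues I (2 ℕ.^ e) (2 ℕ.^ d)
      factor≡ : rats s #factor 0 0 ≡ factor ε d e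

  sizeAt : ℕ → ℕ
  sizeAt = extend 0 size

  widthCost countCost setupCost prepareCost : ℕ
  widthCost   = straightCost (#width ≔ lit {nat} 2) + (straightCost (#depth ≔ lit {nat} 2) + doubleCost ε #width #maxSize)
  countCost   = straightCost (#count ≔ lit {nat} 1) + doubleCost ε #count 0
  setupCost   = widthCost * 1 + (countCost * 2 + (scanItemsCost ε * 4 + straightCost setFactor))
  prepareCost = findCost ε * 2 + setupCost

  run-setWidth : ∀ {s n} k → nats s #maxSize 0 0 ≡ n →
    n ≤ 2 ℕ.^ (k + 1) → (∀ j → j < k → 2 ℕ.^ (j + 1) < n) →
    Run setWidth s (widthCost * suc k)
      (λ s′ → nats s′ #width 0 0 ≡ 2 ℕ.^ (k + 1) × nats s′ #depth 0 0 ≡ k + 2)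
  run-setWidth k n≡ n≤ larger =
    assign-then* (straightCost (#depth ≔ lit {nat} 2) + doubleCost ε #width #maxSize) (suc k) (s≤s z≤n) $
    assign-then* (doubleCost ε #width #maxSize) (suc k) (s≤s z≤n) $
    run-double ε #width #maxSize 1 k _ refl (ℕ.≤ᵇ⇒≤ 7 9 _) (λ _ _ → refl) (λ _ _ → refl)
      n≡ n≤ larger refl refl

  run-setCount : ∀ {s n D₀} k → nats s 0 0 0 ≡ n →
    n ≤ 2 ℕ.^ (k + 0) → (∀ j → j < k → 2 ℕ.^ (j + 0) < n) → nats s #depth 0 0 ≡ D₀ →
    Run setCount s (countCost * suc k)
      (λ s′ → nats s′ #count 0 0 ≡ 2 ℕ.^ (k + 0) × nats s′ #depth 0 0 ≡ k + D₀)
  run-setCount k n≡ n≤ larger depth≡ =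
    assign-then* (doubleCost ε #count 0) (suc k) (s≤s z≤n) $
    run-double ε #count 0 0 k _ refl (ℕ.≤ᵇ⇒≤ 8 9 _) (λ _ _ → refl) (λ _ _ → refl)
      n≡ n≤ larger refl depth≡

  module Preparing {s₁ : State} (A₁ : Agree 5 (input I) s₁)
    (size≤n : ∀ i → size i ≤ nats s₁ #maxSize 0 0) (n≤maxSize : nats s₁ #maxSize 0 0 ≤ maxSize I)
    {kᵈ kᵉ : ℕ} (n≤N : nats s₁ #maxSize 0 0 ≤ 2 ℕ.^ (kᵈ + 1))
    (n-larger : ∀ j → j < kᵈ → 2 ℕ.^ (j + 1) < nats s₁ #maxSize 0 0)
    (m≤2^ : m ≤ 2 ℕ.^ (kᵉ + 0)) (m-larger : ∀ j → j < kᵉ → 2 ℕ.^ (j + 0) < m) where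

    d e X : ℕ
    d = kᵈ + 1
    e = kᵉ + 0
    X = 2 ℕ.^ d * 2 ℕ.^ e

    1≤n : 1 ≤ nats s₁ #maxSize 0 0
    1≤n with i , j , _ ← someValuePositive =
      ℕ.≤-trans (ℕ.≤-trans (s≤s z≤n) (Fin.toℕ<n j)) (size≤n i)

    M≤2*m : 2 ℕ.^ e ≤ 2 * m
    M≤2*m = m≤2^k⇒2^k≤2m 0 kᵉ (ℕ.≤-trans (1≤m I) (ℕ.m≤m+n m (m + 0))) m-larger

    N≤2*n : 2 ℕ.^ d ≤ 2 * maxSize I
    N≤2*n = ℕ.≤-trans
      (m≤2^k⇒2^k≤2m 1 kᵈ (ℕ.*-monoʳ-≤ 2 1≤n) n-larger)
      (ℕ.*-monoʳ-≤ 2 n≤maxSize)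

    N≤X : 2 ℕ.^ d ≤ X
    N≤X = ℕ.≤-trans (ℕ.≤-reflexive (sym (ℕ.*-identityʳ (2 ℕ.^ d)))) (ℕ.*-monoʳ-≤ (2 ℕ.^ d) (2^-pos e))

    M≤X : 2 ℕ.^ e ≤ X
    M≤X = ℕ.≤-trans (ℕ.≤-reflexive (sym (ℕ.*-identityˡ (2 ℕ.^ e)))) (ℕ.*-monoˡ-≤ (2 ℕ.^ e) (2^-pos d))

    1≤X : 1 ≤ X
    1≤X = ℕ.≤-trans (2^-pos d) N≤X

    suc-m≤ : 1 * suc m ≤ 2 * X
    suc-m≤ = ℕ.≤-trans (ℕ.≤-reflexive (ℕ.*-identityˡ (suc m))) $
      ℕ.≤-trans (suc≤2* (1≤m I)) (ℕ.*-monoʳ-≤ 2 (ℕ.≤-trans m≤2^ M≤X))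

    suc-kᵈ≤ : suc kᵈ ≤ 1 * X
    suc-kᵈ≤ = ℕ.≤-trans (ℕ.≤-reflexive (ℕ.+-comm 1 kᵈ))
      (ℕ.≤-trans (n≤2^n d) (ℕ.≤-trans N≤X (ℕ.≤-reflexive (sym (ℕ.*-identityˡ X)))))

    suc-kᵉ≤ : suc kᵉ ≤ 2 * X
    suc-kᵉ≤ = ℕ.≤-trans (ℕ.≤-reflexive (cong suc (sym (ℕ.+-identityʳ kᵉ))))
      (ℕ.≤-trans (n≤2^n (suc e)) (ℕ.*-monoʳ-≤ 2 M≤X))

    area≤ : 1 * suc (2 ℕ.^ d) * suc (2 ℕ.^ e) ≤ 4 * X
    area≤ = ℕ.≤-trans
      (ℕ.*-mono-≤ (ℕ.≤-trans (ℕ.≤-reflexive (ℕ.*-identityˡ _)) (suc≤2* (2^-pos d))) (suc≤2* (2^-pos e)))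
      (ℕ.≤-reflexive (solve 2 (λ x y → (con 2 :* x) :* (con 2 :* y) := con 4 :* (x :* y)) refl (2 ℕ.^ d) (2 ℕ.^ e)))
      where open ℕ-Solver

    vmin≤table : ∀ i j → 0ℚ <ℚ table I v i j → vmin I ≤ℚ table I v i j
    vmin≤table = table-all I (λ x → 0ℚ <ℚ x → vmin I ≤ℚ x)
      (λ 0<0 → contradiction 0<0 (ℚ.<-irrefl refl)) (vmin≤v I)

    Scanned : State → Set
    Scanned s = Agree 5 (input I) s × nats s #width 0 0 ≡ 2 ℕ.^ d × nats s #count 0 0 ≡ 2 ℕ.^ e ×
      nats s #depth 0 0 ≡ suc (d + e) × IsBase ε (vmin I) (rats s #base 0 0) ×
      (∀ i → i < 2 ℕ.^ e → ∀ j → j < 2 ℕ.^ d → Covers ε (rats s #base 0 0) (table I v i j)) ×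
      rats s #total 0 0 ≡ allValues I (2 ℕ.^ e) (2 ℕ.^ d)

    depth-total : kᵉ + (kᵈ + 2) ≡ suc (d + e)
    depth-total = solve 2 (λ x y → x :+ (y :+ con 2) := con 1 :+ (y :+ con 1 :+ (x :+ con 0))) refl kᵉ kᵈ
      where open ℕ-Solver

    run-scan : ∀ {s} → Agree 5 (input I) s → nats s #width 0 0 ≡ 2 ℕ.^ d →
      nats s #count 0 0 ≡ 2 ℕ.^ e → nats s #depth 0 0 ≡ suc (d + e) →
      Scaled X scanItems s (scanItemsCost ε * 4) Scanned
    run-scan {s} A width≡ count≡ depth≡ =
      map* (λ (A′ , A″ , base , covers , total≡) →
          Agree-trans A A′ , trans (at A″ nat #width 0 0) width≡ , trans (at A″ nat #count 0 0) count≡ ,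
          trans (at A″ nat #depth 0 0) depth≡ , base , covers , total≡) $
      framed* 5 $ framed* 10 $ scale (scanItemsCost ε) 4 {X} area≤ $
      run-scanItems ε {s} {2 ℕ.^ e} {2 ℕ.^ d} (table I v) (vmin I) count≡ width≡ (at A rat 1) vmin≤table

    run-factor : ∀ {s} → Scanned s → Scaled X setFactor s (straightCost setFactor) (Prepared d e)
    run-factor {s} (A , width≡ , count≡ , depth≡ , base , covers , total≡) =
      constant 1≤X $ run-assign record
        { inputs  = Agree-trans A (write-Agree rat s #factor 0 0 _ (ℕ.≤ᵇ⇒≤ 5 14 _))
        ; 1≤d     = ℕ.m≤n+m 1 kᵈ
        ; m≤M     = m≤2^
        ; M≤2m    = M≤2*m
        ; size≤   = λ i → ℕ.≤-trans (size≤n i) n≤N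
        ; width≤  = N≤2*n
        ; 0<b     = proj₁ base-range
        ; vmin≤b  = proj₂ base-range
        ; b≤      = λ i j i<M j<N 0<v → proj₂ (covers i i<M j j<N 0<v)
        ; width≡  = width≡
        ; count≡  = count≡
        ; total≡  = total≡
        ; factor≡ = trans (cong (λ k → 1ℚ +ℚ ((½ *ℚ ε) ÷₀ fromℕ k)) depth≡) (cong (1ℚ +ℚ_) (sym (step≡ ε d e)))
        }
      where
      some-covered : 0ℚ <ℚ rats s #base 0 0
      some-covered with i , j , 0<v ← someValuePositive = proj₁ $
        covers (toℕ i) (ℕ.<-≤-trans (Fin.toℕ<n i) m≤2^) (toℕ j)
          (ℕ.<-≤-trans (Fin.toℕ<n j) (ℕ.≤-trans (size≤n i) n≤N))
          (subst (0ℚ <ℚ_) (sym (trans (table-toℕ I v i (toℕ j)) (extend-toℕ 0ℚ (v i) j))) 0<v)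
      base-range : 0ℚ <ℚ rats s #base 0 0 × vmin I ≤ℚ rats s #base 0 0
      base-range = positive base
        where
        positive : IsBase ε (vmin I) (rats s #base 0 0) →
          0ℚ <ℚ rats s #base 0 0 × vmin I ≤ℚ rats s #base 0 0
        positive (inj₂ range) = range
        positive (inj₁ b≡0)   = contradiction some-covered (ℚ.<-irrefl (sym b≡0))

    run-setup : Scaled X (setWidth ⨾ setCount ⨾ scanItems ⨾ setFactor) s₁ setupCost (Prepared d e)
    run-setup = recost refl $
      framed* 5 (scale widthCost 1 {X} suc-kᵈ≤ (run-setWidth kᵈ refl n≤N n-larger))
        >>=* λ (A₂ , width≡ , depth≡) →
      framed* 5 (framed* #count (scale countCost 2 {X} suc-kᵉ≤
          (run-setCount kᵉ (at (Agree-trans A₁ A₂) nat 0 0 0) m≤2^ m-larger depth≡)))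
        >>=* λ (A₃ , A₃′ , count≡ , depth≡′) →
      run-scan (Agree-trans (Agree-trans A₁ A₂) A₃) (trans (at A₃′ nat #width 0 0) width≡)
          count≡ (trans depth≡′ depth-total)
        >>=* run-factor

  SizesFound : State → Set
  SizesFound s = Agree 5 (input I) s ×
    ((∀ i → i < m → sizeAt i ≤ nats s #maxSize 0 0) × nats s #maxSize 0 0 ≤ maxSize I)

  run-sizes : Run findMaxSize (input I) (findCost ε * (1 * suc m)) SizesFound
  run-sizes = framed 5 $ run-findMaxSize ε sizeAt (maxSize I) refl (λ _ → refl)
    (extend-all (_≤ maxSize I) z≤n (size≤maxSize I))

  size≤found : ∀ s → SizesFound s → ∀ i → size i ≤ nats s #maxSize 0 0
  size≤found s (_ , sizes≤ , _) i =
    subst (_≤ nats s #maxSize 0 0) (extend-toℕ 0 size i) (sizes≤ (toℕ i) (Fin.toℕ<n i))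

  -- The state after the first phase is a variable, since terms mentioning
  -- the computed state are too large to be compared.
  prepare-from : ∀ {s₁ t} → ⟨ findMaxSize , input I ⟩⇓⟨ s₁ , t ⟩ → t ≤ findCost ε * (1 * suc m) → SizesFound s₁ →
    ∃[ kᵈ ] (nats s₁ #maxSize 0 0 ≤ 2 ℕ.^ (kᵈ + 1) × (∀ j → j < kᵈ → 2 ℕ.^ (j + 1) < nats s₁ #maxSize 0 0)) →
    ∃[ kᵉ ] (m ≤ 2 ℕ.^ (kᵉ + 0) × (∀ j → j < kᵉ → 2 ℕ.^ (j + 0) < m)) →
    ∃[ d ] ∃[ e ] Scaled (2 ℕ.^ d * 2 ℕ.^ e) (prepare ε) (input I) prepareCost (Prepared d e)
  prepare-from {s₁} exec t≤ found (kᵈ , n≤N , n-larger) (kᵉ , m≤M , m-larger) =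
    kᵈ + 1 , kᵉ + 0 , recost refl
      (scale (findCost ε) 2
          (Preparing.suc-m≤ (proj₁ found) (size≤found s₁ found) (proj₂ (proj₂ found)) {kᵈ} {kᵉ} n≤N n-larger m≤M m-larger)
          (run {Q = _≡ s₁} exec t≤ refl) >>=* λ { {s} refl →
        Preparing.run-setup (proj₁ found) (size≤found s₁ found) (proj₂ (proj₂ found)) {kᵈ} {kᵉ} n≤N n-larger m≤M m-larger })

  run-prepare : ∃[ d ] ∃[ e ] Scaled (2 ℕ.^ d * 2 ℕ.^ e) (prepare ε) (input I) prepareCost (Prepared d e)
  run-prepare = prepare-from (Run.exec run-sizes) (Run.time≤ run-sizes) (Run.post run-sizes)
    (log 1 (nats (Run.final run-sizes) #maxSize 0 0)) (log 0 m)

module Search (𝒮 : Scheme) where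
  open Scheme 𝒮
  open TreeTables 𝒮
  open Merge ε₁ using (mergeTables)
  open Leaves using (fillLeaves)
  open Selection ε₁ using (selectRoot; traceTables; writeOutput)

  R area X : ℕ
  R    = suc (suc K)
  area = 2 ℕ.^ d * 2 ℕ.^ e
  X    = area * (R * R * R)

  P≡area : P ≡ area
  P≡area = ℕ.^-distribˡ-+-* 2 d e

  1≤R³ : 1 ≤ R * R * R
  1≤R³ = ℕ.*-mono-≤ {1} {R * R} {1} {R} (ℕ.*-mono-≤ {1} {R} {1} {R} (s≤s z≤n) (s≤s z≤n)) (s≤s z≤n)

  1≤area : 1 ≤ area
  1≤area = ℕ.*-mono-≤ (2^-pos d) (2^-pos e)

  area≤X : area ≤ X
  area≤X = ℕ.≤-trans (ℕ.≤-reflexive (sym (ℕ.*-identityʳ area))) (ℕ.*-monoʳ-≤ area 1≤R³)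

  R≤R³ : R ≤ R * R * R
  R≤R³ = ℕ.≤-trans (ℕ.≤-reflexive (sym (ℕ.*-identityˡ R)))
    (ℕ.*-monoˡ-≤ R (ℕ.*-mono-≤ {1} {R} {1} {R} (s≤s z≤n) (s≤s z≤n)))

  R≤X : R ≤ X
  R≤X = ℕ.≤-trans R≤R³ (ℕ.≤-trans (ℕ.≤-reflexive (sym (ℕ.*-identityˡ _))) (ℕ.*-monoˡ-≤ (R * R * R) 1≤area))

  1*≤ : ∀ {x y} → x ≤ y → 1 * x ≤ 1 * y
  1*≤ = ℕ.*-monoʳ-≤ 1

  suc-area≤ : suc (2 ℕ.^ d) * suc (2 ℕ.^ e) ≤ 4 * area
  suc-area≤ = ℕ.≤-trans
    (ℕ.*-mono-≤ (suc≤2* (2^-pos d)) (suc≤2* (2^-pos e)))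
    (ℕ.≤-reflexive (solve 2 (λ x y → (con 2 :* x) :* (con 2 :* y) := con 4 :* (x :* y)) refl (2 ℕ.^ d) (2 ℕ.^ e)))
    where open ℕ-Solver

  leavesSize≤ : leavesSize 𝒮 ≤ 4 * X
  leavesSize≤ = begin
    1 * suc K * suc N * suc M′       ≡⟨ cong (λ x → x * suc N * suc M′) (ℕ.*-identityˡ (suc K)) ⟩
    suc K * suc N * suc M′           ≡⟨ ℕ.*-assoc (suc K) (suc N) (suc M′) ⟩
    suc K * (suc N * suc M′)         ≤⟨ ℕ.*-mono-≤ (ℕ.≤-trans (ℕ.n≤1+n (suc K)) R≤R³) suc-area≤ ⟩
    R * R * R * (4 * area)           ≡⟨ ℕ.*-comm (R * R * R) (4 * area) ⟩
    4 * area * (R * R * R)           ≡⟨ ℕ.*-assoc 4 area (R * R * R) ⟩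
    4 * X                            ∎
    where
    open ℕ.≤-Reasoning
    N  = 2 ℕ.^ d
    M′ = 2 ℕ.^ e

  nodes≡ : suc (P ∸ 1) ≡ area
  nodes≡ = trans (ℕ.m+[n∸m]≡n (2^-pos (d + e))) P≡area

  mergeSize≤ : mergeSize 𝒮 ≤ 1 * X
  mergeSize≤ = ℕ.≤-reflexive (begin
    1 * R * R * R * suc (P ∸ 1)   ≡⟨ cong₂ (λ x y → x * R * R * y) (ℕ.*-identityˡ R) nodes≡ ⟩
    R * R * R * area              ≡⟨ ℕ.*-comm (R * R * R) area ⟩
    X                             ≡⟨ ℕ.*-identityˡ X ⟨
    1 * X                         ∎)
    where open ≡-Reasoning

  nodes≤ : 1 * suc (P ∸ 1) ≤ 1 * X
  nodes≤ = 1*≤ (ℕ.≤-trans (ℕ.≤-reflexive nodes≡) area≤X)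

  outputSize≤ : 1 * suc (2 ℕ.^ d) * suc (2 ℕ.^ e) ≤ 4 * X
  outputSize≤ = ℕ.≤-trans (ℕ.≤-reflexive (cong (_* suc (2 ℕ.^ e)) (ℕ.*-identityˡ (suc (2 ℕ.^ d)))))
    (ℕ.≤-trans suc-area≤ (ℕ.*-monoʳ-≤ 4 area≤X))

  searchCost : ℕ
  searchCost = leavesCost 𝒮 * 4 + (mergeCost 𝒮 * 1 + (selectCost 𝒮 * 1 + (traceCost 𝒮 * 1 + outputCost 𝒮 * 4)))

  record Found (L : ℚ) (s : State) : Set where
    field
      {final}   : Tables
      choice    : ℕ → ℕ
      filled    : Filled final
      traced    : TracedTo 𝒮 P final choice
      best      : Selected 𝒮 final L (choice 1)
      written   : ∀ i → i < M → ∀ j → j < 2 ℕ.^ d → nats s 2 i j ≡ choice (2 ℕ.^ d * (M + i) + j)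

  run-search : ∀ {s L} → Env 𝒮 s → rats s 4 0 0 ≡ L →
    (∀ r c → nats s #flag r c ≡ 0) → (∀ r c → rats s #weight r c ≡ 0ℚ) → nats s #found 0 0 ≡ 0 →
    Scaled X (fillLeaves ⨾ mergeTables ⨾ selectRoot ⨾ traceTables ⨾ writeOutput) s searchCost (Found L)
  run-search {s} {L} E L≡ no-flags no-weights found≡0 = recost refl $
    keep* (framed* 17 (scale (leavesCost 𝒮) 4 leavesSize≤ (run-fillLeaves 𝒮 E no-flags no-weights)))
      >>=* λ {s₁} (k₁ , A₁ , leaves) → let E₁ = Env-Agree 𝒮 A₁ E in
    keep* (framed* 17 (scale (mergeCost 𝒮) 1 mergeSize≤ (run-mergeTables 𝒮 E₁ leaves)))
      >>=* λ {s₂} (k₂ , A₂ , filled) → let E₂ = Env-Agree 𝒮 A₂ E₁ in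
    framed* 26 (scale (selectCost 𝒮) 1 (1*≤ R≤X) (run-selectRoot 𝒮 E₂
        (trans (at (Agree-trans A₁ A₂) rat 4 0 0) L≡)
        (trans (kept k₂ nat #found 0 0) (trans (kept k₁ nat #found 0 0) found≡0))))
      >>=* λ {s₃} (A₃ , best) → let E₃ = Env-Agree 𝒮 A₃ E₂ in
    framed* 26 (scale (traceCost 𝒮) 1 nodes≤ (run-traceTables 𝒮 E₃))
      >>=* λ {s₄} (A₄ , x₁ , traced) →
    map* (λ written → record
        { choice  = chosenAt s₄
        ; filled  = filled
        ; traced  = TracedTo-cong 𝒮 {t = tableOf s₃} {tableOf s₂}
            (λ r c → sym (at A₃ nat #left r c)) (λ r c → sym (at A₃ nat #right r c)) traced
        ; best    = subst (Selected 𝒮 (tableOf s₂) L) (sym x₁) best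
        ; written = written
        })
      (scale (outputCost 𝒮) 4 outputSize≤
        (run-writeOutput 𝒮 (Env-Agree 𝒮 A₄ E₃)))

module _ (I : Instance) {ε : ℚ} (0<ε : 0ℚ <ℚ ε) (ε<1 : ε <ℚ 1ℚ) where
  open Instance I
  open Preparation ε

  module _ {d e κ : ℕ} {s₁ : State} (p : Prepared I ε d e s₁)
    (total≤ : allValues I (2 ℕ.^ e) (2 ℕ.^ d) ≤ℚ rats s₁ #base 0 0 *ℚ factor ε d e ^ κ)
    (total≰ : ∀ j → j < κ → ¬ allValues I (2 ℕ.^ e) (2 ℕ.^ d) ≤ℚ rats s₁ #base 0 0 *ℚ factor ε d e ^ j) where
    open Prepared p

    setup : Setup I ε
    setup = record
      { d = d ; e = e ; κ = κ ; b = rats s₁ #base 0 0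
      ; 1≤d = 1≤d ; m≤M = m≤M ; M≤2m = M≤2m ; size≤ = size≤ ; width≤ = width≤
      ; 0<b = 0<b ; vmin≤b = vmin≤b ; b≤ = b≤ ; total≤ = total≤ ; total≰ = total≰ }

    open Rounding 0<ε ε<1 setup using (grid; scheme; atLeaf≡; output-approximates)

    env : ∀ {s} → Agree 15 s₁ s → nats s #top 0 0 ≡ suc κ →
      (∀ c → rats s #grid c 0 ≡ grid c) → Env scheme s
    env A top≡ grid≡ = record
      { width≡  = trans (at A nat #width 0 0) width≡
      ; count≡  = trans (at A nat #count 0 0) count≡
      ; factor≡ = trans (at A rat #factor 0 0) factor≡
      ; top≡    = top≡
      ; grid≡   = grid≡
      ; lo≡     = λ i → trans (at A rat 2 i 0) (at inputs rat 2 i 0)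
      ; hi≡     = λ i → trans (at A rat 3 i 0) (at inputs rat 3 i 0)
      ; val≡    = λ {i} {j} _ j<n → trans (trans (at A rat 1 i j) (at inputs rat 1 i j))
                    (sym (atLeaf≡ (table I v) i j<n))
      ; wt≡     = λ {i} {j} _ j<n → trans (trans (at A rat 0 i j) (at inputs rat 0 i j))
                    (sym (atLeaf≡ (table I w) i j<n))
      }

    Gridded : State → Set
    Gridded s = nats s #top 0 0 ≡ suc κ × (∀ c → rats s #grid c 0 ≡ grid c)

    run-grid : (∀ c → rats s₁ #grid c 0 ≡ 0ℚ) → Scaled (Search.X scheme) buildGrid s₁ (gridCost ε * 1) Gridded
    run-grid no-grid = scale (gridCost ε) 1 suc-κ≤ $
      run-buildGrid ε {s₁} {factor ε d e} {rats s₁ #base 0 0} {allValues I (2 ℕ.^ e) (2 ℕ.^ d)} κ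
        factor≡ refl total≡ no-grid total≤ total≰
      where
      suc-κ≤ : suc κ ≤ 1 * Search.X scheme
      suc-κ≤ = ℕ.≤-trans (ℕ.≤-trans (ℕ.≤-trans (ℕ.n≤1+n (suc κ)) (ℕ.n≤1+n _)) (Search.R≤X scheme))
        (ℕ.≤-reflexive (sym (ℕ.*-identityˡ (Search.X scheme))))

    afterCost : ℕ
    afterCost = gridCost ε * 1 + Search.searchCost scheme

    run-main : Keeps (prepare ε) (input I) s₁ →
      Scaled (Search.X scheme) (search ε) s₁ afterCost (Search.Found scheme L)
    run-main k = keep* (framed* 15 (run-grid (λ c → kept k rat #grid c 0)))
      >>=* λ {s₂} (k′ , A , top≡ , grid≡) →
      Search.run-search scheme (env A top≡ grid≡) (trans (at A rat 4 0 0) (at inputs rat 4 0 0))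
        (λ r c → trans (kept k′ nat #flag r c) (kept k nat #flag r c))
        (λ r c → trans (kept k′ rat #weight r c) (kept k rat #weight r c))
        (trans (kept k′ nat #found 0 0) (kept k nat #found 0 0))

    found-approximates : ∀ {s} → Search.Found scheme L s → (∃[ S ] Feasible I S) → ApproxSolution I ε (output I s)
    found-approximates {s} f = output-approximates (Search.Found.filled f) (Search.Found.choice f)
      (Search.Found.traced f) (Search.Found.best f) {s} (Search.Found.written f)

-- The running time

fromℕ-ratio : ∀ k c y → 0ℚ ≤ℚ y → k * ↧ₙ y ≤ c * ℤ.∣ ↥ y ∣ → fromℕ k ≤ℚ fromℕ c *ℚ y
fromℕ-ratio k c y 0≤y le = *-cancelʳ (fromℕ-pos {↧ₙ y} (ℕ.>-nonZero⁻¹ (↧ₙ y))) $ begin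
  fromℕ k *ℚ fromℕ (↧ₙ y)          ≡⟨ fromℕ-* k (↧ₙ y) ⟨
  fromℕ (k * ↧ₙ y)                 ≤⟨ fromℕ-mono le ⟩
  fromℕ (c * ℤ.∣ ↥ y ∣)            ≡⟨ fromℕ-* c ℤ.∣ ↥ y ∣ ⟩
  fromℕ c *ℚ fromℕ ℤ.∣ ↥ y ∣       ≡⟨ cong (fromℕ c *ℚ_) (↧*p≡↥ y 0≤y) ⟨
  fromℕ c *ℚ (y *ℚ fromℕ (↧ₙ y))   ≡⟨ ℚ.*-assoc (fromℕ c) y (fromℕ (↧ₙ y)) ⟨
  fromℕ c *ℚ y *ℚ fromℕ (↧ₙ y)     ∎
  where open ℚ.≤-Reasoning

-- k ≤ log_β a = log_β b · log_b a ≤ c · log_b a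
exponent≤ : ∀ {β b a y} k c → 1ℚ <ℚ β → 0ℚ ≤ℚ b → b ≤ℚ β ^ c → β ^ k ≤ℚ a →
  Log⁺[ b , a ]≤ y → fromℕ k ≤ℚ fromℕ c *ℚ y
exponent≤ {β} {b} {a} {y} k c 1<β 0≤b b≤ ≤a (1≤y , a≤) =
  fromℕ-ratio k c y (ℚ.≤-trans 0≤1 1≤y) $
  ^-cancelˡ-≤ (k * q) (c * p) 1<β $ begin
    β ^ (k * q)      ≡⟨ ^.^-assocʳ β k q ⟨
    (β ^ k) ^ q      ≤⟨ ^-monoˡ q (^-nonNeg k 0≤β) ≤a ⟩
    a ^ q            ≤⟨ a≤ ⟩
    b ^ p            ≤⟨ ^-monoˡ p 0≤b b≤ ⟩
    (β ^ c) ^ p      ≡⟨ ^.^-assocʳ β c p ⟩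
    β ^ (c * p)      ∎
  where
  open ℚ.≤-Reasoning
  q = ↧ₙ y
  p = ℤ.∣ ↥ y ∣
  0≤β = ℚ.≤-trans 0≤1 (ℚ.<⇒≤ 1<β)

[4+d]³≤ : ∀ d → (4 + d) * (4 + d) * (4 + d) ≤ 64 * 2 ℕ.^ d
[4+d]³≤ zero    = ℕ.≤-refl
[4+d]³≤ (suc d) = begin
  (5 + d) * (5 + d) * (5 + d)
    ≤⟨ ℕ.m≤m+n _ (3 + 21 * d + 9 * d * d + d * d * d) ⟩
  (5 + d) * (5 + d) * (5 + d) + (3 + 21 * d + 9 * d * d + d * d * d)
    ≡⟨ solve 1 (λ d → (con 5 :+ d) :* (con 5 :+ d) :* (con 5 :+ d)
         :+ (con 3 :+ con 21 :* d :+ con 9 :* d :* d :+ d :* d :* d)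
         := con 2 :* ((con 4 :+ d) :* (con 4 :+ d) :* (con 4 :+ d))) refl d ⟩
  2 * ((4 + d) * (4 + d) * (4 + d))  ≤⟨ ℕ.*-monoʳ-≤ 2 ([4+d]³≤ d) ⟩
  2 * (64 * 2 ℕ.^ d)                 ≡⟨ solve 1 (λ p → con 2 :* (con 64 :* p) := con 64 :* (con 2 :* p)) refl (2 ℕ.^ d) ⟩
  64 * (2 * 2 ℕ.^ d)                 ∎
  where
  open ℕ.≤-Reasoning
  open ℕ-Solver

1<2 : 1ℚ <ℚ fromℕ 2
1<2 = toWitness {a? = 1ℚ ℚ.<? fromℕ 2} _

module _ {I : Instance} {ε : ℚ} (0<ε : 0ℚ <ℚ ε) (ε<1 : ε <ℚ 1ℚ) (setup : Setup I ε)
  {x y : ℚ} (log-m : Log⁺[ fromℕ 2 , fromℕ (Instance.m I) ]≤ x)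
  (log-ratio : Log⁺[ 1ℚ +ℚ ε , fromℕ (itemCount I) *ℚ vmax I ÷₀ vmin I ]≤ y) where
  open Instance I
  open Setup setup
  open Rounding 0<ε ε<1 setup using (D; 1<factor; 0≤factor; ≤factor^2D)

  1≤x : 1ℚ ≤ℚ x
  1≤x = proj₁ log-m

  1≤y : 1ℚ ≤ℚ y
  1≤y = proj₁ log-ratio

  0≤x : 0ℚ ≤ℚ x
  0≤x = ℚ.≤-trans 0≤1 1≤x

  0≤y : 0ℚ ≤ℚ y
  0≤y = ℚ.≤-trans 0≤1 1≤y

  levels-from : ∀ k → 2 ℕ.^ k ≤ 2 * m → fromℕ k ≤ℚ 1ℚ +ℚ x
  levels-from zero    _     = +-nonNeg 0≤1 0≤x
  levels-from (suc k) 2ᵏ≤2m = begin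
    fromℕ (suc k)         ≡⟨ fromℕ-suc k ⟩
    1ℚ +ℚ fromℕ k         ≤⟨ ℚ.+-monoʳ-≤ 1ℚ (exponent≤ {fromℕ 2} {fromℕ 2} {fromℕ m} {x} k 1 1<2
                               (fromℕ-nonNeg 2) (ℚ.≤-reflexive (sym (ℚ.*-identityʳ (fromℕ 2)))) 2ᵏ≤m log-m) ⟩
    1ℚ +ℚ 1ℚ *ℚ x         ≡⟨ cong (1ℚ +ℚ_) (ℚ.*-identityˡ x) ⟩
    1ℚ +ℚ x               ∎
    where
    open ℚ.≤-Reasoning
    ℕ-2ᵏ≤m : 2 ℕ.^ k ≤ m
    ℕ-2ᵏ≤m = ℕ.*-cancelˡ-≤ 2 2ᵏ≤2m
    2ᵏ≤m : fromℕ 2 ^ k ≤ℚ fromℕ m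
    2ᵏ≤m = ℚ.≤-trans (ℚ.≤-reflexive (sym (fromℕ-^ 2 k))) (fromℕ-mono ℕ-2ᵏ≤m)

  levels≤ : fromℕ e ≤ℚ 1ℚ +ℚ x
  levels≤ = levels-from e M≤2m

  depth≤ : fromℕ D ≤ℚ fromℕ (4 + d) *ℚ x
  depth≤ = begin
    fromℕ (1 + (d + e))                     ≡⟨ trans (fromℕ-suc (d + e)) (cong (1ℚ +ℚ_) (fromℕ-+ d e)) ⟩
    1ℚ +ℚ (fromℕ d +ℚ fromℕ e)              ≤⟨ ℚ.+-monoʳ-≤ 1ℚ (ℚ.+-monoʳ-≤ (fromℕ d) levels≤) ⟩
    1ℚ +ℚ (fromℕ d +ℚ (1ℚ +ℚ x))            ≤⟨ ≤-fromDifference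
                                                 ((x -ℚ 1ℚ) *ℚ (fromℕ 3 +ℚ fromℕ d) +ℚ 1ℚ)
                                                 (+-nonNeg (*-nonNeg (0≤q-p 1≤x) (+-nonNeg (fromℕ-nonNeg 3) (fromℕ-nonNeg d))) 0≤1)
                                                 (solve 2 (λ x d → (con (fromℕ 4) :+ d) :* x :=
                                                   con 1ℚ :+ (d :+ (con 1ℚ :+ x)) :+ ((x :- con 1ℚ) :* (con (fromℕ 3) :+ d) :+ con 1ℚ))
                                                   refl x (fromℕ d)) ⟩
    (fromℕ 4 +ℚ fromℕ d) *ℚ x               ≡⟨ cong (_*ℚ x) (fromℕ-+ 4 d) ⟨
    fromℕ (4 + d) *ℚ x                      ∎
    where
    open ℚ.≤-Reasoning
    open ℚ-Solver

  power≤ratio : ∀ k → ¬ allValues I (2 ℕ.^ e) (2 ℕ.^ d) ≤ℚ b *ℚ factor ε d e ^ k →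
    factor ε d e ^ k *ℚ vmin I ≤ℚ fromℕ (itemCount I) *ℚ vmax I
  power≤ratio k above = begin
    factor ε d e ^ k *ℚ vmin I           ≤⟨ *-monoʳ (^-nonNeg k 0≤factor) vmin≤b ⟩
    factor ε d e ^ k *ℚ b                ≡⟨ ℚ.*-comm (factor ε d e ^ k) b ⟩
    b *ℚ factor ε d e ^ k                ≤⟨ ℚ.<⇒≤ (ℚ.≰⇒> above) ⟩
    allValues I (2 ℕ.^ e) (2 ℕ.^ d)      ≤⟨ allValues≤ I m≤M size≤ ⟩
    fromℕ (itemCount I) *ℚ vmax I        ∎
    where open ℚ.≤-Reasoning

  grid-from : ∀ k → (∀ j → j < k → ¬ allValues I (2 ℕ.^ e) (2 ℕ.^ d) ≤ℚ b *ℚ factor ε d e ^ j) →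
    fromℕ k ≤ℚ 1ℚ +ℚ fromℕ (2 * D) *ℚ y
  grid-from zero    _     = +-nonNeg 0≤1 (*-nonNeg (fromℕ-nonNeg (2 * D)) 0≤y)
  grid-from (suc k) above = begin
    fromℕ (suc k)                     ≡⟨ fromℕ-suc k ⟩
    1ℚ +ℚ fromℕ k                     ≤⟨ ℚ.+-monoʳ-≤ 1ℚ (exponent≤ {factor ε d e} {1ℚ +ℚ ε} {a} {y} k (2 * D)
                                           1<factor (+-nonNeg 0≤1 (ℚ.<⇒≤ 0<ε))
                                           ≤factor^2D
                                           (≤-÷₀ (vmin-pos I) (power≤ratio k (above k ℕ.≤-refl))) log-ratio) ⟩
    1ℚ +ℚ fromℕ (2 * D) *ℚ y         ∎
    where
    open ℚ.≤-Reasoning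
    a = fromℕ (itemCount I) *ℚ vmax I ÷₀ vmin I

  grid-length≤ : fromℕ κ ≤ℚ 1ℚ +ℚ fromℕ (2 * D) *ℚ y
  grid-length≤ = grid-from κ total≰

  rows≤ : fromℕ (3 + κ) ≤ℚ fromℕ 6 *ℚ (fromℕ (4 + d) *ℚ x *ℚ y)
  rows≤ = begin
    fromℕ (3 + κ)                                   ≡⟨ fromℕ-+ 3 κ ⟩
    fromℕ 3 +ℚ fromℕ κ                              ≤⟨ ℚ.+-monoʳ-≤ (fromℕ 3) grid-length≤ ⟩
    fromℕ 3 +ℚ (1ℚ +ℚ fromℕ (2 * D) *ℚ y)          ≡⟨ cong (λ z → fromℕ 3 +ℚ (1ℚ +ℚ z *ℚ y)) (fromℕ-* 2 D) ⟩
    fromℕ 3 +ℚ (1ℚ +ℚ fromℕ 2 *ℚ fromℕ D *ℚ y)     ≤⟨ ≤-fromDifference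
                                                         (fromℕ 4 *ℚ (fromℕ D *ℚ y -ℚ 1ℚ))
                                                         (*-nonNeg (fromℕ-nonNeg 4) (0≤q-p 1≤Dy))
                                                         (solve 2 (λ D y → con (fromℕ 6) :* (D :* y) :=
                                                           con (fromℕ 3) :+ (con 1ℚ :+ con (fromℕ 2) :* D :* y) :+ con (fromℕ 4) :* (D :* y :- con 1ℚ))
                                                           refl (fromℕ D) y) ⟩
    fromℕ 6 *ℚ (fromℕ D *ℚ y)                      ≤⟨ *-monoʳ (fromℕ-nonNeg 6) (*-monoˡ 0≤y depth≤) ⟩
    fromℕ 6 *ℚ (fromℕ (4 + d) *ℚ x *ℚ y)            ∎
    where
    open ℚ.≤-Reasoning
    open ℚ-Solver
    1≤Dy : 1ℚ ≤ℚ fromℕ D *ℚ y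
    1≤Dy = ℚ.≤-trans 1≤y (q≤p*q (fromℕ-1≤ {D} (s≤s z≤n)) 0≤y)

  n : ℕ
  n = maxSize I

  cube≤ : fromℕ (4 + d) *ℚ fromℕ (4 + d) *ℚ fromℕ (4 + d) ≤ℚ fromℕ 128 *ℚ fromℕ n
  cube≤ = begin
    fromℕ (4 + d) *ℚ fromℕ (4 + d) *ℚ fromℕ (4 + d)
      ≡⟨ trans (fromℕ-* ((4 + d) * (4 + d)) (4 + d)) (cong (_*ℚ fromℕ (4 + d)) (fromℕ-* (4 + d) (4 + d))) ⟨
    fromℕ ((4 + d) * (4 + d) * (4 + d))
      ≤⟨ fromℕ-mono (ℕ.≤-trans ([4+d]³≤ d) (ℕ.≤-trans (ℕ.*-monoʳ-≤ 64 width≤)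
           (ℕ.≤-reflexive (sym (ℕ.*-assoc 64 2 n))))) ⟩
    fromℕ (128 * n)
      ≡⟨ fromℕ-* 128 n ⟩
    fromℕ 128 *ℚ fromℕ n ∎
    where open ℚ.≤-Reasoning

  area≤4nm : fromℕ (2 ℕ.^ d * 2 ℕ.^ e) ≤ℚ fromℕ 4 *ℚ fromℕ n *ℚ fromℕ m
  area≤4nm = begin
    fromℕ (2 ℕ.^ d * 2 ℕ.^ e)         ≤⟨ fromℕ-mono (ℕ.*-mono-≤ width≤ M≤2m) ⟩
    fromℕ (2 * n * (2 * m))           ≡⟨ cong fromℕ (solve 2 (λ n m → con 2 :* n :* (con 2 :* m) := con 4 :* n :* m) refl n m) ⟩
    fromℕ (4 * n * m)                 ≡⟨ trans (fromℕ-* (4 * n) m) (cong (_*ℚ fromℕ m) (fromℕ-* 4 n)) ⟩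
    fromℕ 4 *ℚ fromℕ n *ℚ fromℕ m     ∎
    where
    open ℚ.≤-Reasoning
    open ℕ-Solver

  -- 110592 = 4 · 6³ · 128
  volume≤ : fromℕ (2 ℕ.^ d * 2 ℕ.^ e * ((3 + κ) * (3 + κ) * (3 + κ))) ≤ℚ
    fromℕ 110592 *ℚ fromℕ n ^ 2 *ℚ fromℕ m *ℚ x ^ 3 *ℚ y ^ 3
  volume≤ = begin
    fromℕ (area * (r * r * r))
      ≡⟨ trans (fromℕ-* area (r * r * r)) (cong (fromℕ area *ℚ_)
           (trans (fromℕ-* (r * r) r) (cong (_*ℚ fromℕ r) (fromℕ-* r r)))) ⟩
    fromℕ area *ℚ (fromℕ r *ℚ fromℕ r *ℚ fromℕ r)
      ≤⟨ *-mono (*-nonNeg (*-nonNeg (fromℕ-nonNeg 4) (fromℕ-nonNeg n)) (fromℕ-nonNeg m))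
           (*-nonNeg (*-nonNeg 0≤r 0≤r) 0≤r) area≤4nm
           (*-mono (*-nonNeg 0≤s 0≤s) 0≤r (*-mono 0≤s 0≤r rows≤ rows≤) rows≤) ⟩
    fromℕ 4 *ℚ fromℕ n *ℚ fromℕ m *ℚ (s *ℚ s *ℚ s)
      ≡⟨ solve 5 (λ n m g x y →
           let s = con (fromℕ 6) :* (g :* x :* y) in
           con (fromℕ 4) :* n :* m :* (s :* s :* s) :=
           con (fromℕ 864) :* n :* m :* (x :* x :* x) :* (y :* y :* y) :* (g :* g :* g))
           refl (fromℕ n) (fromℕ m) g x y ⟩
    fromℕ 864 *ℚ fromℕ n *ℚ fromℕ m *ℚ (x *ℚ x *ℚ x) *ℚ (y *ℚ y *ℚ y) *ℚ (g *ℚ g *ℚ g)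
      ≤⟨ *-monoʳ (*-nonNeg (*-nonNeg (*-nonNeg (*-nonNeg (fromℕ-nonNeg 864) (fromℕ-nonNeg n)) (fromℕ-nonNeg m))
           (*-nonNeg (*-nonNeg 0≤x 0≤x) 0≤x)) (*-nonNeg (*-nonNeg 0≤y 0≤y) 0≤y)) cube≤ ⟩
    fromℕ 864 *ℚ fromℕ n *ℚ fromℕ m *ℚ (x *ℚ x *ℚ x) *ℚ (y *ℚ y *ℚ y) *ℚ (fromℕ 128 *ℚ fromℕ n)
      ≡⟨ solve 4 (λ n m x y →
           con (fromℕ 864) :* n :* m :* (x :* x :* x) :* (y :* y :* y) :* (con (fromℕ 128) :* n) :=
           con (fromℕ 110592) :* (n :* (n :* con 1ℚ)) :* m :* (x :* (x :* (x :* con 1ℚ))) :* (y :* (y :* (y :* con 1ℚ))))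
           refl (fromℕ n) (fromℕ m) x y ⟩
    fromℕ 110592 *ℚ fromℕ n ^ 2 *ℚ fromℕ m *ℚ x ^ 3 *ℚ y ^ 3 ∎
    where
    open ℚ.≤-Reasoning
    open ℚ-Solver
    area = 2 ℕ.^ d * 2 ℕ.^ e
    r = 3 + κ
    g = fromℕ (4 + d)
    s = fromℕ 6 *ℚ (g *ℚ x *ℚ y)
    0≤r = fromℕ-nonNeg r
    0≤s = ℚ.≤-trans 0≤r rows≤

grid-exists : ∀ {β b} V → 0ℚ <ℚ β → 0ℚ <ℚ b →
  ∃[ κ ] (V ≤ℚ b *ℚ (1ℚ +ℚ β) ^ κ × (∀ j → j < κ → ¬ V ≤ℚ b *ℚ (1ℚ +ℚ β) ^ j))
grid-exists {β} {b} V 0<β 0<b =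
  let n , V/b≤ = ^-unbounded (V ÷₀ b) 0<β
      V≤ = ℚ.≤-trans (ℚ.≤-reflexive (trans (sym (÷₀-* V 0<b)) (ℚ.*-comm (V ÷₀ b) b)))
             (*-monoʳ (ℚ.<⇒≤ 0<b) V/b≤)
      κ , _ , enough , minimal = least (λ k → V ℚ.≤? b *ℚ (1ℚ +ℚ β) ^ k) n V≤
  in κ , enough , minimal

-- 2414 is the sum of the constant factors of all phases.
phasesCost constantFactor : ℕ
phasesCost     = 2414
constantFactor = phasesCost * 110592

Halts : (ε : ℚ) (I : Instance) → Program → Set
Halts ε I A = ∃[ s ] ∃[ t ]
  (⟨ A , input I ⟩⇓⟨ s , t ⟩ × WithinBound constantFactor ε I t ×
   ((∃[ S ] Feasible I S) → ApproxSolution I ε (output I s)))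

module _ {ε : ℚ} (0<ε : 0ℚ <ℚ ε) (ε<1 : ε <ℚ 1ℚ) (I : Instance) where

  halts-from : ∀ {d e s₁ t₁} → ⟨ prepare ε , input I ⟩⇓⟨ s₁ , t₁ ⟩ →
    t₁ ≤ prepareCost I ε * (2 ℕ.^ d * 2 ℕ.^ e) → (p : Prepared I ε d e s₁) →
    ∃[ κ ] (allValues I (2 ℕ.^ e) (2 ℕ.^ d) ≤ℚ rats s₁ #base 0 0 *ℚ factor ε d e ^ κ ×
      (∀ j → j < κ → ¬ allValues I (2 ℕ.^ e) (2 ℕ.^ d) ≤ℚ rats s₁ #base 0 0 *ℚ factor ε d e ^ j)) →
    Halts ε I (algorithm ε)
  halts-from {d} {e} {s₁} {t₁} exec t₁≤ p (κ , total≤ , total≰) =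
    combine (Scaled.unscaled (run-main I 0<ε ε<1 p total≤ total≰ (keeping λ τ a {q} → exec-untouched τ a q exec)))
    where
    st = setup I 0<ε ε<1 p total≤ total≰
    𝒯 = Rounding.scheme 0<ε ε<1 st
    V = 2 ℕ.^ d * 2 ℕ.^ e * ((3 + κ) * (3 + κ) * (3 + κ))
    combine : Run (search ε) s₁ (afterCost I 0<ε ε<1 p total≤ total≰ * V) (Search.Found 𝒯 (Instance.L I)) →
      Halts ε I (algorithm ε)
    combine (run {s₂} {t₂} exec′ t₂≤ found) =
      s₂ , t₁ + t₂ , seq exec exec′ , bound , found-approximates I 0<ε ε<1 p total≤ total≰ {s₂} found
      where
      t≤ : t₁ + t₂ ≤ phasesCost * V
      t≤ = ℕ.≤-trans
        (ℕ.+-mono-≤ (ℕ.≤-trans t₁≤ (ℕ.*-monoʳ-≤ (prepareCost I ε) (Search.area≤X 𝒯))) t₂≤)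
        (ℕ.≤-reflexive (sym (ℕ.*-distribʳ-+ V (prepareCost I ε) (afterCost I 0<ε ε<1 p total≤ total≰))))
      bound : WithinBound constantFactor ε I (t₁ + t₂)
      bound x y log-m log-ratio = ≤-÷₀ 0<ε $ begin
        fromℕ (t₁ + t₂) *ℚ ε         ≤⟨ *-monoʳ (fromℕ-nonNeg (t₁ + t₂)) (ℚ.<⇒≤ ε<1) ⟩
        fromℕ (t₁ + t₂) *ℚ 1ℚ        ≡⟨ ℚ.*-identityʳ (fromℕ (t₁ + t₂)) ⟩
        fromℕ (t₁ + t₂)              ≤⟨ fromℕ-mono t≤ ⟩
        fromℕ (phasesCost * V)       ≡⟨ fromℕ-* phasesCost V ⟩
        fromℕ phasesCost *ℚ fromℕ V  ≤⟨ *-monoʳ (fromℕ-nonNeg phasesCost) (volume≤ 0<ε ε<1 st log-m log-ratio) ⟩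
        fromℕ phasesCost *ℚ (fromℕ 110592 *ℚ n² *ℚ m′ *ℚ x ^ 3 *ℚ y ^ 3)
          ≡⟨ solve 6 (λ c k n m x y → c :* (k :* n :* m :* x :* y) := c :* k :* n :* m :* x :* y) refl
               (fromℕ phasesCost) (fromℕ 110592) n² m′ (x ^ 3) (y ^ 3) ⟩
        fromℕ phasesCost *ℚ fromℕ 110592 *ℚ n² *ℚ m′ *ℚ x ^ 3 *ℚ y ^ 3
          ≡⟨ cong (λ c → c *ℚ n² *ℚ m′ *ℚ x ^ 3 *ℚ y ^ 3) (fromℕ-* phasesCost 110592) ⟨
        fromℕ constantFactor *ℚ n² *ℚ m′ *ℚ x ^ 3 *ℚ y ^ 3 ∎
        where
        open ℚ.≤-Reasoning
        open ℚ-Solver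
        n² = fromℕ (maxSize I) ^ 2
        m′ = fromℕ (Instance.m I)

  halts : Halts ε I (algorithm ε)
  halts = from (run-prepare I ε)
    where
    from : ∃[ d ] ∃[ e ] Scaled (2 ℕ.^ d * 2 ℕ.^ e) (prepare ε) (input I) (prepareCost I ε) (Prepared I ε d e) →
      Halts ε I (algorithm ε)
    from (d , e , scaled (run {s₁} exec t≤ p)) = halts-from exec t≤ p
      (grid-exists (allValues I (2 ℕ.^ e) (2 ℕ.^ d)) (step-pos d e 0<ε) (Prepared.0<b p))

-- For ε ≥ 1 the empty selection approximates every instance.
module _ {ε : ℚ} (1≤ε : 1ℚ ≤ℚ ε) (I : Instance) where
  open Instance I

  sum-zero : ∀ {n} {g : Fin n → ℚ} → (∀ i → g i ≡ 0ℚ) → sum g ≡ 0ℚ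
  sum-zero {zero}  g≡0 = refl
  sum-zero {suc n} g≡0 = cong₂ _+ℚ_ (g≡0 Fin.zero) (sum-zero (g≡0 ∘ Fin.suc))

  sum-nonNeg : ∀ {n} {g : Fin n → ℚ} → (∀ i → 0ℚ ≤ℚ g i) → 0ℚ ≤ℚ sum g
  sum-nonNeg {zero}  0≤g = ℚ.≤-refl
  sum-nonNeg {suc n} 0≤g = +-nonNeg (0≤g Fin.zero) (sum-nonNeg (0≤g ∘ Fin.suc))

  if-nonNeg : ∀ b {p} → 0ℚ ≤ℚ p → 0ℚ ≤ℚ (if b then p else 0ℚ)
  if-nonNeg true  0≤p = 0≤p
  if-nonNeg false _   = ℚ.≤-refl

  category-empty : ∀ f i → categorySum I f (output I (input I)) i ≡ 0ℚ
  category-empty f i = sum-zero λ j →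
    cong (λ b → if b then f i j else 0ℚ) (Vec.lookup∘tabulate (λ _ → false) j)

  total-empty : ∀ f → sum (categorySum I f (output I (input I))) ≡ 0ℚ
  total-empty f = sum-zero (category-empty f)

  1-ε*≤0 : ∀ {p} → 0ℚ ≤ℚ p → (1ℚ -ℚ ε) *ℚ p ≤ℚ 0ℚ
  1-ε*≤0 {p} 0≤p = ℚ.≤-trans (*-monoˡ 0≤p 1-ε≤0) (ℚ.≤-reflexive (ℚ.*-zeroˡ p))
    where
    1-ε≤0 : 1ℚ -ℚ ε ≤ℚ 0ℚ
    1-ε≤0 = ℚ.≤-trans (ℚ.+-monoˡ-≤ (ℚ.- ε) 1≤ε) (ℚ.≤-reflexive (ℚ.+-inverseʳ ε))

  empty-approximates : ApproxSolution I ε (output I (input I))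
  empty-approximates =
    (λ W ((S , _ , weight≡W) , _) → ℚ.≤-trans (ℚ.≤-reflexive (total-empty w)) $
      ℚ.≤-trans (sum-nonNeg λ i → sum-nonNeg λ j → if-nonNeg (lookup (S i) j) (w≥0 i j))
        (ℚ.≤-reflexive weight≡W)) ,
    (λ k → ℚ.≤-trans (1-ε*≤0 (l≥0 k)) (ℚ.≤-reflexive (sym (category-empty v k))) ,
      ℚ.≤-trans (ℚ.≤-reflexive (category-empty v k))
        (*-nonNeg (+-nonNeg 0≤1 (ℚ.≤-trans 0≤1 1≤ε)) (ℚ.≤-trans (l≥0 k) (l≤u k)))) ,
    ℚ.≤-trans (1-ε*≤0 L≥0) (ℚ.≤-reflexive (sym (total-empty v)))

  skip-halts : Halts ε I skip
  skip-halts = input I , 0 , skip , bound , λ _ → empty-approximates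
    where
    bound : WithinBound constantFactor ε I 0
    bound x y (1≤x , _) (1≤y , _) = ≤-÷₀ (ℚ.<-≤-trans 0<1 1≤ε) $
      ℚ.≤-trans (ℚ.≤-reflexive (ℚ.*-zeroˡ ε)) $
      *-nonNeg (*-nonNeg (*-nonNeg (*-nonNeg (fromℕ-nonNeg constantFactor)
        (^-nonNeg 2 (fromℕ-nonNeg (maxSize I)))) (fromℕ-nonNeg m))
        (^-nonNeg 3 (ℚ.≤-trans 0≤1 1≤x))) (^-nonNeg 3 (ℚ.≤-trans 0≤1 1≤y))

theorem4p4 : ∃[ C ] ((ε : ℚ) → 0ℚ <ℚ ε →
    Σ Program λ A → (I : Instance) →
    ∃[ s ] ∃[ t ]
    (⟨ A , input I ⟩⇓⟨ s , t ⟩ ×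
    WithinBound C ε I t ×
    ((∃[ S ] Feasible I S) → ApproxSolution I ε (output I s))))
theorem4p4 = constantFactor , λ ε 0<ε → case ε ℚ.<? 1ℚ of λ where
  (yes ε<1) → algorithm ε , halts 0<ε ε<1
  (no ε≮1)  → skip , skip-halts (ℚ.≮⇒≥ ε≮1)
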